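{- There exists a locally-iterative coloring algorithm such that, for any input graph $G=(V,E)$ with $n$ vertices and maximum degree $\Delta$, it produces a proper $(\Delta+1)$-coloring of $G$ within $O(\Delta^{3/4}\log\Delta)+\log^* n$ rounds, and every message it sends has $O(\log n)$ bits.
   Context: Model: synchronous message-passing model. The network is an undirected graph $G=(V,E)$ with $n$ vertices and maximum degree $\Delta$; each vertex hosts a processor and has a unique identifier $id(v)\in\{0,1,\dots,n-1\}$; $N(v)=\{u : (u,v)\in E\}$. In each synchronous round vertices perform local computation and exchange messages with their neighbors; the time complexity is the number of rounds until all vertices terminate (here: until the maintained coloring is a proper $(\Delta+1)$-coloring). A $q$-coloring is a map $\phi:V\to Q$ with $|Q|=q$; it is proper if $\phi(u)\neq\phi(v)$ for all $(u,v)\in E$; a $(\Delta+1)$-coloring uses colors from $\{0,\dots,\Delta\}$. Locally-iterative coloring algorithm: an algorithm that maintains a sequence of proper colorings $\phi_0,\phi_1,\phi_2,\dots$ of $G$ such that (i) for every vertex $v$, the initial color $\phi_0(v)$ is computed locally from $id(v)$ alone; (ii) in each round $t\ge 1$, every vertex $v$ broadcasts only its current color $\phi_{t-1}(v)$ to its neighbors, and computes $\phi_t(v)=\textsc{Update}(\phi_{t-1}(v),\{\{\phi_{t-1}(u): u\in N(v)\}\})$, where $\textsc{Update}$ is a single fixed rule (the same for all rounds and all vertices, oblivious to the round number and the vertex identity) applied to the current color and the multiset of the neighbors' current colors. -}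

module Defs where

open import Data.Nat using (ℕ; zero; suc; _+_; _*_; _^_; _≤_; _⊔_; _≤ᵇ_)
open import Data.Nat.Logarithm using (⌈log₂_⌉)
open import Data.Fin using (Fin; zero; suc; toℕ; _≟_)
open import Data.Bool using (Bool; true; false; if_then_else_; _∧_)
open import Relation.Nullary.Decidable using (⌊_⌋)
open import Relation.Binary.PropositionalEquality using (_≡_; _≢_)
open import Data.Product using (Σ; Σ-syntax; ∃; ∃-syntax; _×_)

sumFin : {n : ℕ} → (Fin n → ℕ) → ℕ
sumFin {zero}  f = 0
sumFin {suc n} f = f zero + sumFin (λ i → f (suc i))

maxFin : {n : ℕ} → (Fin n → ℕ) → ℕ
maxFin {zero}  f = 0
maxFin {suc n} f = f zero ⊔ maxFin (λ i → f (suc i))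

-- A simple undirected graph on vertex set Fin n; vertex v has identifier toℕ v.
record Graph (n : ℕ) : Set where
  field
    adj    : Fin n → Fin n → Bool
    sym    : ∀ u v → adj u v ≡ adj v u
    irrefl : ∀ v → adj v v ≡ false

open Graph public

degree : {n : ℕ} → Graph n → Fin n → ℕ
degree G v = sumFin (λ u → if adj G v u then 1 else 0)

maxDegree : {n : ℕ} → Graph n → ℕ
maxDegree G = maxFin (degree G)

Proper : {n : ℕ} {C : Set} → Graph n → (Fin n → C) → Set
Proper G φ = ∀ u v → adj G u v ≡ true → φ u ≢ φ v

-- Multiset of the neighbours' colors, represented by its multiplicity function.
nbrColors : {n M : ℕ} → Graph n → (Fin n → Fin M) → Fin n → (Fin M → ℕ)
nbrColors G φ v c = sumFin (λ u → if adj G v u ∧ ⌊ φ u ≟ c ⌋ then 1 else 0)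

-- A locally-iterative algorithm (for known parameters n, Δ):
-- a color space Fin M, an initial color computed from the identifier alone,
-- and a single fixed update rule on (own color, multiset of neighbour colors).
record LocIter (n Δ : ℕ) : Set where
  field
    M      : ℕ
    init   : Fin n → Fin M
    update : Fin M → (Fin M → ℕ) → Fin M

open LocIter public

run : {n Δ : ℕ} (A : LocIter n Δ) → Graph n → ℕ → Fin n → Fin (M A)
run A G zero    v = init A v
run A G (suc t) v = update A (run A G t v) (nbrColors G (run A G t) v)

ceil34 : ℕ → ℕ
ceil34 Δ = go 0 (suc Δ)
  where
  go : ℕ → ℕ → ℕ
  go k zero    = k
  go k (suc f) = if (Δ ^ 3) ≤ᵇ (k ^ 4) then k else go (suc k) f

logStar : ℕ → ℕ
logStar n = go n n
  where
  go : ℕ → ℕ → ℕ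
  go zero    m = 0
  go (suc f) m = if m ≤ᵇ 1 then 0 else suc (go f ⌈log₂ m ⌉)

roundBound : ℕ → ℕ → ℕ → ℕ
roundBound C n Δ = C * (ceil34 Δ * ⌈log₂ Δ ⌉ + 1) + logStar n

{-# OPTIONS --safe #-}
module Submission where

-- Colours carry the identifier and a state of O(log n) bits until all vertices switch to their
-- output at once, so properness matters only at the end.  Linial's algorithm, with sets
-- {(x, g(x))} for polynomials g modulo a prime whose coefficients are the binary digits of the
-- colour, gives a proper colouring with Δ^O(1) colours after exactly log* n rounds.
--
-- Then O(log Δ) stages each halve the maximum degree D of the graph of uncoloured vertices.
-- First, in round x < q every vertex v tries the class g_v(x) mod q and keeps it if at most β
-- neighbours compete for it; two curves meet O(log Δ) times, so everybody succeeds if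
-- qβ ≫ D log Δ, and inside a class every vertex has at most β out-neighbours.  Next the classes
-- are served one after the other.  The palette is laid out in a p × p grid; v chooses a
-- translate of its curve containing at least 1/p of its free colours, and then a free colour on
-- it that lies on no translate chosen by an out-neighbour.  This is possible as long as v still
-- has D/2 uncoloured neighbours, hence more than D/2 ≥ pβ · O(log Δ) free colours.  With
-- p = Õ(√Δ) and q = Õ(p), all stages together take Õ(√Δ) rounds, well within O(Δ^{3/4} log Δ).
--
-- Primes of the required size exist because k·C(n,k) divides lcm(1..n), whereas the latter is
-- at most n^N if no prime lies between N and n.

open import Defs renaming (sym to adj-sym)
open import Data.Bool using (Bool; true; false; if_then_else_; _∧_; _∨_; not)
open import Data.Empty using (⊥; ⊥-elim)
open import Data.Unit using (tt)
open import Data.Fin using (Fin; zero; suc; toℕ; fromℕ<)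
import Data.Fin as Fin
import Data.Fin.Properties as Finₚ
open import Data.Integer using (ℤ)
import Data.Integer as Int
import Data.Integer.Properties as ℤₚ
import Data.Integer.Divisibility.Signed as ℤ∣
import Data.Integer.Tactic.RingSolver as ℤ-Ring
open import Data.List using (List; []; _∷_; _++_; length)
import Data.List.Properties as Listₚ
import Data.List.Relation.Unary.All
open import Data.Maybe using (Maybe; just; nothing; maybe′; fromMaybe)
open import Data.Maybe.Properties using (just-injective)
open import Data.Nat
open import Data.Nat.Properties
open import Data.Nat.Combinatorics using (nCk+nC[k+1]≡[n+1]C[k+1]) renaming (_C_ to _choose_)
open import Data.Nat.Divisibility
open import Data.Nat.DivMod
open import Data.Nat.Induction using (<-rec)
open import Data.Nat.LCM using (lcm; m∣lcm[m,n]; n∣lcm[m,n]; lcm-least)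
open import Data.Nat.Logarithm
open import Data.Nat.Primality
open import Data.Nat.Primality.Factorisation using (factorise)
open import Data.Nat.Tactic.RingSolver using (solve-∀)
open import Data.Product using (Σ-syntax; ∃-syntax; _×_; _,_; proj₁; proj₂)
open import Data.Sum using (_⊎_; inj₁; inj₂; [_,_]′)
import Data.Sum as Sum
open import Data.Vec using (Vec; []; _∷_; zipWith)
open import Data.Vec.Relation.Unary.All using (All; []; _∷_)
open import Function using (_∘_; id)
open import Relation.Binary.PropositionalEquality
open import Relation.Nullary using (¬_; Dec; yes; no; contradiction)
open import Relation.Nullary.Decidable using (⌊_⌋; _×-dec_)

-- Binary logarithms

-- All vertices of a class can choose at once because a vertex avoids the entire translate of an
-- out-neighbour instead of the colour taken there, and each edge inside a class is an out-edge of
-- at least one of its ends. The price of this fixes the parameters. Confining a vertex to one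
-- translate costs a factor `p` of its more than D/2 free colours, and every out-neighbour blocks up
-- to `S` = O(log Δ) of what is left, so out-degrees up to β = D/(2pS) are affordable. A neighbour
-- competes in at most 2S rounds, so classifying needs q(β + 1) > 2SD, which `q` ≥ 4pS² guarantees.
-- This does not depend on `D`: one prime serves all stages, also those with β = 0. The palette fits
-- into the grid only if `p` > √Δ, whence roughly √Δ log⁵ Δ rounds for all stages; the factor
-- Δ^(1/4) to spare absorbs the extra logarithms. An update rule that is oblivious to the round
-- number forces the clock into the colour, so the running time has to be polynomial in n as well.

n≤2^⌈log₂n⌉ : ∀ n → n ≤ 2 ^ ⌈log₂ n ⌉
n≤2^⌈log₂n⌉ = <-rec _ go
  where
  n≤⌈n/2⌉+⌈n/2⌉ : ∀ n → n ≤ ⌈ n /2⌉ + ⌈ n /2⌉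
  n≤⌈n/2⌉+⌈n/2⌉ n = begin
    n                     ≡⟨ ⌊n/2⌋+⌈n/2⌉≡n n ⟨
    ⌊ n /2⌋ + ⌈ n /2⌉     ≤⟨ +-monoˡ-≤ ⌈ n /2⌉ (⌊n/2⌋≤⌈n/2⌉ n) ⟩
    ⌈ n /2⌉ + ⌈ n /2⌉     ∎
    where open ≤-Reasoning
  go : ∀ n → (∀ {m} → m < n → m ≤ 2 ^ ⌈log₂ m ⌉) → n ≤ 2 ^ ⌈log₂ n ⌉
  go zero rec = z≤n
  go (suc zero) rec = ≤-refl
  go n@(suc (suc k)) rec = begin
    n                                          ≤⟨ n≤⌈n/2⌉+⌈n/2⌉ n ⟩
    ⌈ n /2⌉ + ⌈ n /2⌉                          ≤⟨ +-mono-≤ half half ⟩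
    2 ^ (⌈log₂ n ⌉ ∸ 1) + 2 ^ (⌈log₂ n ⌉ ∸ 1)  ≡⟨ cong ((2 ^ (⌈log₂ n ⌉ ∸ 1)) +_) (+-identityʳ _) ⟨
    -- For n ≥ 2 the logarithm is at least 1, so the truncated subtraction is exact.
    2 ^ suc (⌈log₂ n ⌉ ∸ 1)                    ≡⟨ cong (2 ^_) (m+[n∸m]≡n {1} (⌈log₂⌉-mono-≤ {2} {n} (s≤s (s≤s z≤n)))) ⟩
    2 ^ ⌈log₂ n ⌉                              ∎
    where
    open ≤-Reasoning
    half : ⌈ n /2⌉ ≤ 2 ^ (⌈log₂ n ⌉ ∸ 1)
    half = subst (λ e → ⌈ n /2⌉ ≤ 2 ^ e) (⌈log₂⌈n/2⌉⌉≡⌈log₂n⌉∸1 n) (rec (⌈n/2⌉<n k))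

n≤2^k⇒⌈log₂n⌉≤k : ∀ {n} k → n ≤ 2 ^ k → ⌈log₂ n ⌉ ≤ k
n≤2^k⇒⌈log₂n⌉≤k {n} k n≤2^k = subst (⌈log₂ n ⌉ ≤_) (⌈log₂2^n⌉≡n k) (⌈log₂⌉-mono-≤ n≤2^k)

n<2^n : ∀ n → n < 2 ^ n
n<2^n zero = ≤-refl
n<2^n (suc n) = begin-strict
  suc n              <⟨ s≤s (n<2^n n) ⟩
  1 + 2 ^ n          ≤⟨ +-monoˡ-≤ (2 ^ n) (m^n>0 2 n) ⟩
  2 ^ n + 2 ^ n      ≡⟨ cong ((2 ^ n) +_) (+-identityʳ _) ⟨
  2 ^ suc n          ∎
  where open ≤-Reasoning

⌈log₂n⌉≤n : ∀ n → ⌈log₂ n ⌉ ≤ n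
⌈log₂n⌉≤n n = n≤2^k⇒⌈log₂n⌉≤k n (<⇒≤ (n<2^n n))

⌈log₂[1+n]⌉≤n : ∀ n → ⌈log₂ suc n ⌉ ≤ n
⌈log₂[1+n]⌉≤n n = n≤2^k⇒⌈log₂n⌉≤k n (n<2^n n)

⌈log₂m*n⌉≤ : ∀ m n → ⌈log₂ (m * n) ⌉ ≤ ⌈log₂ m ⌉ + ⌈log₂ n ⌉
⌈log₂m*n⌉≤ m n = n≤2^k⇒⌈log₂n⌉≤k (⌈log₂ m ⌉ + ⌈log₂ n ⌉) (begin
  m * n                        ≤⟨ *-mono-≤ (n≤2^⌈log₂n⌉ m) (n≤2^⌈log₂n⌉ n) ⟩
  2 ^ ⌈log₂ m ⌉ * 2 ^ ⌈log₂ n ⌉ ≡⟨ ^-distribˡ-+-* 2 ⌈log₂ m ⌉ ⌈log₂ n ⌉ ⟨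
  2 ^ (⌈log₂ m ⌉ + ⌈log₂ n ⌉)  ∎)
  where open ≤-Reasoning

-- Iterated logarithms, log* and the ceiling of Δ^(3/4)

iterLog : ℕ → ℕ → ℕ
iterLog n zero    = n
iterLog n (suc i) = ⌈log₂ iterLog n i ⌉

-- The recursions hidden in the where-blocks of logStar and ceil34 are recovered
-- as the unique solutions of the metavariables below.
mutual
  logStarFrom : ℕ → ℕ → ℕ → ℕ
  logStarFrom = _

  logStar-unfold : ∀ f → logStar (suc f) ≡ (if f <ᵇ 1 then 0 else suc (logStarFrom (suc f) f ⌈log₂ suc f ⌉))
  logStar-unfold f with suc f
  ... | w with ⌈log₂ w ⌉
  ... | m = refl

mutual
  ceil34From : ℕ → ℕ → ℕ → ℕ
  ceil34From = _

  ceil34-unfold : ∀ f → ceil34 (suc f) ≡ (if (suc f ^ 3) ≤ᵇ 1 then 1 else ceil34From (suc f) 2 f)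
  ceil34-unfold f with suc f | 2
  ... | w | z = refl

-- `logStar` takes the next logarithm of its argument, whereas `iterLog` adds it on the outside;
-- this reconciles the two orders of recursion.
iterLog-shift : ∀ m i → iterLog ⌈log₂ m ⌉ i ≡ iterLog m (suc i)
iterLog-shift m zero    = refl
iterLog-shift m (suc i) = cong ⌈log₂_⌉ (iterLog-shift m i)

-- The fuel `f` lasts because ⌈log₂ m⌉ ≤ m - 1 for m ≥ 1, which preserves m ≤ 1 + f. The parameter
-- `w` is the outer argument of `logStar`, in whose scope the recursion lives.
iterLog-logStarFrom : ∀ w f m → m ≤ suc f → iterLog m (logStarFrom w f m) ≤ 1
iterLog-logStarFrom w zero    m m≤1 = m≤1
iterLog-logStarFrom w (suc f) zero m≤ = z≤n
iterLog-logStarFrom w (suc f) (suc zero) m≤ = ≤-refl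
iterLog-logStarFrom w (suc f) m@(suc (suc k)) (s≤s m≤) =
  subst (_≤ 1) (iterLog-shift m (logStarFrom w f ⌈log₂ m ⌉))
    (iterLog-logStarFrom w f ⌈log₂ m ⌉ (≤-trans (⌈log₂[1+n]⌉≤n (suc k)) m≤))

iterLog-logStar : ∀ n → iterLog n (logStar n) ≤ 1
iterLog-logStar zero = z≤n
iterLog-logStar (suc zero) = ≤-refl
iterLog-logStar n@(suc (suc k)) rewrite logStar-unfold (suc k) =
  subst (_≤ 1) (iterLog-shift n (logStarFrom n (suc k) ⌈log₂ n ⌉))
    (iterLog-logStarFrom n (suc k) ⌈log₂ n ⌉ (m≤n⇒m≤1+n (⌈log₂[1+n]⌉≤n (suc k))))

iterLog-≤ : ∀ n i → iterLog n (suc i) ≤ ⌈log₂ n ⌉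
iterLog-≤ n zero    = ≤-refl
iterLog-≤ n (suc i) = ≤-trans (⌈log₂n⌉≤n _) (iterLog-≤ n i)

logStarFrom≤fuel : ∀ w f m → logStarFrom w f m ≤ f
logStarFrom≤fuel w zero    m = z≤n
logStarFrom≤fuel w (suc f) zero = z≤n
logStarFrom≤fuel w (suc f) (suc zero) = z≤n
logStarFrom≤fuel w (suc f) m@(suc (suc _)) = s≤s (logStarFrom≤fuel w f ⌈log₂ m ⌉)

logStar≤n : ∀ n → logStar n ≤ n
logStar≤n zero = z≤n
logStar≤n (suc zero) = z≤n
logStar≤n n@(suc (suc k)) rewrite logStar-unfold (suc k) = s≤s (logStarFrom≤fuel n (suc k) ⌈log₂ n ⌉)

-- Either the test succeeds, or the fuel ends with k ≥ Δ, and then k⁴ ≥ k³ ≥ Δ³.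
ceil34From-bound : ∀ Δ k f → Δ ≤ k + f → Δ ^ 3 ≤ ceil34From Δ k f ^ 4
ceil34From-bound Δ k zero Δ≤k with k
... | zero  rewrite n≤0⇒n≡0 Δ≤k = z≤n
... | suc k = ≤-trans (^-monoˡ-≤ 3 (subst (Δ ≤_) (+-identityʳ _) Δ≤k)) (^-monoʳ-≤ (suc k) (n≤1+n 3))
ceil34From-bound Δ k (suc f) Δ≤k+f with (Δ ^ 3) ≤ᵇ (k ^ 4) in eq
... | true  = ≤ᵇ⇒≤ _ _ (subst Data.Bool.T (sym eq) tt)
... | false = ceil34From-bound Δ (suc k) f (subst (Δ ≤_) (+-suc k f) Δ≤k+f)

Δ³≤ceil34⁴ : ∀ Δ → Δ ^ 3 ≤ ceil34 Δ ^ 4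
Δ³≤ceil34⁴ zero = z≤n
Δ³≤ceil34⁴ (suc zero) = ≤-refl
Δ³≤ceil34⁴ (suc (suc k)) rewrite ceil34-unfold (suc k) =
  ceil34From-bound (suc (suc k)) 2 (suc k) (s≤s (s≤s (n≤1+n k)))

-- Primes between N and O(N log N)

strip-factor : ∀ {p} → Prime p → ∀ x .{{_ : NonZero x}} → ∃[ i ] ∃[ y ] (x ≡ p ^ i * y × ¬ p ∣ y)
strip-factor {p} pp = <-rec _ go
  where
  instance
    _ = prime⇒nonTrivial pp
    _ = prime⇒nonZero pp
  go : ∀ x → (∀ {y} → y < x → .{{_ : NonZero y}} → ∃[ i ] ∃[ z ] (y ≡ p ^ i * z × ¬ p ∣ z)) →
       .{{_ : NonZero x}} → ∃[ i ] ∃[ z ] (x ≡ p ^ i * z × ¬ p ∣ z)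
  go x rec with p ∣? x
  ... | no p∤x = 0 , x , sym (*-identityˡ x) , p∤x
  ... | yes p∣x@(divides k x≡k*p) with rec (quotient-< p∣x) {{quotient≢0 p∣x}}
  ...   | i , z , k≡ , p∤z = suc i , z , eq , p∤z
    where
    open ≡-Reasoning
    eq : x ≡ p ^ suc i * z
    eq = begin
      x                ≡⟨ x≡k*p ⟩
      k * p            ≡⟨ cong (_* p) k≡ ⟩
      p ^ i * z * p    ≡⟨ *-comm (p ^ i * z) p ⟩
      p * (p ^ i * z)  ≡⟨ *-assoc p (p ^ i) z ⟨
      p ^ suc i * z    ∎

^-monoʳ-∣ : ∀ p {i j} → i ≤ j → p ^ i ∣ p ^ j
^-monoʳ-∣ p {i} {j} i≤j = divides (p ^ (j ∸ i)) (trans (cong (p ^_) (sym (m∸n+n≡m i≤j))) (^-distribˡ-+-* p (j ∸ i) i))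

-- If both valuations were at most b, then p^b · x′y′ would be a common multiple of x and y, hence a
-- multiple of p^(b+1), and p would divide x′ or y′.
primePower∣lcm : ∀ {p} → Prime p → ∀ a x y .{{_ : NonZero x}} .{{_ : NonZero y}} →
                 p ^ a ∣ lcm x y → p ^ a ∣ x ⊎ p ^ a ∣ y
primePower∣lcm pp zero x y _ = inj₁ (1∣ x)
primePower∣lcm {p} pp (suc b) x y h with strip-factor pp x | strip-factor pp y
... | i , x′ , x≡ , p∤x′ | j , y′ , y≡ , p∤y′ with suc b ≤? i | suc b ≤? j
... | yes b<i | _ = inj₁ (subst (p ^ suc b ∣_) (sym x≡) (∣m⇒∣m*n x′ (^-monoʳ-∣ p b<i)))
... | no _ | yes b<j = inj₂ (subst (p ^ suc b ∣_) (sym y≡) (∣m⇒∣m*n y′ (^-monoʳ-∣ p b<j)))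
... | no b≮i | no b≮j = ⊥-elim ([ p∤x′ , p∤y′ ]′ (euclidsLemma x′ y′ pp p∣x′y′))
  where
  instance
    _ = prime⇒nonZero pp
    _ = m^n≢0 p b
  x∣ : x ∣ p ^ b * (x′ * y′)
  x∣ = subst (_∣ p ^ b * (x′ * y′)) (sym x≡)
         (*-pres-∣ (^-monoʳ-∣ p (≤-pred (≰⇒> b≮i))) (m∣m*n y′))
  y∣ : y ∣ p ^ b * (x′ * y′)
  y∣ = subst (_∣ p ^ b * (x′ * y′)) (sym y≡)
         (*-pres-∣ (^-monoʳ-∣ p (≤-pred (≰⇒> b≮j))) (n∣m*n x′))
  p∣x′y′ : p ∣ x′ * y′
  p∣x′y′ = *-cancelˡ-∣ (p ^ b) (subst (_∣ p ^ b * (x′ * y′)) (*-comm p (p ^ b)) (∣-trans h (lcm-least x∣ y∣)))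

lcmUpTo : ℕ → ℕ
lcmUpTo zero    = 1
lcmUpTo (suc n) = lcm (suc n) (lcmUpTo n)

lcmUpTo≢0 : ∀ n → NonZero (lcmUpTo n)
lcmUpTo≢0 zero    = _
lcmUpTo≢0 (suc n) = ≢-nonZero λ eq →
  ≢-nonZero⁻¹ (suc n * lcmUpTo n) {{m*n≢0 (suc n) (lcmUpTo n) {{_}} {{lcmUpTo≢0 n}}}}
    (0∣⇒≡0 (subst (_∣ suc n * lcmUpTo n) eq (lcm-least {suc n} {lcmUpTo n} (m∣m*n (lcmUpTo n)) (n∣m*n (suc n)))))

∣lcmUpTo : ∀ n j → 1 ≤ j → j ≤ n → j ∣ lcmUpTo n
∣lcmUpTo zero j 1≤j j≤n = contradiction (≤-trans 1≤j j≤n) λ ()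
∣lcmUpTo (suc n) j 1≤j j≤n with j ≟ suc n
... | yes refl = m∣lcm[m,n] (suc n) (lcmUpTo n)
... | no j≢   = ∣-trans (∣lcmUpTo n j 1≤j (≤-pred (≤∧≢⇒< j≤n j≢))) (n∣lcm[m,n] (suc n) (lcmUpTo n))

-- By `primePower∣lcm` the power divides one of the numbers themselves. Thus a prime contributes at
-- most a factor n + 1 to the lcm, whatever its exponent.
primePower∣lcmUpTo⇒≤ : ∀ {p} → Prime p → ∀ a n → p ^ a ∣ lcmUpTo (suc n) → p ^ a ≤ suc n
primePower∣lcmUpTo⇒≤ {p} pp a n h with primePower∣lcm pp a (suc n) (lcmUpTo n) {{_}} {{lcmUpTo≢0 n}} h
... | inj₁ d = ∣⇒≤ d
primePower∣lcmUpTo⇒≤ {p} pp a zero h    | inj₂ d = ∣⇒≤ d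
primePower∣lcmUpTo⇒≤ {p} pp a (suc n) h | inj₂ d = m≤n⇒m≤1+n (primePower∣lcmUpTo⇒≤ pp a n d)

-- A lower bound for lcm(1, ..., n) from binomial coefficients

[1+k]*[1+n]C[1+k] : ∀ n k → suc k * (suc n choose suc k) ≡ suc n * (n choose k)
[1+k]*[1+n]C[1+k] zero zero = refl
[1+k]*[1+n]C[1+k] zero (suc k) = *-zeroʳ (suc (suc k))
[1+k]*[1+n]C[1+k] (suc n) zero = begin
  1 * (suc (suc n) choose 1)                    ≡⟨ cong (1 *_) (nCk+nC[k+1]≡[n+1]C[k+1] (suc n) 0) ⟨
  1 * (1 + (suc n choose 1))                    ≡⟨ lem (suc n choose 1) ⟩
  1 + 1 * (suc n choose 1)                      ≡⟨ cong suc ([1+k]*[1+n]C[1+k] n zero) ⟩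
  1 + suc n * 1                            ∎
  where
  open ≡-Reasoning
  lem : ∀ x → 1 * (1 + x) ≡ 1 + 1 * x
  lem = solve-∀
[1+k]*[1+n]C[1+k] (suc n) (suc k) = begin
  suc (suc k) * (suc (suc n) choose suc (suc k))                        ≡⟨ cong (suc (suc k) *_) (nCk+nC[k+1]≡[n+1]C[k+1] (suc n) (suc k)) ⟨
  suc (suc k) * (A + B)                                            ≡⟨ lem₁ k A B ⟩
  A + (suc k * A + suc (suc k) * B)                                ≡⟨ cong₂ (λ x y → A + (x + y)) ([1+k]*[1+n]C[1+k] n k) ([1+k]*[1+n]C[1+k] n (suc k)) ⟩
  A + (suc n * (n choose k) + suc n * (n choose suc k))                      ≡⟨ cong (A +_) (*-distribˡ-+ (suc n) (n choose k) (n choose suc k)) ⟨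
  A + suc n * ((n choose k) + (n choose suc k))                              ≡⟨ cong (λ x → A + suc n * x) (nCk+nC[k+1]≡[n+1]C[k+1] n k) ⟩
  suc (suc n) * A                                                  ∎
  where
  open ≡-Reasoning
  A = suc n choose suc k
  B = suc n choose suc (suc k)
  lem₁ : ∀ k a b → suc (suc k) * (a + b) ≡ a + (suc k * a + suc (suc k) * b)
  lem₁ = solve-∀

nCk≢0 : ∀ n k → k ≤ n → NonZero (n choose k)
nCk≢0 n zero k≤n = _
nCk≢0 (suc n) (suc k) (s≤s k≤n) rewrite sym (nCk+nC[k+1]≡[n+1]C[k+1] n k) =
  >-nonZero (≤-trans (>-nonZero⁻¹ (n choose k) {{nCk≢0 n k k≤n}}) (m≤m+n _ _))

-- In Leibniz's harmonic triangle 1/a + 1/b = 1/c; hence a common multiple of a and c is one of b.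
harmonic-∣ : ∀ {a b c D} .{{_ : NonZero a}} → a * b ≡ (a + b) * c → a ∣ D → c ∣ D → b ∣ D
harmonic-∣ {a} {b} {c} {D} ab≡ (divides u D≡ua) (divides w D≡wc) =
  ∣m+n∣m⇒∣n (divides w eq′) (n∣m*n u)
  where
  open ≡-Reasoning
  l₁ : ∀ a b w → a * (w * b) ≡ w * (a * b)
  l₁ = solve-∀
  l₂ : ∀ a b c w → w * ((a + b) * c) ≡ (a + b) * (w * c)
  l₂ = solve-∀
  l₃ : ∀ a b u D → b * (u * a) + a * D ≡ a * (u * b + D)
  l₃ = solve-∀
  eq : a * (w * b) ≡ a * (u * b + D)
  eq = begin
    a * (w * b)          ≡⟨ l₁ a b w ⟩
    w * (a * b)          ≡⟨ cong (w *_) ab≡ ⟩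
    w * ((a + b) * c)    ≡⟨ l₂ a b c w ⟩
    (a + b) * (w * c)    ≡⟨ cong ((a + b) *_) D≡wc ⟨
    (a + b) * D          ≡⟨ *-distribʳ-+ D a b ⟩
    a * D + b * D        ≡⟨ +-comm (a * D) (b * D) ⟩
    b * D + a * D        ≡⟨ cong (λ z → b * z + a * D) D≡ua ⟩
    b * (u * a) + a * D  ≡⟨ l₃ a b u D ⟩
    a * (u * b + D)      ∎
  eq′ : u * b + D ≡ w * b
  eq′ = sym (*-cancelˡ-≡ (w * b) (u * b + D) a eq)

-- The numbers k · C(n,k) are the denominators of the harmonic triangle. The induction starts at its
-- edge, where the denominator is the row number itself; every other entry is the one above it minus
-- its left neighbour.
k*nCk∣commonMultiple : ∀ k n {D} → k ≤ n → (∀ j → 1 ≤ j → j ≤ suc n → j ∣ D) → suc k * (suc n choose suc k) ∣ D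
k*nCk∣commonMultiple zero n {D} k≤n all =
  subst (_∣ D) (sym (trans ([1+k]*[1+n]C[1+k] n 0) (*-identityʳ (suc n)))) (all (suc n) (s≤s z≤n) ≤-refl)
k*nCk∣commonMultiple (suc k) (suc n) {D} (s≤s k≤n) all =
  harmonic-∣ {a} {b} {c} {{m*n≢0 (suc k) (suc (suc n) choose suc k) {{_}} {{nCk≢0 (suc (suc n)) (suc k) (s≤s (m≤n⇒m≤1+n k≤n))}}}} rel
    (k*nCk∣commonMultiple k (suc n) (m≤n⇒m≤1+n k≤n) all)
    (k*nCk∣commonMultiple k n k≤n (λ j 1≤j j≤ → all j 1≤j (m≤n⇒m≤1+n j≤)))
  where
  open ≡-Reasoning
  N = suc (suc n)
  a = suc k * (N choose suc k)
  b = suc (suc k) * (N choose suc (suc k))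
  c = suc k * (suc n choose suc k)
  l₁ : ∀ k N x y → suc k * x * (N * y) ≡ N * x * (suc k * y)
  l₁ = solve-∀
  a+b : a + b ≡ N * (N choose suc k)
  a+b = begin
    a + b                                     ≡⟨ cong₂ _+_ ([1+k]*[1+n]C[1+k] (suc n) k) ([1+k]*[1+n]C[1+k] (suc n) (suc k)) ⟩
    N * (suc n choose k) + N * (suc n choose suc k)     ≡⟨ *-distribˡ-+ N (suc n choose k) (suc n choose suc k) ⟨
    N * ((suc n choose k) + (suc n choose suc k))       ≡⟨ cong (N *_) (nCk+nC[k+1]≡[n+1]C[k+1] (suc n) k) ⟩
    N * (N choose suc k)                           ∎
  rel : a * b ≡ (a + b) * c
  rel = begin
    a * b                              ≡⟨ cong (a *_) ([1+k]*[1+n]C[1+k] (suc n) (suc k)) ⟩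
    a * (N * (suc n choose suc k))          ≡⟨ l₁ k N (N choose suc k) (suc n choose suc k) ⟩
    N * (N choose suc k) * c                ≡⟨ cong (_* c) a+b ⟨
    (a + b) * c                        ∎

-- Two applications of Pascal's rule show that C(2m+2, m+1) contains C(2m, m) twice. They use the
-- entry before the central one, so m = 1 is a base case too.
2^m≤[2m]Cm : ∀ m → 2 ^ m ≤ (m + m) choose m
2^m≤[2m]Cm zero = ≤-refl
2^m≤[2m]Cm (suc zero) = ≤-refl
2^m≤[2m]Cm (suc m@(suc k)) = begin
  2 ^ m + (2 ^ m + 0)                              ≤⟨ +-mono-≤ (2^m≤[2m]Cm m) (≤-trans (≤-reflexive (+-identityʳ (2 ^ m))) (2^m≤[2m]Cm m)) ⟩
  ((m + m) choose m) + ((m + m) choose m)                    ≤⟨ +-mono-≤ (m≤n+m _ ((m + m) choose k)) (m≤m+n _ ((m + m) choose suc m)) ⟩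
  ((m + m) choose k + (m + m) choose m) + ((m + m) choose m + (m + m) choose suc m)
                                                   ≡⟨ cong₂ _+_ (nCk+nC[k+1]≡[n+1]C[k+1] (m + m) k) (nCk+nC[k+1]≡[n+1]C[k+1] (m + m) m) ⟩
  (suc (m + m) choose m) + (suc (m + m) choose suc m)        ≡⟨ nCk+nC[k+1]≡[n+1]C[k+1] (suc (m + m)) m ⟩
  suc (suc (m + m)) choose suc m                        ≡⟨ cong (λ z → suc z choose suc m) (+-suc m m) ⟨
  (suc m + suc m) choose suc m                          ∎
  where open ≤-Reasoning

2^m≤lcmUpTo : ∀ k → 2 ^ suc k ≤ lcmUpTo (suc k + suc k)
2^m≤lcmUpTo k = begin
  2 ^ suc k                     ≤⟨ 2^m≤[2m]Cm (suc k) ⟩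
  (suc k + suc k) choose suc k       ≤⟨ m≤n*m _ (suc k) ⟩
  suc k * ((suc k + suc k) choose suc k)
                                ≤⟨ ∣⇒≤ {{lcmUpTo≢0 (suc k + suc k)}} (k*nCk∣commonMultiple k (k + suc k) (m≤m+n k (suc k)) (∣lcmUpTo (suc k + suc k))) ⟩
  lcmUpTo (suc k + suc k)       ∎
  where open ≤-Reasoning

-- Upper bounds for smooth numbers and existence of primes

prime-factor : ∀ D → 2 ≤ D → ∃[ p ] (Prime p × p ∣ D)
prime-factor D@(suc _) 2≤D with factorise D
... | record { factors = [] ; isFactorisation = eq } = contradiction (subst (2 ≤_) eq 2≤D) λ { (s≤s ()) }
... | record { factors = p ∷ ps ; isFactorisation = eq ; factorsPrime = pp Data.List.Relation.Unary.All.∷ _ } =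
  p , pp , subst (p ∣_) (sym eq) (m∣m*n _)

-- The primes are stripped from `r` downwards, each taking away a power of at most `n`. The exponent
-- generously counts every number up to `r` as if it were prime.
smooth-bound : ∀ r D n .{{_ : NonZero D}} .{{_ : NonZero n}} → (∀ p → Prime p → p ∣ D → p ≤ r) →
               (∀ p a → Prime p → p ^ a ∣ D → p ^ a ≤ n) → D ≤ n ^ r
smooth-bound zero D n small _ with 2 ≤? D
... | no 2≰D = ≤-pred (≰⇒> 2≰D)
... | yes 2≤D = let p , pp , p∣D = prime-factor D 2≤D in
  contradiction (subst Prime (n≤0⇒n≡0 (small p pp p∣D)) pp) ¬prime[0]
smooth-bound (suc r) D n small powers with prime? (suc r)
... | no ¬prime = ≤-trans (smooth-bound r D n (λ p pp p∣D → ≤-pred (≤∧≢⇒< (small p pp p∣D) λ { refl → ¬prime pp })) powers)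
                          (m≤n*m (n ^ r) n)
... | yes r-prime with strip-factor r-prime D
... | i , y , D≡ , r∤y = begin
  D                ≡⟨ D≡ ⟩
  suc r ^ i * y    ≤⟨ *-mono-≤ (powers (suc r) i r-prime (subst (suc r ^ i ∣_) (sym D≡) (m∣m*n y)))
                               (smooth-bound r y n {{y≢0}} small′ (λ p a pp pᵃ∣y → powers p a pp (∣-trans pᵃ∣y y∣D))) ⟩
  n * n ^ r        ∎
  where
  open ≤-Reasoning
  y∣D : y ∣ D
  y∣D = subst (y ∣_) (sym D≡) (n∣m*n (suc r ^ i))
  y≢0 : NonZero y
  y≢0 = ≢-nonZero λ { refl → r∤y (suc r ∣0) }
  small′ : ∀ p → Prime p → p ∣ y → p ≤ r
  small′ p pp p∣y = ≤-pred (≤∧≢⇒< (small p pp (∣-trans p∣y y∣D)) λ { refl → r∤y p∣y })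

prime-between : ∀ N k → let m = suc k in (m + m) ^ N < 2 ^ m → ∃[ p ] (Prime p × N < p × p ≤ m + m)
prime-between N k small with anyUpTo? (λ p → (N <? p) ×-dec prime? p) (suc (suc k + suc k))
... | yes (p , s≤s p≤2m , N<p , pp) = p , pp , N<p , p≤2m
... | no none = contradiction (≤-trans (2^m≤lcmUpTo k) D≤) (<⇒≱ small)
  where
  n = k + suc k
  p≤2m : ∀ p → Prime p → p ∣ lcmUpTo (suc n) → p ≤ suc n
  p≤2m p pp p∣D = subst (_≤ suc n) (*-identityʳ p)
    (primePower∣lcmUpTo⇒≤ pp 1 n (subst (_∣ lcmUpTo (suc n)) (sym (*-identityʳ p)) p∣D))
  D≤ : lcmUpTo (suc n) ≤ suc n ^ N
  D≤ = smooth-bound N (lcmUpTo (suc n)) (suc n) {{lcmUpTo≢0 (suc n)}}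
    (λ p pp p∣D → ≮⇒≥ λ N<p → none (p , s≤s (p≤2m p pp p∣D) , N<p , pp))
    (λ p a pp → primePower∣lcmUpTo⇒≤ pp a n)

prime-above-2^ : ∀ N l .{{_ : NonZero N}} → N ≤ 2 ^ l → ∃[ p ] (Prime p × N < p × p ≤ 4 * N * (2 + l))
prime-above-2^ N@(suc _) l N≤2^l =
  let p , pp , N<p , p≤ = prime-between N (pred m) lower in p , pp , N<p , ≤-trans p≤ (≤-reflexive (lem₂ N b))
  where
  -- `b` is such that 4N ≤ 2^b. Then 2m = 4Nb ≤ b · 2^b < 2^(2b), and the N-th power of the
  -- right-hand side is exactly 2^m.
  b m : ℕ
  b = 2 + l
  m = N * (b + b)
  lem₁ : ∀ N b → N * (b + b) + N * (b + b) ≡ 2 * (2 * N) * b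
  lem₁ = solve-∀
  lem₂ : ∀ N b → N * (b + b) + N * (b + b) ≡ 4 * N * b
  lem₂ = solve-∀
  open ≤-Reasoning
  2m<2^[b+b] : m + m < 2 ^ (b + b)
  2m<2^[b+b] = begin-strict
    m + m                            ≡⟨ lem₁ N b ⟩
    2 * (2 * N) * b                  ≤⟨ *-monoˡ-≤ b (*-monoʳ-≤ 2 (*-monoʳ-≤ 2 N≤2^l)) ⟩
    2 ^ b * b                        <⟨ *-monoʳ-< (2 ^ b) {{m^n≢0 2 b}} (n<2^n b) ⟩
    2 ^ b * 2 ^ b                    ≡⟨ ^-distribˡ-+-* 2 b b ⟨
    2 ^ (b + b)                      ∎
  lower : (m + m) ^ N < 2 ^ m
  lower = begin-strict
    (m + m) ^ N          <⟨ ^-monoˡ-< N 2m<2^[b+b] ⟩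
    (2 ^ (b + b)) ^ N    ≡⟨ ^-*-assoc 2 (b + b) N ⟩
    2 ^ ((b + b) * N)    ≡⟨ cong (2 ^_) (*-comm (b + b) N) ⟩
    2 ^ m                ∎

abstract
  primeAbove : ∀ N .{{_ : NonZero N}} → ∃[ p ] (Prime p × N < p × p ≤ 4 * N * (2 + ⌈log₂ N ⌉))
  primeAbove N = prime-above-2^ N ⌈log₂ N ⌉ (n≤2^⌈log₂n⌉ N)

-- Counting over finite sets

⟦_⟧ : Bool → ℕ
⟦ b ⟧ = if b then 1 else 0

count : ∀ {n} → (Fin n → Bool) → ℕ
count P = sumFin (λ i → ⟦ P i ⟧)

⌊⌋⇒ : ∀ {A : Set} (a? : Dec A) → ⌊ a? ⌋ ≡ true → A
⌊⌋⇒ (yes a) _ = a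

⇒⌊⌋ : ∀ {A : Set} (a? : Dec A) → A → ⌊ a? ⌋ ≡ true
⇒⌊⌋ (yes _) _ = refl
⇒⌊⌋ (no ¬a) a = contradiction a ¬a

∧-elim : ∀ {a b} → a ∧ b ≡ true → a ≡ true × b ≡ true
∧-elim {true} {true} _ = refl , refl

∧-intro : ∀ {a b} → a ≡ true → b ≡ true → a ∧ b ≡ true
∧-intro refl refl = refl

true-or-false : ∀ b → b ≡ true ⊎ b ≡ false
true-or-false true  = inj₁ refl
true-or-false false = inj₂ refl

true≢false : ∀ {b} → b ≡ true → b ≡ false → ⊥
true≢false refl ()

⟦⟧-mono : ∀ {a b} → (a ≡ true → b ≡ true) → ⟦ a ⟧ ≤ ⟦ b ⟧
⟦⟧-mono {false} _ = z≤n
⟦⟧-mono {true}  a⇒b rewrite a⇒b refl = ≤-refl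

sumFin-cong : ∀ {n} {f g : Fin n → ℕ} → (∀ i → f i ≡ g i) → sumFin f ≡ sumFin g
sumFin-cong {zero}  f≡g = refl
sumFin-cong {suc n} f≡g = cong₂ _+_ (f≡g zero) (sumFin-cong (f≡g ∘ suc))

sumFin-mono : ∀ {n} {f g : Fin n → ℕ} → (∀ i → f i ≤ g i) → sumFin f ≤ sumFin g
sumFin-mono {zero}  f≤g = z≤n
sumFin-mono {suc n} f≤g = +-mono-≤ (f≤g zero) (sumFin-mono (f≤g ∘ suc))

sumFin-+ : ∀ {n} (f g : Fin n → ℕ) → sumFin (λ i → f i + g i) ≡ sumFin f + sumFin g
sumFin-+ {zero}  f g = refl
sumFin-+ {suc n} f g rewrite sumFin-+ (f ∘ suc) (g ∘ suc) = lem (f zero) (g zero) (sumFin (f ∘ suc)) (sumFin (g ∘ suc))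
  where
  lem : ∀ a b c d → a + b + (c + d) ≡ a + c + (b + d)
  lem = solve-∀

sumFin-const : ∀ n c → sumFin {n} (λ _ → c) ≡ n * c
sumFin-const zero    c = refl
sumFin-const (suc n) c = cong (c +_) (sumFin-const n c)

sumFin-zero : ∀ {n} {f : Fin n → ℕ} → (∀ i → f i ≡ 0) → sumFin f ≡ 0
sumFin-zero {n} f≡0 = trans (sumFin-cong f≡0) (trans (sumFin-const n 0) (*-zeroʳ n))

sumFin-*ʳ : ∀ {n} (f : Fin n → ℕ) c → sumFin (λ i → f i * c) ≡ sumFin f * c
sumFin-*ʳ {zero}  f c = refl
sumFin-*ʳ {suc n} f c rewrite sumFin-*ʳ (f ∘ suc) c = sym (*-distribʳ-+ c (f zero) (sumFin (f ∘ suc)))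

sumFin-swap : ∀ {m n} (f : Fin m → Fin n → ℕ) →
              sumFin (λ i → sumFin (f i)) ≡ sumFin (λ j → sumFin (λ i → f i j))
sumFin-swap {zero} {n} f = sym (sumFin-zero {n} (λ _ → refl))
sumFin-swap {suc m} f rewrite sumFin-swap (f ∘ suc) = sym (sumFin-+ (f zero) (λ j → sumFin (λ i → f (suc i) j)))

≤-sumFin : ∀ {n} (f : Fin n → ℕ) i → f i ≤ sumFin f
≤-sumFin f zero    = m≤m+n _ _
≤-sumFin f (suc i) = ≤-trans (≤-sumFin (f ∘ suc) i) (m≤n+m _ (f zero))

≤-maxFin : ∀ {n} (f : Fin n → ℕ) i → f i ≤ maxFin f
≤-maxFin f zero    = m≤m⊔n _ _
≤-maxFin f (suc i) = ≤-trans (≤-maxFin (f ∘ suc) i) (m≤n⊔m (f zero) _)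

maxFin≤ : ∀ {n} {f : Fin n → ℕ} {b} → (∀ i → f i ≤ b) → maxFin f ≤ b
maxFin≤ {zero}  f≤ = z≤n
maxFin≤ {suc n} f≤ = ⊔-lub (f≤ zero) (maxFin≤ (f≤ ∘ suc))

sumFin-δ : ∀ {n} (k : Fin n) (f : Fin n → ℕ) → sumFin (λ i → if ⌊ k Fin.≟ i ⌋ then f i else 0) ≡ f k
sumFin-δ {suc n} zero f = trans (cong (f zero +_) (sumFin-zero {n} (λ _ → refl))) (+-identityʳ _)
sumFin-δ {suc n} (suc k) f = trans (sumFin-cong lem) (sumFin-δ k (f ∘ suc))
  where
  lem : ∀ i → (if ⌊ suc k Fin.≟ suc i ⌋ then f (suc i) else 0) ≡ (if ⌊ k Fin.≟ i ⌋ then f (suc i) else 0)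
  lem i with k Fin.≟ i
  ... | yes _ = refl
  ... | no _  = refl

-- The points, translates and colours chosen in the algorithm all owe their existence to this
-- averaging argument.
sumFin-pigeonhole : ∀ {n} (f g : Fin n → ℕ) → sumFin f < sumFin g → ∃[ i ] f i < g i
sumFin-pigeonhole {suc n} f g f<g with f zero <? g zero
... | yes f₀<g₀ = zero , f₀<g₀
... | no f₀≮g₀ with sumFin-pigeonhole (f ∘ suc) (g ∘ suc)
                     (+-cancelˡ-< (f zero) _ _ (<-≤-trans f<g (+-monoˡ-≤ (sumFin (g ∘ suc)) (≮⇒≥ f₀≮g₀))))
...   | i , fᵢ<gᵢ = suc i , fᵢ<gᵢ

count-mono : ∀ {n} {P Q : Fin n → Bool} → (∀ i → P i ≡ true → Q i ≡ true) → count P ≤ count Q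
count-mono P⇒Q = sumFin-mono (λ i → ⟦⟧-mono (P⇒Q i))

count-cong : ∀ {n} {P Q : Fin n → Bool} → (∀ i → P i ≡ Q i) → count P ≡ count Q
count-cong P≡Q = sumFin-cong (λ i → cong ⟦_⟧ (P≡Q i))

count≡0 : ∀ {n} (P : Fin n → Bool) → count P ≡ 0 → ∀ i → P i ≡ false
count≡0 P c≡0 i with P i in eq | ≤-sumFin (λ i → ⟦ P i ⟧) i
... | false | _ = refl
... | true  | le rewrite c≡0 = contradiction le λ ()

count≢0 : ∀ {n} (P : Fin n → Bool) → 1 ≤ count P → ∃[ i ] P i ≡ true
count≢0 {n} P 1≤c with sumFin-pigeonhole (λ _ → 0) (λ i → ⟦ P i ⟧) (subst (_< count P) (sym (sumFin-zero {n} (λ _ → refl))) 1≤c)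
... | i , 0<Pᵢ with P i in eq
...   | true = i , eq

count-not : ∀ {n} (P : Fin n → Bool) → count P + count (not ∘ P) ≡ n
count-not {n} P = trans (sym (sumFin-+ (λ i → ⟦ P i ⟧) (λ i → ⟦ not (P i) ⟧)))
  (trans (sumFin-cong (λ i → lem (P i))) (trans (sumFin-const n 1) (*-identityʳ n)))
  where
  lem : ∀ b → ⟦ b ⟧ + ⟦ not b ⟧ ≡ 1
  lem true  = refl
  lem false = refl

count-∨ : ∀ {n} (P Q R : Fin n → Bool) → (∀ i → P i ≡ true → Q i ≡ true ⊎ R i ≡ true) → count P ≤ count Q + count R
count-∨ P Q R P⇒ = subst (count P ≤_) (sumFin-+ (λ i → ⟦ Q i ⟧) (λ i → ⟦ R i ⟧)) (sumFin-mono λ i → lem (P i) (Q i) (R i) (P⇒ i))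
  where
  lem : ∀ p q r → (p ≡ true → q ≡ true ⊎ r ≡ true) → ⟦ p ⟧ ≤ ⟦ q ⟧ + ⟦ r ⟧
  lem false q r _ = z≤n
  lem true true r _ = s≤s z≤n
  lem true false true _ = s≤s z≤n
  lem true false false h with h refl
  ... | inj₁ ()
  ... | inj₂ ()

count-at-most-one : ∀ {n} (P : Fin n → Bool) → (∀ i j → P i ≡ true → P j ≡ true → i ≡ j) → count P ≤ 1
count-at-most-one {zero} P _ = z≤n
count-at-most-one {suc n} P uniq with P zero in eq
... | true  = ≤-reflexive (cong suc (sumFin-zero (λ i → lem i)))
  where
  lem : ∀ i → ⟦ P (suc i) ⟧ ≡ 0
  lem i with P (suc i) in eqᵢ
  ... | false = refl
  ... | true with uniq zero (suc i) eq eqᵢ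
  ...   | ()
... | false = count-at-most-one (P ∘ suc) (λ i j pᵢ pⱼ → Finₚ.suc-injective (uniq (suc i) (suc j) pᵢ pⱼ))

count-image : ∀ {m n} (P : Fin m → Bool) (h : Fin m → Fin n) →
              count P ≡ sumFin (λ y → count (λ x → P x ∧ ⌊ h x Fin.≟ y ⌋))
count-image P h = trans (sumFin-cong (λ x → sym (fibre x))) (sumFin-swap (λ x y → ⟦ P x ∧ ⌊ h x Fin.≟ y ⌋ ⟧))
  where
  lem : ∀ a b → ⟦ a ∧ b ⟧ ≡ (if b then ⟦ a ⟧ else 0)
  lem true  b = refl
  lem false true = refl
  lem false false = refl
  fibre : ∀ x → sumFin (λ y → ⟦ P x ∧ ⌊ h x Fin.≟ y ⌋ ⟧) ≡ ⟦ P x ⟧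
  fibre x = trans (sumFin-cong (λ y → lem (P x) ⌊ h x Fin.≟ y ⌋)) (sumFin-δ (h x) (λ _ → ⟦ P x ⟧))

count-injective : ∀ {m n} (P : Fin m → Bool) (Q : Fin n → Bool) (h : Fin m → Fin n) →
                  (∀ x → P x ≡ true → Q (h x) ≡ true) →
                  (∀ x y → P x ≡ true → P y ≡ true → h x ≡ h y → x ≡ y) → count P ≤ count Q
count-injective P Q h P⇒Q inj = subst (_≤ count Q) (sym (count-image P h)) (sumFin-mono λ y → lem y (Q y) refl)
  where
  lem : ∀ y b → Q y ≡ b → count (λ x → P x ∧ ⌊ h x Fin.≟ y ⌋) ≤ ⟦ b ⟧
  lem y true _ = count-at-most-one _ λ i j pᵢ pⱼ →
    let Pᵢ , hᵢ = ∧-elim pᵢ ; Pⱼ , hⱼ = ∧-elim pⱼ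
    in inj i j Pᵢ Pⱼ (trans (⌊⌋⇒ (h i Fin.≟ y) hᵢ) (sym (⌊⌋⇒ (h j Fin.≟ y) hⱼ)))
  lem y false Qy≡false = ≤-reflexive (sumFin-zero λ x → none x (P x ∧ ⌊ h x Fin.≟ y ⌋) refl)
    where
    none : ∀ x c → P x ∧ ⌊ h x Fin.≟ y ⌋ ≡ c → ⟦ c ⟧ ≡ 0
    none x false _ = refl
    none x true eq = let Pₓ , hₓ = ∧-elim {P x} eq
      in ⊥-elim (true≢false (subst (λ z → Q z ≡ true) (⌊⌋⇒ (h x Fin.≟ y) hₓ) (P⇒Q x Pₓ)) Qy≡false)

-- Returns the first index satisfying `P`, and the last index if there is none; `d` witnesses that
-- `Fin n` is inhabited.
pick : ∀ {n} → Fin n → (Fin n → Bool) → Fin n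
pick {suc zero}    d P = zero
pick {suc (suc n)} d P = if P zero then zero else suc (pick zero (P ∘ suc))

pick-correct : ∀ {n} (d : Fin n) (P : Fin n → Bool) i → P i ≡ true → P (pick d P) ≡ true
pick-correct {suc zero} d P zero Pᵢ = Pᵢ
pick-correct {suc (suc n)} d P i Pᵢ with P zero in eq
... | true = eq
pick-correct {suc (suc n)} d P zero Pᵢ | false = ⊥-elim (true≢false Pᵢ eq)
pick-correct {suc (suc n)} d P (suc i) Pᵢ | false = pick-correct zero (P ∘ suc) i Pᵢ

-- Polynomials modulo a prime

module Polynomial where
  open Int using (0ℤ; 1ℤ) renaming (_+_ to _⊞_; _-_ to _⊟_; _*_ to _⊠_; +_ to ⁺_)
  open ℤ∣ using () renaming (_∣_ to _∣ᶻ_)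

  eval : ∀ {n} → Vec ℤ n → ℤ → ℤ
  eval []      x = 0ℤ
  eval (a ∷ P) x = a ⊞ x ⊠ eval P x

  -- Horner's scheme: the quotient of P - P(r) by x - r. It is computed over the integers, so it is
  -- valid modulo every `q`.
  deflate : ∀ {n} → Vec ℤ (suc n) → ℤ → Vec ℤ n
  deflate {zero}  (a ∷ []) r = []
  deflate {suc n} (a ∷ P)  r = eval P r ∷ deflate P r

  factor-theorem : ∀ {n} (P : Vec ℤ (suc n)) r x → eval P x ⊟ eval P r ≡ (x ⊟ r) ⊠ eval (deflate P r) x
  factor-theorem {zero} (a ∷ []) r x = lem a r x
    where
    lem : ∀ a r x → (a ⊞ x ⊠ 0ℤ) ⊟ (a ⊞ r ⊠ 0ℤ) ≡ (x ⊟ r) ⊠ 0ℤ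
    lem = ℤ-Ring.solve-∀
  factor-theorem {suc n} (a ∷ P) r x = begin
    (a ⊞ x ⊠ p) ⊟ (a ⊞ r ⊠ pᵣ)             ≡⟨ lem₁ a x r p pᵣ ⟩
    x ⊠ (p ⊟ pᵣ) ⊞ (x ⊟ r) ⊠ pᵣ            ≡⟨ cong (λ z → x ⊠ z ⊞ (x ⊟ r) ⊠ pᵣ) (factor-theorem P r x) ⟩
    x ⊠ ((x ⊟ r) ⊠ q) ⊞ (x ⊟ r) ⊠ pᵣ       ≡⟨ lem₂ x r q pᵣ ⟩
    (x ⊟ r) ⊠ (pᵣ ⊞ x ⊠ q)                 ∎
    where
    open ≡-Reasoning
    p  = eval P x
    pᵣ = eval P r
    q  = eval (deflate P r) x
    lem₁ : ∀ a x r p pᵣ → (a ⊞ x ⊠ p) ⊟ (a ⊞ r ⊠ pᵣ) ≡ x ⊠ (p ⊟ pᵣ) ⊞ (x ⊟ r) ⊠ pᵣ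
    lem₁ = ℤ-Ring.solve-∀
    lem₂ : ∀ x r q pᵣ → x ⊠ ((x ⊟ r) ⊠ q) ⊞ (x ⊟ r) ⊠ pᵣ ≡ (x ⊟ r) ⊠ (pᵣ ⊞ x ⊠ q)
    lem₂ = ℤ-Ring.solve-∀

  -- Used in contrapositive form: a polynomial that is non-zero modulo `k` stays so after division
  -- by x - r at a root r modulo `k`, which keeps the induction on the degree going.
  ∣deflate⇒∣ : ∀ {k n} (P : Vec ℤ (suc n)) r → k ∣ᶻ eval P r → All (k ∣ᶻ_) (deflate P r) → All (k ∣ᶻ_) P
  ∣deflate⇒∣ {k} {zero} (a ∷ []) r k∣P[r] [] = subst (k ∣ᶻ_) (lem a r) k∣P[r] ∷ []
    where
    lem : ∀ a r → a ⊞ r ⊠ 0ℤ ≡ a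
    lem = ℤ-Ring.solve-∀
  ∣deflate⇒∣ {n = suc n} (a ∷ P) r k∣P[r] (k∣p ∷ k∣Q) =
    ℤ∣.∣m+n∣n⇒∣m {m = a} k∣P[r] (ℤ∣.∣n⇒∣m*n r k∣p) ∷ ∣deflate⇒∣ P r k∣p k∣Q

  ∣<⇒≡0 : ∀ {q} m → m < q → q ∣ m → m ≡ 0
  ∣<⇒≡0 zero    _   _   = refl
  ∣<⇒≡0 (suc m) m<q q∣m = contradiction q∣m (>⇒∤ m<q)

  ∣-⇒≡ : ∀ {q a b} → a < q → b < q → ⁺ q ∣ᶻ ⁺ a ⊟ ⁺ b → a ≡ b
  ∣-⇒≡ {q} {a} {b} a<q b<q h with ≤-total a b
  ... | inj₁ a≤b = ≤-antisym a≤b (m∸n≡0⇒m≤n (∣<⇒≡0 (b ∸ a) (≤-<-trans (m∸n≤m b a) b<q) (subst (q ∣_) ∣a-b∣ (ℤ∣.∣⇒∣ᵤ h))))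
    where
    ∣a-b∣ : Int.∣ ⁺ a ⊟ ⁺ b ∣ ≡ b ∸ a
    ∣a-b∣ = trans (cong Int.∣_∣ (ℤₚ.m-n≡m⊖n a b)) (ℤₚ.∣⊖∣-≤ a≤b)
  ... | inj₂ b≤a = ≤-antisym (m∸n≡0⇒m≤n (∣<⇒≡0 (a ∸ b) (≤-<-trans (m∸n≤m a b) a<q) (subst (q ∣_) ∣a-b∣ (ℤ∣.∣⇒∣ᵤ h)))) b≤a
    where
    ∣a-b∣ : Int.∣ ⁺ a ⊟ ⁺ b ∣ ≡ a ∸ b
    ∣a-b∣ = trans (cong Int.∣_∣ (ℤₚ.m-n≡m⊖n a b)) (trans (ℤₚ.∣m⊖n∣≡∣n⊖m∣ a b) (ℤₚ.∣⊖∣-≤ b≤a))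

  euclid : ∀ {q} → Prime q → ∀ m n → ⁺ q ∣ᶻ m ⊠ n → ⁺ q ∣ᶻ m ⊎ ⁺ q ∣ᶻ n
  euclid {q} pq m n h with euclidsLemma Int.∣ m ∣ Int.∣ n ∣ pq (subst (q ∣_) (ℤₚ.abs-* m n) (ℤ∣.∣⇒∣ᵤ h))
  ... | inj₁ d = inj₁ (ℤ∣.∣ᵤ⇒∣ d)
  ... | inj₂ d = inj₂ (ℤ∣.∣ᵤ⇒∣ d)

  root? : ∀ {n} q → Vec ℤ n → Fin q → Bool
  root? q P x = ⌊ ⁺ q ℤ∣.∣? eval P (⁺ toℕ x) ⌋

  -- Lagrange's theorem. After splitting off a root r, any other root x makes the prime `q` divide
  -- (x - r) times the deflated value, and 0 < |x - r| < q leaves only the second factor.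
  count-roots : ∀ {q n} → Prime q → (P : Vec ℤ (suc n)) → ¬ All (⁺ q ∣ᶻ_) P → count (root? q P) ≤ n
  count-roots {q} pq P ¬all with count (root? q P) in eq
  ... | zero = z≤n
  count-roots {q} {zero} pq (a ∷ []) ¬all | suc c with count≢0 (root? q (a ∷ [])) (subst (1 ≤_) (sym eq) (s≤s z≤n))
  ... | r , root = contradiction (∣deflate⇒∣ (a ∷ []) (⁺ toℕ r) (⌊⌋⇒ (_ ℤ∣.∣? _) root) []) ¬all
  count-roots {q} {suc n} pq P ¬all | suc c with count≢0 (root? q P) (subst (1 ≤_) (sym eq) (s≤s z≤n))
  ... | r , root = begin
    suc c                                                            ≡⟨ eq ⟨
    count (root? q P)                                                ≤⟨ count-∨ (root? q P) _ _ step ⟩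
    count (λ x → ⌊ x Fin.≟ r ⌋) + count (root? q (deflate P r′))   ≤⟨ +-mono-≤ one (count-roots pq (deflate P r′) λ all → ¬all (∣deflate⇒∣ P r′ q∣P[r] all)) ⟩
    suc n                                                            ∎
    where
    open ≤-Reasoning
    r′ = ⁺ toℕ r
    q∣P[r] : ⁺ q ∣ᶻ eval P r′
    q∣P[r] = ⌊⌋⇒ (_ ℤ∣.∣? _) root
    one : count (λ x → ⌊ x Fin.≟ r ⌋) ≤ 1
    one = count-at-most-one _ λ i j i≡r j≡r → trans (⌊⌋⇒ (i Fin.≟ r) i≡r) (sym (⌊⌋⇒ (j Fin.≟ r) j≡r))
    step : ∀ x → root? q P x ≡ true → ⌊ x Fin.≟ r ⌋ ≡ true ⊎ root? q (deflate P r′) x ≡ true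
    step x rootₓ with x Fin.≟ r
    ... | yes _  = inj₁ refl
    ... | no x≢r with euclid pq (⁺ toℕ x ⊟ r′) (eval (deflate P r′) (⁺ toℕ x))
                        (subst (⁺ q ∣ᶻ_) (factor-theorem P r′ (⁺ toℕ x)) (ℤ∣.∣m∣n⇒∣m-n (⌊⌋⇒ (_ ℤ∣.∣? _) rootₓ) q∣P[r]))
    ...   | inj₁ d = contradiction (Finₚ.toℕ-injective (∣-⇒≡ (Finₚ.toℕ<n x) (Finₚ.toℕ<n r) d)) x≢r
    ...   | inj₂ d = inj₂ (⇒⌊⌋ (_ ℤ∣.∣? _) d)

  %≡⇒∣- : ∀ {q} .{{_ : NonZero q}} a b → a % q ≡ b % q → ⁺ q ∣ᶻ ⁺ a ⊟ ⁺ b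
  %≡⇒∣- {q} a b eq = ℤ∣.divides (⁺ (a / q) ⊟ ⁺ (b / q)) (begin
    ⁺ a ⊟ ⁺ b                                                     ≡⟨ cong₂ (λ x y → x ⊟ y) (split a) (split b) ⟩
    (⁺ (a % q) ⊞ ⁺ (a / q) ⊠ ⁺ q) ⊟ (⁺ (b % q) ⊞ ⁺ (b / q) ⊠ ⁺ q) ≡⟨ cong (λ z → (⁺ z ⊞ ⁺ (a / q) ⊠ ⁺ q) ⊟ (⁺ (b % q) ⊞ ⁺ (b / q) ⊠ ⁺ q)) eq ⟩
    (⁺ (b % q) ⊞ ⁺ (a / q) ⊠ ⁺ q) ⊟ (⁺ (b % q) ⊞ ⁺ (b / q) ⊠ ⁺ q) ≡⟨ lem (⁺ (b % q)) (⁺ (a / q)) (⁺ (b / q)) (⁺ q) ⟩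
    (⁺ (a / q) ⊟ ⁺ (b / q)) ⊠ ⁺ q                                 ∎)
    where
    open ≡-Reasoning
    split : ∀ m → ⁺ m ≡ ⁺ (m % q) ⊞ ⁺ (m / q) ⊠ ⁺ q
    split m = trans (cong ⁺_ (m≡m%n+[m/n]*n m q))
      (trans (ℤₚ.pos-+ (m % q) (m / q * q)) (cong ((⁺ (m % q)) ⊞_) (ℤₚ.pos-* (m / q) q)))
    lem : ∀ r s t q → (r ⊞ s ⊠ q) ⊟ (r ⊞ t ⊠ q) ≡ (s ⊟ t) ⊠ q
    lem = ℤ-Ring.solve-∀

  _⊝_ : ∀ {n} → Vec ℤ n → Vec ℤ n → Vec ℤ n
  _⊝_ = zipWith _⊟_

  eval-⊝ : ∀ {n} (P Q : Vec ℤ n) x → eval (P ⊝ Q) x ≡ eval P x ⊟ eval Q x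
  eval-⊝ [] [] x = refl
  eval-⊝ (a ∷ P) (b ∷ Q) x = trans (cong (λ z → (a ⊟ b) ⊞ x ⊠ z) (eval-⊝ P Q x)) (lem a b x (eval P x) (eval Q x))
    where
    lem : ∀ a b x p q → (a ⊟ b) ⊞ x ⊠ (p ⊟ q) ≡ (a ⊞ x ⊠ p) ⊟ (b ⊞ x ⊠ q)
    lem = ℤ-Ring.solve-∀

  digits : ∀ d → ℕ → Vec ℤ (suc d)
  digits zero    ψ = 1ℤ ∷ []
  digits (suc d) ψ = ⁺ (ψ % 2) ∷ digits d (ψ / 2)

open Polynomial

-- Curves with binary coefficients

digitPoly : ℕ → ℕ → ℕ → ℕ
digitPoly zero    ψ x = 1
digitPoly (suc d) ψ x = ψ % 2 + x * digitPoly d (ψ / 2) x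

-- x^(d+1) + Σ_{i<d} ψᵢ x^(i+1), where ψᵢ are the binary digits of ψ: being monic, a curve is
-- never constant, and having no constant term, distinct curves stay distinct when translated.
curve : ℕ → ℕ → ℕ → ℕ
curve d ψ x = x * digitPoly d ψ x

eval-digits : ∀ d ψ x → eval (digits d ψ) (Int.+ x) ≡ Int.+ digitPoly d ψ x
eval-digits zero ψ x = trans (cong (λ z → Int.+ 1 Int.+ z) (ℤₚ.*-zeroʳ (Int.+ x))) refl
eval-digits (suc d) ψ x rewrite eval-digits d (ψ / 2) x =
  sym (trans (ℤₚ.pos-+ (ψ % 2) (x * digitPoly d (ψ / 2) x)) (cong (λ z → Int.+ (ψ % 2) Int.+ z) (ℤₚ.pos-* x _)))

-- Base 2 makes the coefficients serve every modulus: numbers below 2 ≤ q are equal once they are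
-- congruent modulo `q`. The bound 2^d ensures that no digit is cut off.
digits-injective : ∀ {q} → 2 ≤ q → ∀ d {ψ χ} → ψ < 2 ^ d → χ < 2 ^ d →
                   All (Int.+ q ℤ∣.∣_) (digits d ψ ⊝ digits d χ) → ψ ≡ χ
digits-injective 2≤q zero {zero} {zero} _ _ _ = refl
digits-injective 2≤q zero {suc ψ} (s≤s ()) _ _
digits-injective 2≤q zero {zero} {suc χ} _ (s≤s ()) _
digits-injective 2≤q (suc d) {ψ} {χ} ψ< χ< (q∣ ∷ all) = begin
  ψ                    ≡⟨ m≡m%n+[m/n]*n ψ 2 ⟩
  ψ % 2 + ψ / 2 * 2    ≡⟨ cong₂ (λ x y → x + y * 2) (∣-⇒≡ (<-≤-trans (m%n<n ψ 2) 2≤q) (<-≤-trans (m%n<n χ 2) 2≤q) q∣)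
                            (digits-injective 2≤q d (half ψ<) (half χ<) all) ⟩
  χ % 2 + χ / 2 * 2    ≡⟨ m≡m%n+[m/n]*n χ 2 ⟨
  χ                    ∎
  where
  open ≡-Reasoning
  half : ∀ {m} → m < 2 ^ suc d → m / 2 < 2 ^ d
  half {m} m< = m<n*o⇒m/o<n (subst (m <_) (*-comm 2 (2 ^ d)) m<)

digits-monic : ∀ {q} → 2 ≤ q → ∀ d ψ → ¬ All (Int.+ q ℤ∣.∣_) (digits d ψ)
digits-monic 2≤q zero ψ (q∣1 ∷ []) = contradiction (≤-trans 2≤q (∣⇒≤ (ℤ∣.∣⇒∣ᵤ q∣1))) λ { (s≤s ()) }
digits-monic 2≤q (suc d) ψ (_ ∷ all) = digits-monic 2≤q d (ψ / 2) all

prime⇒2≤ : ∀ {q} → Prime q → 2 ≤ q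
prime⇒2≤ {q} pq = nonTrivial⇒n>1 q {{prime⇒nonTrivial pq}}

-- The translations affect only the constant coefficient of the difference. Its other coefficients
-- are differences of digits, not all of them 0 modulo `q`, and the degree is at most d + 1.
count-curves-meet : ∀ {q} .{{_ : NonZero q}} → Prime q → ∀ d {ψ χ} → ψ < 2 ^ d → χ < 2 ^ d → ψ ≢ χ → ∀ j j′ →
  count {q} (λ x → ⌊ (curve d ψ (toℕ x) + j) % q ≟ (curve d χ (toℕ x) + j′) % q ⌋) ≤ suc d
count-curves-meet {q} pq d {ψ} {χ} ψ< χ< ψ≢χ j j′ =
  ≤-trans (count-mono λ x eq → ⇒⌊⌋ (_ ℤ∣.∣? _) (subst (Int.+ q ℤ∣.∣_) (lem x) (%≡⇒∣- _ _ (⌊⌋⇒ (_ ≟ _) eq))))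
    (count-roots pq P λ { (_ ∷ all) → ψ≢χ (digits-injective (prime⇒2≤ pq) d ψ< χ< all) })
  where
  P = (Int.+ j Int.- Int.+ j′) ∷ (digits d ψ ⊝ digits d χ)
  split : ∀ ψ j (x : Fin q) → Int.+ (curve d ψ (toℕ x) + j) ≡ Int.+ toℕ x Int.* eval (digits d ψ) (Int.+ toℕ x) Int.+ Int.+ j
  split ψ j x = trans (ℤₚ.pos-+ (curve d ψ (toℕ x)) j)
    (cong (Int._+ Int.+ j) (trans (ℤₚ.pos-* (toℕ x) _) (cong (λ z → Int.+ toℕ x Int.* z) (sym (eval-digits d ψ (toℕ x))))))
  ring : ∀ x a b j j′ → (x Int.* a Int.+ j) Int.- (x Int.* b Int.+ j′) ≡ (j Int.- j′) Int.+ x Int.* (a Int.- b)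
  ring = ℤ-Ring.solve-∀
  lem : ∀ (x : Fin q) → Int.+ (curve d ψ (toℕ x) + j) Int.- Int.+ (curve d χ (toℕ x) + j′) ≡ eval P (Int.+ toℕ x)
  lem x = trans (cong₂ Int._-_ (split ψ j x) (split χ j′ x))
    (trans (ring (Int.+ toℕ x) _ _ (Int.+ j) (Int.+ j′))
      (cong (λ z → (Int.+ j Int.- Int.+ j′) Int.+ Int.+ toℕ x Int.* z) (sym (eval-⊝ (digits d ψ) (digits d χ) (Int.+ toℕ x)))))

-- The leading coefficient 1 keeps curve minus constant non-zero modulo `q`. This case arises from
-- neighbours whose class is already fixed.
count-curve-hits : ∀ {q} .{{_ : NonZero q}} → Prime q → ∀ d ψ (y : ℕ) →
  count {q} (λ x → ⌊ curve d ψ (toℕ x) % q ≟ y % q ⌋) ≤ suc d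
count-curve-hits {q} pq d ψ y =
  ≤-trans (count-mono λ x eq → ⇒⌊⌋ (_ ℤ∣.∣? _) (subst (Int.+ q ℤ∣.∣_) (lem x) (%≡⇒∣- _ _ (⌊⌋⇒ (_ ≟ _) eq))))
    (count-roots pq P λ { (_ ∷ all) → digits-monic (prime⇒2≤ pq) d ψ all })
  where
  P = Int.- (Int.+ y) ∷ digits d ψ
  lem : ∀ (x : Fin q) → Int.+ curve d ψ (toℕ x) Int.- Int.+ y ≡ eval P (Int.+ toℕ x)
  lem x = trans (cong (Int._- Int.+ y) (trans (ℤₚ.pos-* (toℕ x) _) (cong (λ z → Int.+ toℕ x Int.* z) (sym (eval-digits d ψ (toℕ x))))))
    (ℤₚ.+-comm (Int.+ toℕ x Int.* eval (digits d ψ) (Int.+ toℕ x)) (Int.- (Int.+ y)))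

-- Message-passing programs and their simulation

record Finite (A : Set) : Set where
  field
    size    : ℕ
    enc     : A → Fin size
    dec     : Fin size → A
    dec-enc : ∀ a → dec (enc a) ≡ a

open Finite

finFinite : ∀ k → Finite (Fin k)
finFinite k = record { size = k ; enc = id ; dec = id ; dec-enc = λ _ → refl }

×-finite : ∀ {A B} → Finite A → Finite B → Finite (A × B)
×-finite a b = record
  { size    = size a * size b
  ; enc     = λ (x , y) → Fin.combine (enc a x) (enc b y)
  ; dec     = λ i → let j , k = Fin.remQuot (size b) i in dec a j , dec b k
  ; dec-enc = λ (x , y) → trans
      (cong (λ (j , k) → dec a j , dec b k) (Finₚ.remQuot-combine (enc a x) (enc b y)))
      (cong₂ _,_ (dec-enc a x) (dec-enc b y))
  }

⊎-finite : ∀ {A B} → Finite A → Finite B → Finite (A ⊎ B)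
⊎-finite a b = record
  { size    = size a + size b
  ; enc     = λ x → Fin.join (size a) (size b) (Sum.map (enc a) (enc b) x)
  ; dec     = λ i → Sum.map (dec a) (dec b) (Fin.splitAt (size a) i)
  ; dec-enc = λ x → trans (cong (Sum.map (dec a) (dec b)) (Finₚ.splitAt-join (size a) (size b) (Sum.map (enc a) (enc b) x))) (back x)
  }
  where
  back : ∀ x → Sum.map (dec a) (dec b) (Sum.map (enc a) (enc b) x) ≡ x
  back (inj₁ x) = cong inj₁ (dec-enc a x)
  back (inj₂ y) = cong inj₂ (dec-enc b y)

maybe-finite : ∀ {A} → Finite A → Finite (Maybe A)
maybe-finite a = record
  { size    = suc (size a)
  ; enc     = λ { nothing → zero ; (just x) → suc (enc a x) }
  ; dec     = λ { zero → nothing ; (suc i) → just (dec a i) }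
  ; dec-enc = λ { nothing → refl ; (just x) → cong just (dec-enc a x) }
  }

-- A vertex sees its neighbours only through the function telling how many of them satisfy a given predicate.
Step : Set → Set
Step St = St → ((St → Bool) → ℕ) → St

nbrCount : ∀ {n} {St : Set} → Graph n → (Fin n → St) → Fin n → (St → Bool) → ℕ
nbrCount G σ v P = count (λ u → adj G v u ∧ P (σ u))

-- Agreement of `Q` with the counts is demanded pointwise, because the counts recovered from a
-- multiset of colours are the same function only extensionally.
Round : ∀ {n St} → Graph n → Step St → (Fin n → St) → (Fin n → St) → Set
Round G s σ σ′ = ∀ v → ∃[ Q ] ((∀ P → Q P ≡ nbrCount G σ v P) × σ′ v ≡ s (σ v) Q)

data Runs {n St} (G : Graph n) : List (Step St) → (Fin n → St) → (Fin n → St) → Set where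
  done : ∀ {σ} → Runs G [] σ σ
  step : ∀ {s p σ σ₁ σ′} → Round G s σ σ₁ → Runs G p σ₁ σ′ → Runs G (s ∷ p) σ σ′

Runs-++ : ∀ {n St} {G : Graph n} (p {q} : List (Step St)) {σ σ′} → Runs G (p ++ q) σ σ′ →
          ∃[ σ₁ ] (Runs G p σ σ₁ × Runs G q σ₁ σ′)
Runs-++ []      r = _ , done , r
Runs-++ (s ∷ p) (step x r) = let σ₁ , r₁ , r₂ = Runs-++ p r in σ₁ , step x r₁ , r₂

forEach : ∀ {St} k → (Fin k → List (Step St)) → List (Step St)
forEach zero    f = []
forEach (suc k) f = f zero ++ forEach k (f ∘ suc)

forEach-invariant : ∀ {n St} {G : Graph n} k {f : Fin k → List (Step St)} (I : ℕ → (Fin n → St) → Set) →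
  (∀ i σ σ′ → I (toℕ i) σ → Runs G (f i) σ σ′ → I (suc (toℕ i)) σ′) →
  ∀ {σ σ′} → I 0 σ → Runs G (forEach k f) σ σ′ → I k σ′
forEach-invariant zero    I inv I₀ done = I₀
forEach-invariant (suc k) {f} I inv I₀ r =
  let σ₁ , r₁ , r₂ = Runs-++ (f zero) r
  in forEach-invariant k (I ∘ suc) (λ i → inv (suc i)) (inv zero _ _ I₀ r₁) r₂

length-forEach : ∀ {St} k (f : Fin k → List (Step St)) c → (∀ i → length (f i) ≡ c) → length (forEach k f) ≡ k * c
length-forEach zero    f c len = refl
length-forEach (suc k) f c len =
  trans (Listₚ.length-++ (f zero)) (cong₂ _+_ (len zero) (length-forEach k (f ∘ suc) c (len ∘ suc)))

Runs-lookup : ∀ {n St} {G : Graph n} (p : List (Step St)) (conf : ℕ → Fin n → St) →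
  (∀ i → Round G (Data.List.lookup p i) (conf (toℕ i)) (conf (suc (toℕ i)))) → Runs G p (conf 0) (conf (length p))
Runs-lookup []      conf round = done
Runs-lookup (s ∷ p) conf round = step (round zero) (Runs-lookup p (conf ∘ suc) (round ∘ suc))

-- The colour of a vertex is its identifier, the round number and its state, until in the
-- last round all vertices switch to their output, taken from a disjoint block of k colours.
module Simulation {St : Set} (fin : Finite St) (n Δ k : ℕ) (p : List (Step St))
                  (start : Fin n → St) (out : St → Fin k) (0<T : 0 < length p) where

  T : ℕ
  T = length p

  Colour : Set
  Colour = Fin k ⊎ (Fin n × (Fin T × St))

  colours : Finite Colour
  colours = ⊎-finite (finFinite k) (×-finite (finFinite n) (×-finite (finFinite T) fin))

  onState : (St → Bool) → Colour → Bool
  onState P (inj₁ _)           = false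
  onState P (inj₂ (_ , _ , s)) = P s

  next : Colour → ((St → Bool) → ℕ) → Colour
  next (inj₁ c) Q = inj₁ c
  next (inj₂ (v , t , s)) Q with suc (toℕ t) <? T
  ... | yes t<T = inj₂ (v , fromℕ< t<T , Data.List.lookup p t s Q)
  ... | no _    = inj₁ (out (Data.List.lookup p t s Q))

  query : (Fin (size colours) → ℕ) → (St → Bool) → ℕ
  query m P = sumFin (λ c → if onState P (dec colours c) then m c else 0)

  algorithm : LocIter n Δ
  algorithm = record
    { M      = size colours
    ; init   = λ v → enc colours (inj₂ (v , fromℕ< 0<T , start v))
    ; update = λ c m → enc colours (next (dec colours c) (query m))
    }

  query-nbrColors : ∀ (G : Graph n) (φ : Fin n → Fin (size colours)) v P →
    query (nbrColors G φ v) P ≡ count (λ u → adj G v u ∧ onState P (dec colours (φ u)))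
  query-nbrColors G φ v P = begin
    sumFin (λ c → if R c then sumFin (λ u → ⟦ adj G v u ∧ ⌊ φ u Fin.≟ c ⌋ ⟧) else 0)
      ≡⟨ sumFin-cong (λ c → if-sum (R c) _) ⟩
    sumFin (λ c → sumFin (λ u → if R c then ⟦ adj G v u ∧ ⌊ φ u Fin.≟ c ⌋ ⟧ else 0))
      ≡⟨ sumFin-swap (λ c u → if R c then ⟦ adj G v u ∧ ⌊ φ u Fin.≟ c ⌋ ⟧ else 0) ⟩
    sumFin (λ u → sumFin (λ c → if R c then ⟦ adj G v u ∧ ⌊ φ u Fin.≟ c ⌋ ⟧ else 0))
      ≡⟨ sumFin-cong (λ u → trans (sumFin-cong (λ c → flip (R c) (adj G v u) ⌊ φ u Fin.≟ c ⌋)) (sumFin-δ (φ u) (λ c → ⟦ adj G v u ∧ R c ⟧))) ⟩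
    count (λ u → adj G v u ∧ R (φ u)) ∎
    where
    open ≡-Reasoning
    R : Fin (size colours) → Bool
    R c = onState P (dec colours c)
    if-sum : ∀ b (f : Fin n → ℕ) → (if b then sumFin f else 0) ≡ sumFin (λ u → if b then f u else 0)
    if-sum true  f = refl
    if-sum false f = sym (sumFin-zero {n} (λ _ → refl))
    flip : ∀ r a e → (if r then ⟦ a ∧ e ⟧ else 0) ≡ (if e then ⟦ a ∧ r ⟧ else 0)
    flip true  true  true  = refl
    flip true  true  false = refl
    flip true  false true  = refl
    flip true  false false = refl
    flip false true  true  = refl
    flip false true  false = refl
    flip false false true  = refl
    flip false false false = refl

  module _ (G : Graph n) where

    decoded : ℕ → Fin n → Colour
    decoded t v = dec colours (run algorithm G t v)

    Q : ℕ → Fin n → (St → Bool) → ℕ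
    Q t v = query (nbrColors G (run algorithm G t) v)

    stepAt : ℕ → Step St
    stepAt t with t <? T
    ... | yes t<T = Data.List.lookup p (fromℕ< t<T)
    ... | no _    = λ s _ → s

    conf : ℕ → Fin n → St
    conf zero    v = start v
    conf (suc t) v = stepAt t (conf t v) (Q t v)

    stepAt-< : ∀ t (t<T : t < T) → stepAt t ≡ Data.List.lookup p (fromℕ< t<T)
    stepAt-< t t<T with t <? T
    ... | yes t<T′ = cong (λ z → Data.List.lookup p (fromℕ< z)) (≤-irrelevant t<T′ t<T)
    ... | no t≮T   = contradiction t<T t≮T

    decoded-suc : ∀ t v → decoded (suc t) v ≡ next (decoded t v) (Q t v)
    decoded-suc t v = dec-enc colours _

    next-inner : ∀ v (t : Fin T) s Q (t<T : suc (toℕ t) < T) →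
                 next (inj₂ (v , t , s)) Q ≡ inj₂ (v , fromℕ< t<T , Data.List.lookup p t s Q)
    next-inner v t s Q t<T with suc (toℕ t) <? T
    ... | yes t<T′ = cong (λ z → inj₂ (v , fromℕ< z , Data.List.lookup p t s Q)) (≤-irrelevant t<T′ t<T)
    ... | no t≮T   = contradiction t<T t≮T

    next-last : ∀ v (t : Fin T) s Q → suc (toℕ t) ≡ T → next (inj₂ (v , t , s)) Q ≡ inj₁ (out (Data.List.lookup p t s Q))
    next-last v t s Q t≡T with suc (toℕ t) <? T
    ... | yes t<T = contradiction t≡T (<⇒≢ t<T)
    ... | no _    = refl

    decoded-conf : ∀ t (t<T : t < T) v → decoded t v ≡ inj₂ (v , fromℕ< t<T , conf t v)
    decoded-conf zero t<T v = trans (dec-enc colours _) (cong (λ z → inj₂ (v , fromℕ< z , start v)) (≤-irrelevant 0<T t<T))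
    decoded-conf (suc t) 1+t<T v = begin
      decoded (suc t) v                               ≡⟨ decoded-suc t v ⟩
      next (decoded t v) (Q t v)                      ≡⟨ cong (λ c → next c (Q t v)) (decoded-conf t t<T v) ⟩
      next (inj₂ (v , i , conf t v)) (Q t v)          ≡⟨ next-inner v i (conf t v) (Q t v) 1+i<T ⟩
      inj₂ (v , fromℕ< 1+i<T , Data.List.lookup p i (conf t v) (Q t v))
        ≡⟨ cong₂ (λ j s → inj₂ (v , j , s)) (Finₚ.fromℕ<-cong _ _ (cong suc (Finₚ.toℕ-fromℕ< t<T)) 1+i<T 1+t<T)
             (cong (λ f → f (conf t v) (Q t v)) (sym (stepAt-< t t<T))) ⟩
      inj₂ (v , fromℕ< 1+t<T , conf (suc t) v)        ∎
      where
      open ≡-Reasoning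
      t<T = <-trans (n<1+n t) 1+t<T
      i = fromℕ< t<T
      1+i<T : suc (toℕ i) < T
      1+i<T = subst (λ z → suc z < T) (sym (Finₚ.toℕ-fromℕ< t<T)) 1+t<T

    decoded-last : ∀ v → decoded T v ≡ inj₁ (out (conf T v))
    decoded-last v = go T refl
      where
      open ≡-Reasoning
      go : ∀ t → t ≡ T → decoded t v ≡ inj₁ (out (conf t v))
      go zero 0≡T = contradiction 0≡T (<⇒≢ 0<T)
      go (suc t) 1+t≡T = begin
        decoded (suc t) v                               ≡⟨ decoded-suc t v ⟩
        next (decoded t v) (Q t v)                      ≡⟨ cong (λ c → next c (Q t v)) (decoded-conf t t<T v) ⟩
        next (inj₂ (v , i , conf t v)) (Q t v)          ≡⟨ next-last v i (conf t v) (Q t v) (trans (cong suc (Finₚ.toℕ-fromℕ< t<T)) 1+t≡T) ⟩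
        inj₁ (out (Data.List.lookup p i (conf t v) (Q t v)))
          ≡⟨ cong (λ f → inj₁ (out (f (conf t v) (Q t v)))) (sym (stepAt-< t t<T)) ⟩
        inj₁ (out (conf (suc t) v))                     ∎
        where
        t<T : t < T
        t<T = ≤-reflexive 1+t≡T
        i = fromℕ< t<T

    decoded-after : ∀ i v → decoded (i + T) v ≡ inj₁ (out (conf T v))
    decoded-after zero    v = decoded-last v
    decoded-after (suc i) v = trans (decoded-suc (i + T) v) (cong (λ c → next c (Q (i + T) v)) (decoded-after i v))

    conf-Runs : Runs G p start (conf T)
    conf-Runs = Runs-lookup p conf λ i v → Q (toℕ i) v , count≡ i v , step≡ i v
      where
      count≡ : ∀ (i : Fin T) v P → Q (toℕ i) v P ≡ nbrCount G (conf (toℕ i)) v P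
      count≡ i v P = trans (query-nbrColors G (run algorithm G (toℕ i)) v P)
        (count-cong λ u → cong (λ c → adj G v u ∧ onState P c) (decoded-conf (toℕ i) (Finₚ.toℕ<n i) u))
      step≡ : ∀ (i : Fin T) v → conf (suc (toℕ i)) v ≡ Data.List.lookup p i (conf (toℕ i) v) (Q (toℕ i) v)
      step≡ i v = cong (λ f → f (conf (toℕ i) v) (Q (toℕ i) v))
        (trans (stepAt-< (toℕ i) (Finₚ.toℕ<n i)) (cong (Data.List.lookup p) (Finₚ.fromℕ<-toℕ i (Finₚ.toℕ<n i))))

    correct : (∀ σ → Runs G p start σ → Proper G (out ∘ σ)) →
              (∀ t → Proper G (run algorithm G t)) × (∀ v → toℕ (run algorithm G T v) < k)
    correct proper = always-proper , final
      where
      always-proper : ∀ t → Proper G (run algorithm G t)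
      always-proper t u v uv eq with t <? T
      ... | yes t<T = true≢false uv (subst (λ w → adj G u w ≡ false) (ids (trans (sym (decoded-conf t t<T u)) (trans (cong (dec colours) eq) (decoded-conf t t<T v)))) (irrefl G u))
        where
        ids : ∀ {a b : Fin n} {x y : Fin T × St} → _≡_ {A = Colour} (inj₂ (a , x)) (inj₂ (b , y)) → a ≡ b
        ids refl = refl
      ... | no t≮T = proper (conf T) conf-Runs u v uv
              (outs (trans (sym (at u)) (trans (cong (dec colours) eq) (at v))))
        where
        outs : ∀ {a b : Fin k} → _≡_ {A = Colour} (inj₁ a) (inj₁ b) → a ≡ b
        outs refl = refl
        at : ∀ w → decoded t w ≡ inj₁ (out (conf T w))
        at w = subst (λ z → decoded z w ≡ inj₁ (out (conf T w))) (m∸n+n≡m (≮⇒≥ t≮T)) (decoded-after (t ∸ T) w)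
      -- Outputs form the left summand of `Colour`, so their codes are exactly the numbers below
      -- `k`.
      enc-dec : ∀ (x : Fin (size colours)) c → dec colours x ≡ inj₁ c → toℕ x < k
      enc-dec x c eq with Fin.splitAt k x in split
      ... | inj₁ y = subst (_< k) (trans (sym (Finₚ.toℕ-↑ˡ y _)) (cong toℕ (Finₚ.splitAt⁻¹-↑ˡ split))) (Finₚ.toℕ<n y)
      final : ∀ v → toℕ (run algorithm G T v) < k
      final v = enc-dec _ _ (decoded-last v)

-- The rounds of the algorithm and their correctness

retract-finite : ∀ {A B : Set} (f : A → B) (g : B → A) → (∀ a → g (f a) ≡ a) → Finite B → Finite A
retract-finite f g gf b = record
  { size = size b ; enc = enc b ∘ f ; dec = g ∘ dec b
  ; dec-enc = λ a → trans (cong g (dec-enc b (f a))) (gf a) }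

-- Incidences between vertices and points are counted by vertices instead of by points; `R u` is the
-- set of points spoilt by the neighbour u.
double-count : ∀ {n m} (A : Fin n → Bool) (R : Fin n → Fin m → Bool) c → (∀ u → A u ≡ true → count (R u) ≤ c) →
               sumFin (λ x → count (λ u → A u ∧ R u x)) ≤ count A * c
double-count {n} {m} A R c R≤c = begin
  sumFin (λ x → sumFin (λ u → ⟦ A u ∧ R u x ⟧))   ≡⟨ sumFin-swap (λ x u → ⟦ A u ∧ R u x ⟧) ⟩
  sumFin (λ u → count (λ x → A u ∧ R u x))        ≤⟨ sumFin-mono (λ u → row (A u) (R u) (R≤c u)) ⟩
  sumFin (λ u → ⟦ A u ⟧ * c)                       ≡⟨ sumFin-*ʳ (λ u → ⟦ A u ⟧) c ⟩
  count A * c                                      ∎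
  where
  open ≤-Reasoning
  row : ∀ a (r : Fin m → Bool) → (a ≡ true → count r ≤ c) → count (λ x → a ∧ r x) ≤ ⟦ a ⟧ * c
  row true  r r≤c = ≤-trans (r≤c refl) (≤-reflexive (sym (+-identityʳ c)))
  row false r r≤c = ≤-reflexive (sumFin-zero {m} (λ _ → refl))

∧-assocʳ : ∀ {a b c} → a ∧ (b ∧ c) ≡ true → (a ∧ b) ∧ c ≡ true
∧-assocʳ {true} {true} {true} _ = refl

∨-introˡ : ∀ {a b} → a ≡ true → a ∨ b ≡ true
∨-introˡ refl = refl

∨-introʳ : ∀ {a b} → b ≡ true → a ∨ b ≡ true
∨-introʳ {true}  _ = refl
∨-introʳ {false} b = b

∨-elim : ∀ {a b} → a ∨ b ≡ true → a ≡ true ⊎ b ≡ true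
∨-elim {true}  _ = inj₁ refl
∨-elim {false} b = inj₂ b

unset : ∀ {A : Set} → Maybe A → Bool
unset nothing  = true
unset (just _) = false

-- The moduli p and q are primes; in the state, base is the colour of Linial's phase, final
-- the colour that is eventually output, class the class in the current arbdefective
-- colouring together with the round in which it was chosen, and part is the chosen
-- translate of the curve of base in the palette {0..Δ}, which is laid out as a subset of a
-- p × p grid.
module Rounds (Δ Ψ p q d : ℕ) (p-prime : Prime p) (q-prime : Prime q) (Δ<p² : Δ < p * p) where

  instance
    p≢0 : NonZero p
    p≢0 = prime⇒nonZero p-prime
    q≢0 : NonZero q
    q≢0 = prime⇒nonZero q-prime

  S : ℕ
  S = suc d

  record State : Set where
    constructor state
    field
      base  : Fin Ψ
      final : Maybe (Fin (suc Δ))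
      class : Maybe (Fin q × Fin q)
      part  : Fin p

  open State

  state-finite : Finite State
  state-finite = retract-finite (λ s → base s , final s , class s , part s) (λ (b , f , c , j) → state b f c j) (λ _ → refl)
    (×-finite (finFinite Ψ) (×-finite (maybe-finite (finFinite (suc Δ)))
      (×-finite (maybe-finite (×-finite (finFinite q) (finFinite q))) (finFinite p))))

  pending : State → Bool
  pending s = unset (final s)

  pendingDegree : ∀ {n} → Graph n → (Fin n → State) → Fin n → ℕ
  pendingDegree G σ v = nbrCount G σ v pending

  valueAt : ℕ → ∀ m .{{_ : NonZero m}} → State → Fin m → Fin m
  valueAt e m s x = curve e (toℕ (base s)) (toℕ x) mod m

  toℕ-mod : ∀ a m .{{_ : NonZero m}} → toℕ (a mod m) ≡ a % m
  toℕ-mod a m = Finₚ.toℕ-fromℕ< (m%n<n a m)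

  count-values-meet : ∀ e {m} .{{_ : NonZero m}} → Prime m → ∀ s s′ → toℕ (base s) < 2 ^ e → toℕ (base s′) < 2 ^ e →
                      base s ≢ base s′ → count (λ x → ⌊ valueAt e m s x Fin.≟ valueAt e m s′ x ⌋) ≤ suc e
  count-values-meet e {m} m-prime s s′ s< s′< s≢s′ =
    ≤-trans (count-mono λ x eq → ⇒⌊⌋ (_ ≟ _) (lem x (⌊⌋⇒ (_ Fin.≟ _) eq)))
      (count-curves-meet m-prime e s< s′< (s≢s′ ∘ Finₚ.toℕ-injective) 0 0)
    where
    lem : ∀ x → valueAt e m s x ≡ valueAt e m s′ x →
          (curve e (toℕ (base s)) (toℕ x) + 0) % m ≡ (curve e (toℕ (base s′)) (toℕ x) + 0) % m
    lem x eq = subst₂ (λ a b → a % m ≡ b % m) (sym (+-identityʳ _)) (sym (+-identityʳ _))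
      (trans (sym (toℕ-mod _ m)) (trans (cong toℕ eq) (toℕ-mod _ m)))

  -- Linial's colour reduction

  ProperBase : ∀ {n} → Graph n → (Fin n → State) → Set
  ProperBase G σ = Proper G (base ∘ σ)

  linialPoint : ∀ e m .{{_ : NonZero m}} → State → ((State → Bool) → ℕ) → Fin m
  linialPoint e m s Q = pick (0 mod m) (λ x → ⌊ Q (λ s′ → ⌊ valueAt e m s′ x Fin.≟ valueAt e m s x ⌋) ≟ 0 ⌋)

  -- The pair (x, g(x)) is coded as a number below m² inside the fixed type `Fin Ψ`, so the state
  -- keeps its type while the colours shrink.
  linial : ∀ e m .{{_ : NonZero m}} → m * m ≤ Ψ → Step State
  linial e m m²≤Ψ s Q =
    record s { base = let x = linialPoint e m s Q in Fin.inject≤ (Fin.combine x (valueAt e m s x)) m²≤Ψ }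

  module _ {n} (G : Graph n) (deg≤Δ : ∀ v → degree G v ≤ Δ) where

    -- Each neighbour spoils at most e + 1 of the m abscissae, so some x has the vertex's value
    -- shared by no neighbour. Two adjacent vertices with equal pairs would share both x and the
    -- value at x, contrary to that choice.
    linial-correct : ∀ e {m} .{{_ : NonZero m}} → Prime m → (m²≤Ψ : m * m ≤ Ψ) → Δ * suc e < m →
      ∀ {σ σ′} → Round G (linial e m m²≤Ψ) σ σ′ → ProperBase G σ → (∀ v → toℕ (base (σ v)) < 2 ^ e) →
      ProperBase G σ′ × (∀ v → toℕ (base (σ′ v)) < m * m) × (∀ v → final (σ′ v) ≡ final (σ v))
    linial-correct e {m} m-prime m²≤Ψ big {σ} {σ′} round proper small =
      proper′ , (λ v → subst (_< m * m) (sym (base≡ v)) (Finₚ.toℕ<n (Fin.combine (point v) _))) ,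
      λ v → cong final (proj₂ (proj₂ (round v)))
      where
      point : Fin n → Fin m
      point v = linialPoint e m (σ v) (proj₁ (round v))
      newBase : Fin n → Fin (m * m)
      newBase v = Fin.combine (point v) (valueAt e m (σ v) (point v))
      base′ : ∀ v → base (σ′ v) ≡ Fin.inject≤ (newBase v) m²≤Ψ
      base′ v = cong base (proj₂ (proj₂ (round v)))
      base≡ : ∀ v → toℕ (base (σ′ v)) ≡ toℕ (newBase v)
      base≡ v = trans (cong toℕ (base′ v)) (Finₚ.toℕ-inject≤ (newBase v) m²≤Ψ)
      agree : Fin n → Fin m → State → Bool
      agree v x s′ = ⌊ valueAt e m s′ x Fin.≟ valueAt e m (σ v) x ⌋
      few : ∀ v → sumFin (λ x → nbrCount G σ v (agree v x)) < sumFin {m} (λ _ → 1)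
      few v = begin-strict
        sumFin (λ x → nbrCount G σ v (agree v x))
          ≤⟨ double-count (adj G v) (λ u x → agree v x (σ u)) (suc e)
               (λ u vu → count-values-meet e m-prime (σ u) (σ v) (small u) (small v) (proper v u vu ∘ sym)) ⟩
        degree G v * suc e      ≤⟨ *-monoˡ-≤ (suc e) (deg≤Δ v) ⟩
        Δ * suc e               <⟨ big ⟩
        m                       ≡⟨ trans (sumFin-const m 1) (*-identityʳ m) ⟨
        sumFin {m} (λ _ → 1)    ∎
        where open ≤-Reasoning
      point-free : ∀ v → nbrCount G σ v (agree v (point v)) ≡ 0
      point-free v =
        let Q , Q≡ , _ = round v
            x , free = sumFin-pigeonhole (λ x → nbrCount G σ v (agree v x)) (λ _ → 1) (few v)
        in trans (sym (Q≡ _)) (⌊⌋⇒ (_ ≟ 0) (pick-correct (0 mod m) (λ x → ⌊ Q (agree v x) ≟ 0 ⌋) x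
             (⇒⌊⌋ (_ ≟ 0) (trans (Q≡ _) (n<1⇒n≡0 free)))))
      proper′ : ProperBase G σ′
      proper′ u v uv eq = true≢false (∧-intro uv (⇒⌊⌋ (_ Fin.≟ _) agree-uv))
                                     (count≡0 _ (point-free u) v)
        where
        both : newBase u ≡ newBase v
        both = Finₚ.inject≤-injective m²≤Ψ m²≤Ψ _ _ (trans (sym (base′ u)) (trans eq (base′ v)))
        xy = Finₚ.combine-injective (point u) _ (point v) _ both
        agree-uv : valueAt e m (σ v) (point u) ≡ valueAt e m (σ u) (point u)
        agree-uv = trans (cong (valueAt e m (σ v)) (proj₁ xy)) (sym (proj₂ xy))

  -- Classes in which every vertex has few out-neighbours

  hasClass : Fin q → State → Bool
  hasClass y s = maybe′ (λ (y′ , _) → ⌊ y′ Fin.≟ y ⌋) false (class s)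

  stamp : State → ℕ
  stamp s = maybe′ (λ (_ , x) → toℕ x) 0 (class s)

  -- Counting the classified neighbours whose curve passes through y as well makes the crowd
  -- at a given x nondecreasing over the rounds.
  collides : Fin q → Fin q → State → Bool
  collides x y s = pending s ∧ (⌊ valueAt d q s x Fin.≟ y ⌋ ∨ hasClass y s)

  classify : ℕ → Fin q → Step State
  classify β x s Q =
    if pending s ∧ (unset (class s) ∧ ⌊ Q (collides x (valueAt d q s x)) ≤? β ⌋)
    then record s { class = just (valueAt d q s x , x) } else s

  declassify : Step State
  declassify s _ = record s { class = nothing }

  -- Orients the edges inside a class: of two adjacent vertices, the one classified no earlier
  -- avoids the curve of the other.
  outNeighbour : Fin q → ℕ → State → Bool
  outNeighbour y t s = pending s ∧ (hasClass y s ∧ ⌊ stamp s ≤? t ⌋)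

  hasClass⇒≡ : ∀ {y y′ x′ s} → class s ≡ just (y′ , x′) → hasClass y s ≡ true → y′ ≡ y
  hasClass⇒≡ {y} {y′} {s = s} eq has rewrite eq = ⌊⌋⇒ (y′ Fin.≟ y) has

  ≡⇒hasClass : ∀ {y x s} → class s ≡ just (y , x) → hasClass y s ≡ true
  ≡⇒hasClass {y} eq rewrite eq = ⇒⌊⌋ (y Fin.≟ y) refl

  stamp≡ : ∀ {y x s} → class s ≡ just (y , x) → stamp s ≡ toℕ x
  stamp≡ eq rewrite eq = refl

  -- A neighbour collides either by its curve or by the class that it already holds, and each of the
  -- two can happen in at most `S` rounds.
  count-collisions : ∀ s s′ → toℕ (base s) < 2 ^ d → toℕ (base s′) < 2 ^ d → base s ≢ base s′ →
    count (λ x → ⌊ valueAt d q s′ x Fin.≟ valueAt d q s x ⌋ ∨ hasClass (valueAt d q s x) s′) ≤ 2 * S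
  count-collisions s s′ s< s′< s≢s′ = begin
    count (λ x → ⌊ valueAt d q s′ x Fin.≟ valueAt d q s x ⌋ ∨ hasClass (valueAt d q s x) s′)
      ≤⟨ count-∨ _ (λ x → ⌊ valueAt d q s′ x Fin.≟ valueAt d q s x ⌋) (λ x → hasClass (valueAt d q s x) s′) (λ x → ∨-elim) ⟩
    count (λ x → ⌊ valueAt d q s′ x Fin.≟ valueAt d q s x ⌋) + count (λ x → hasClass (valueAt d q s x) s′)
      ≤⟨ +-mono-≤ (count-values-meet d q-prime s′ s s′< s< (s≢s′ ∘ sym)) (hits (class s′)) ⟩
    S + S     ≡⟨ cong (S +_) (+-identityʳ S) ⟨
    2 * S     ∎
    where
    open ≤-Reasoning
    hits : ∀ c → count (λ x → maybe′ (λ (y′ , _) → ⌊ y′ Fin.≟ valueAt d q s x ⌋) false c) ≤ S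
    hits nothing  = ≤-trans (≤-reflexive (sumFin-zero {q} (λ _ → refl))) z≤n
    hits (just (y′ , _)) = ≤-trans (count-mono λ x eq → ⇒⌊⌋ (_ ≟ _) (lem x (⌊⌋⇒ (y′ Fin.≟ _) eq)))
                                   (count-curve-hits q-prime d (toℕ (base s)) (toℕ y′))
      where
      lem : ∀ x → y′ ≡ valueAt d q s x → curve d (toℕ (base s)) (toℕ x) % q ≡ toℕ y′ % q
      lem x eq = sym (trans (cong (_% q) (trans (cong toℕ eq) (toℕ-mod _ q))) (m%n%n≡m%n _ q))

  -- Final colours on translates of curves

  finalIs : Fin (suc Δ) → State → Bool
  finalIs f s = maybe′ (λ f′ → ⌊ f′ Fin.≟ f ⌋) false (final s)

  free : ((State → Bool) → ℕ) → Fin (suc Δ) → Bool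
  free Q f = ⌊ Q (finalIs f) ≟ 0 ⌋

  -- Colour f is the grid point (f / p , f % p).
  onCurve : Fin Ψ → Fin p → Fin (suc Δ) → Bool
  onCurve b j f = ⌊ (curve d (toℕ b) (toℕ f / p) + toℕ j) % p ≟ toℕ f % p ⌋

  blocks : Fin q → ℕ → Fin (suc Δ) → State → Bool
  blocks c t f s = outNeighbour c t s ∧ onCurve (base s) (part s) f

  -- A vertex with fewer than D/2 pending neighbours is left to the next stage.
  active : Fin q → ℕ → State → ((State → Bool) → ℕ) → Bool
  active c D s Q = pending s ∧ (hasClass c s ∧ ⌊ D ≤? 2 * Q pending ⌋)

  choosePart : ℕ → ℕ → Fin q → Step State
  choosePart β D c s Q =
    if active c D s Q
    then record s { part = pick (part s) (λ j → ⌊ S * β <? count (λ f → free Q f ∧ onCurve (base s) j f) ⌋) }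
    else s

  chooseFinal : ℕ → Fin q → Step State
  chooseFinal D c s Q =
    if active c D s Q
    then record s { final = just (pick zero (λ f →
           (free Q f ∧ onCurve (base s) (part s) f) ∧ ⌊ Q (blocks c (stamp s) f) ≟ 0 ⌋)) }
    else s

  translate-exists : ∀ b f → ∃[ j ] onCurve b j f ≡ true
  translate-exists b f = x mod p , ⇒⌊⌋ (_ ≟ _) (begin
    (c + toℕ (x mod p)) % p                     ≡⟨ cong (λ z → (c + z) % p) (toℕ-mod x p) ⟩
    (c + x % p) % p                             ≡⟨ %-distribˡ-+ c (x % p) p ⟩
    (c % p + x % p % p) % p                     ≡⟨ cong (λ z → (c % p + z) % p) (m%n%n≡m%n x p) ⟩
    (c % p + x % p) % p                         ≡⟨ %-distribˡ-+ c x p ⟨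
    (c + (g + (p ∸ c % p))) % p                 ≡⟨ cong (_% p) whole ⟩
    (g + suc (c / p) * p) % p                   ≡⟨ [m+kn]%n≡m%n g (suc (c / p)) p ⟩
    g % p                                       ∎)
    where
    open ≡-Reasoning
    g = toℕ f
    c = curve d (toℕ b) (toℕ f / p)
    -- This is g - c modulo `p`; the truncated subtraction is exact since c % p ≤ p.
    x = g + (p ∸ c % p)
    lem : ∀ r k g y → (r + k) + (g + y) ≡ g + ((y + r) + k)
    lem = solve-∀
    whole : c + x ≡ g + suc (c / p) * p
    whole = begin
      c + x                                        ≡⟨ cong (_+ x) (m≡m%n+[m/n]*n c p) ⟩
      (c % p + c / p * p) + (g + (p ∸ c % p))      ≡⟨ lem (c % p) (c / p * p) g (p ∸ c % p) ⟩
      g + ((p ∸ c % p + c % p) + c / p * p)        ≡⟨ cong (λ z → g + (z + c / p * p)) (m∸n+n≡m (m%n≤n c p)) ⟩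
      g + suc (c / p) * p                          ∎

  -- A curve has one point in each column, so a common colour is determined by its column, where the
  -- two polynomials agree modulo `p`. Since Δ < p², columns are elements of `Fin p`.
  count-curves-intersect : ∀ b b′ j j′ → toℕ b < 2 ^ d → toℕ b′ < 2 ^ d → b ≢ b′ →
                           count (λ f → onCurve b j f ∧ onCurve b′ j′ f) ≤ S
  count-curves-intersect b b′ j j′ b< b′< b≢b′ =
    ≤-trans (count-injective (λ f → onCurve b j f ∧ onCurve b′ j′ f) meets column column-meets column-injective)
            (count-curves-meet p-prime d b< b′< (b≢b′ ∘ Finₚ.toℕ-injective) (toℕ j) (toℕ j′))
    where
    meets : Fin p → Bool
    meets x = ⌊ (curve d (toℕ b) (toℕ x) + toℕ j) % p ≟ (curve d (toℕ b′) (toℕ x) + toℕ j′) % p ⌋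
    column : Fin (suc Δ) → Fin p
    column f = fromℕ< (m<n*o⇒m/o<n (≤-<-trans (≤-pred (Finₚ.toℕ<n f)) Δ<p²))
    toℕ-column : ∀ f → toℕ (column f) ≡ toℕ f / p
    toℕ-column f = Finₚ.toℕ-fromℕ< _
    column-meets : ∀ f → onCurve b j f ∧ onCurve b′ j′ f ≡ true → meets (column f) ≡ true
    column-meets f h = let on , on′ = ∧-elim h in ⇒⌊⌋ (_ ≟ _)
      (subst (λ x → (curve d (toℕ b) x + toℕ j) % p ≡ (curve d (toℕ b′) x + toℕ j′) % p) (sym (toℕ-column f))
        (trans (⌊⌋⇒ (_ ≟ _) on) (sym (⌊⌋⇒ (_ ≟ _) on′))))
    column-injective : ∀ f g → onCurve b j f ∧ onCurve b′ j′ f ≡ true → onCurve b j g ∧ onCurve b′ j′ g ≡ true →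
                       column f ≡ column g → f ≡ g
    column-injective f g hf hg eq = Finₚ.toℕ-injective (begin
      toℕ f                              ≡⟨ m≡m%n+[m/n]*n (toℕ f) p ⟩
      toℕ f % p + toℕ f / p * p          ≡⟨ cong₂ (λ r x → r + x * p) same-row same-column ⟩
      toℕ g % p + toℕ g / p * p          ≡⟨ m≡m%n+[m/n]*n (toℕ g) p ⟨
      toℕ g                              ∎)
      where
      open ≡-Reasoning
      same-column : toℕ f / p ≡ toℕ g / p
      same-column = trans (sym (toℕ-column f)) (trans (cong toℕ eq) (toℕ-column g))
      same-row : toℕ f % p ≡ toℕ g % p
      same-row = trans (sym (⌊⌋⇒ (_ ≟ _) (proj₁ (∧-elim hf))))
        (trans (cong (λ x → (curve d (toℕ b) x + toℕ j) % p) same-column) (⌊⌋⇒ (_ ≟ _) (proj₁ (∧-elim hg))))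

  -- Stages and their parameters

  stage : ℕ → ℕ → List (Step State)
  stage β D = declassify ∷
    (forEach q (λ x → classify β x ∷ []) ++ forEach q (λ c → choosePart β D c ∷ chooseFinal D c ∷ []))

  length-stage : ∀ β D → length (stage β D) ≡ suc (q * 1 + q * 2)
  length-stage β D = cong suc (trans (Listₚ.length-++ (forEach q (λ x → classify β x ∷ [])))
    (cong₂ _+_ (length-forEach q _ 1 (λ _ → refl)) (length-forEach q _ 2 (λ _ → refl))))

  halve : ℕ → ℕ → ℕ
  halve zero    E = E
  halve (suc i) E = ⌊ halve i E /2⌋

  instance
    pS≢0 : NonZero (p * S)
    pS≢0 = m*n≢0 p S
    2pS≢0 : NonZero (2 * (p * S))
    2pS≢0 = m*n≢0 2 (p * S)

  -- The largest out-degree that the choice of a final colour tolerates. It may be 0; then no two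
  -- pending vertices of one class are adjacent.
  outBound : ℕ → ℕ
  outBound D = D / (2 * (p * S))

  stages : ℕ → ℕ → List (Step State)
  stages k E = forEach k (λ i → let D = halve (suc (toℕ i)) E in stage (outBound D) D)

  length-stages : ∀ k E → length (stages k E) ≡ k * suc (q * 1 + q * 2)
  length-stages k E = length-forEach k _ _ (λ i → length-stage _ _)

  outBound-wide : ∀ D → 2 * (p * (S * outBound D)) ≤ D
  outBound-wide D = ≤-trans (≤-reflexive (lem p S (outBound D))) (m/n*n≤m D (2 * (p * S)))
    where
    lem : ∀ p S β → 2 * (p * (S * β)) ≡ β * (2 * (p * S))
    lem = solve-∀

  -- A crowd above β means at least β + 1 neighbours, and this successor makes up for the rounding
  -- in `outBound`.
  outBound-enough : 2 * (p * S) * (2 * S) ≤ q → ∀ D → D * (2 * S) < q * suc (outBound D)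
  outBound-enough q-big D = begin-strict
    D * (2 * S)                                        <⟨ *-monoˡ-< (2 * S) D< ⟩
    suc (outBound D) * (2 * (p * S)) * (2 * S)         ≡⟨ *-assoc (suc (outBound D)) (2 * (p * S)) (2 * S) ⟩
    suc (outBound D) * (2 * (p * S) * (2 * S))         ≤⟨ *-monoʳ-≤ (suc (outBound D)) q-big ⟩
    suc (outBound D) * q                               ≡⟨ *-comm (suc (outBound D)) q ⟩
    q * suc (outBound D)                               ∎
    where
    open ≤-Reasoning
    W = 2 * (p * S)
    D< : D < suc (outBound D) * W
    D< = begin-strict
      D                        ≡⟨ m≡m%n+[m/n]*n D W ⟩
      D % W + D / W * W        <⟨ +-monoˡ-< (D / W * W) (m%n<n D W) ⟩
      suc (outBound D) * W     ∎

  record LinialSchedule : Set where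
    field
      bits       : ℕ → ℕ
      modulus    : ℕ → ℕ
      prime-mod  : ∀ i → Prime (modulus i)
      fits       : ∀ i → modulus i * modulus i ≤ Ψ
      large      : ∀ i → Δ * suc (bits i) < modulus i
      next-bits  : ∀ i → modulus i * modulus i ≤ 2 ^ bits (suc i)

  open LinialSchedule

  linialRounds : LinialSchedule → ℕ → List (Step State)
  linialRounds sch k = forEach k λ i →
    linial (bits sch (toℕ i)) (modulus sch (toℕ i)) {{prime⇒nonZero (prime-mod sch (toℕ i))}} (fits sch (toℕ i)) ∷ []

  module _ {n} (G : Graph n) (deg≤Δ : ∀ v → degree G v ≤ Δ) where

    -- Invariants of the stages

    record Valid (σ : Fin n → State) : Set where
      field
        base-proper  : ProperBase G σ
        base-small   : ∀ v → toℕ (base (σ v)) < 2 ^ d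
        final-proper : ∀ u v c → adj G u v ≡ true → final (σ u) ≡ just c → final (σ v) ≡ just c → ⊥

    open Valid

    -- In this doubled, strict form the bound is the negation of the degree test in `active`; it
    -- holds at the start for E = 2Δ + 1, and for E = 0 it says that nobody is pending.
    PendingDegree< : ℕ → (Fin n → State) → Set
    PendingDegree< E σ = ∀ v → pending (σ v) ≡ true → 2 * pendingDegree G σ v < E

    Valid-transfer : ∀ {σ σ′} → (∀ v → base (σ′ v) ≡ base (σ v)) → (∀ v → final (σ′ v) ≡ final (σ v)) → Valid σ → Valid σ′
    Valid-transfer b f val = record
      { base-proper  = λ u v uv eq → base-proper val u v uv (trans (sym (b u)) (trans eq (b v)))
      ; base-small   = λ v → subst (λ z → toℕ z < 2 ^ d) (sym (b v)) (base-small val v)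
      ; final-proper = λ u v c uv fu fv → final-proper val u v c uv (trans (sym (f u)) fu) (trans (sym (f v)) fv)
      }

    pendingDegree-cong : ∀ {σ σ′} → (∀ v → final (σ′ v) ≡ final (σ v)) → ∀ v → pendingDegree G σ′ v ≡ pendingDegree G σ v
    pendingDegree-cong f v = count-cong λ u → cong (λ z → adj G v u ∧ unset z) (f u)

    PendingDegree<-transfer : ∀ {E σ σ′} → (∀ v → final (σ′ v) ≡ final (σ v)) → PendingDegree< E σ → PendingDegree< E σ′
    PendingDegree<-transfer {E} {σ} {σ′} f low v pend =
      subst (λ z → 2 * z < E) (sym (pendingDegree-cong {σ} {σ′} f v)) (low v (trans (cong unset (sym (f v))) pend))

    nbrCount-mono : ∀ (σ σ′ : Fin n → State) (P P′ : State → Bool) v →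
      (∀ u → adj G v u ≡ true → P (σ u) ≡ true → P′ (σ′ u) ≡ true) → nbrCount G σ v P ≤ nbrCount G σ′ v P′
    nbrCount-mono σ σ′ P P′ v P⇒P′ = count-mono λ u h → let vu , Pu = ∧-elim h in ∧-intro vu (P⇒P′ u vu Pu)

    -- Correctness of the classification

    module Classification (β : ℕ) where

      -- `crowded` keeps the evidence of all failed rounds until it is summed up in
      -- `all-classified`. The bound on the stamp in `few-out` is what protects the out-degree
      -- against later arrivals.
      record Classified (k : ℕ) (σ : Fin n → State) (v : Fin n) : Set where
        field
          few-out   : ∀ y x → class (σ v) ≡ just (y , x) →
                      toℕ x < k × nbrCount G σ v (outNeighbour y (toℕ x)) ≤ β
          crowded   : class (σ v) ≡ nothing → ∀ x → toℕ x < k →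
                      β < nbrCount G σ v (collides x (valueAt d q (σ v) x))

      open Classified

      Invariant : ℕ → ℕ → (Fin n → State) → Set
      Invariant E k σ = Valid σ × PendingDegree< E σ × (∀ v → pending (σ v) ≡ true → Classified k σ v)

      module _ (x : Fin q) {σ σ′} (round : Round G (classify β x) σ σ′) where

        crowd : Fin n → ℕ
        crowd v = nbrCount G σ v (collides x (valueAt d q (σ v) x))

        classify-cases : ∀ v →
          (class (σ v) ≡ nothing × crowd v ≤ β × σ′ v ≡ record (σ v) { class = just (valueAt d q (σ v) x , x) })
          ⊎ (σ′ v ≡ σ v × (pending (σ v) ≡ true → class (σ v) ≡ nothing → β < crowd v))
        classify-cases v with round v
        ... | Q , Q≡ , eq with true-or-false (pending (σ v) ∧ (unset (class (σ v)) ∧ ⌊ Q (collides x (valueAt d q (σ v) x)) ≤? β ⌋))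
        ...   | inj₁ t rewrite t =
          let _ , t′ = ∧-elim {pending (σ v)} t
              un , le = ∧-elim {unset (class (σ v))} t′
          in inj₁ (unset⇒nothing (class (σ v)) un , subst (_≤ β) (Q≡ _) (⌊⌋⇒ (_ ≤? β) le) , eq)
          where
          unset⇒nothing : ∀ {A : Set} (m : Maybe A) → unset m ≡ true → m ≡ nothing
          unset⇒nothing nothing _ = refl
        ...   | inj₂ f rewrite f = inj₂ (eq , λ pend none → subst (β <_) (Q≡ _) (≰⇒> λ le →
          true≢false (∧-intro pend (∧-intro (cong unset none) (⇒⌊⌋ (_ ≤? β) le))) f))

        base-same : ∀ v → base (σ′ v) ≡ base (σ v)
        base-same v with classify-cases v
        ... | inj₁ (_ , _ , eq) = cong base eq
        ... | inj₂ (eq , _) = cong base eq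

        final-same : ∀ v → final (σ′ v) ≡ final (σ v)
        final-same v with classify-cases v
        ... | inj₁ (_ , _ , eq) = cong final eq
        ... | inj₂ (eq , _) = cong final eq

        hasClass-persists : ∀ y u → hasClass y (σ u) ≡ true → hasClass y (σ′ u) ≡ true
        hasClass-persists y u has with classify-cases u
        ... | inj₁ (none , _ , _) = ⊥-elim (true≢false has (cong (maybe′ (λ (y′ , _) → ⌊ y′ Fin.≟ y ⌋) false) none))
        ... | inj₂ (eq , _) = trans (cong (hasClass y) eq) has

        pending-same : ∀ u → pending (σ′ u) ≡ pending (σ u)
        pending-same u = cong unset (final-same u)

        value-same : ∀ u x′ → valueAt d q (σ′ u) x′ ≡ valueAt d q (σ u) x′
        value-same u x′ = cong (λ b → curve d (toℕ b) (toℕ x′) mod q) (base-same u)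

        collides-persists : ∀ x′ y u → collides x′ y (σ u) ≡ true → collides x′ y (σ′ u) ≡ true
        collides-persists x′ y u h with ∧-elim {pending (σ u)} h
        ... | pend , h′ with ∨-elim {⌊ valueAt d q (σ u) x′ Fin.≟ y ⌋} h′
        ...   | inj₁ val = ∧-intro (trans (pending-same u) pend) (∨-introˡ (trans (cong (λ z → ⌊ z Fin.≟ y ⌋) (value-same u x′)) val))
        ...   | inj₂ has = ∧-intro (trans (pending-same u) pend) (∨-introʳ {⌊ valueAt d q (σ′ u) x′ Fin.≟ y ⌋} (hasClass-persists y u has))

        -- A vertex of class y after round x either has just entered, so its curve passes through y
        -- at x, or held y before. `collides` covers both, so a calm crowd bounds the out-degree on
        -- entry.
        out⇒collides : ∀ y t u → outNeighbour y t (σ′ u) ≡ true → collides x y (σ u) ≡ true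
        out⇒collides y t u h with ∧-elim {pending (σ′ u)} h
        ... | pend , h′ with proj₁ (∧-elim {hasClass y (σ′ u)} h′) | classify-cases u
        ...   | has | inj₁ (_ , _ , eq) = ∧-intro (trans (sym (pending-same u)) pend)
                  (∨-introˡ (trans (sym (cong (hasClass y) eq)) has))
        ...   | has | inj₂ (eq , _) = ∧-intro (trans (sym (pending-same u)) pend)
                  (∨-introʳ {⌊ valueAt d q (σ u) x Fin.≟ y ⌋} (trans (sym (cong (hasClass y) eq)) has))

        -- A vertex entering in this round carries the stamp x > t, too late to become an
        -- out-neighbour of a vertex with stamp t.
        out-earlier : ∀ y t u → t < toℕ x → outNeighbour y t (σ′ u) ≡ true → outNeighbour y t (σ u) ≡ true
        out-earlier y t u t<x h with classify-cases u
        ... | inj₂ (eq , _) = trans (sym (cong (outNeighbour y t) eq)) h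
        ... | inj₁ (_ , _ , eq) = contradiction (subst (_≤ t) (stamp≡ {s = σ′ u} (cong class eq)) late) (<⇒≱ t<x)
          where
          late : stamp (σ′ u) ≤ t
          late = ⌊⌋⇒ (_ ≤? t) (proj₂ (∧-elim {hasClass y (σ′ u)} (proj₂ (∧-elim {pending (σ′ u)} h))))

        classify-invariant : ∀ {E} → Invariant E (toℕ x) σ → Invariant E (suc (toℕ x)) σ′
        classify-invariant (val , low , inv) = Valid-transfer base-same final-same val , PendingDegree<-transfer {σ = σ} {σ′} final-same low , inv′
          where
          inv′ : ∀ v → pending (σ′ v) ≡ true → Classified (suc (toℕ x)) σ′ v
          inv′ v pend′ with trans (sym (pending-same v)) pend′ | classify-cases v
          ... | pend | inj₁ (none , calm , eq) = record
            { few-out = few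
            ; crowded = λ none′ → contradiction (trans (sym none′) (cong class eq)) λ () }
            where
            few : ∀ y x′ → class (σ′ v) ≡ just (y , x′) →
                  toℕ x′ < suc (toℕ x) × nbrCount G σ′ v (outNeighbour y (toℕ x′)) ≤ β
            few y x′ cl with trans (sym cl) (cong class eq)
            ... | refl = ≤-refl , ≤-trans (nbrCount-mono σ′ σ (outNeighbour y (toℕ x′)) (collides x y) v λ u _ → out⇒collides y (toℕ x′) u) calm
          ... | pend | inj₂ (eq , busy) = record { few-out = few ; crowded = crowd′ }
            where
            few : ∀ y x′ → class (σ′ v) ≡ just (y , x′) →
                  toℕ x′ < suc (toℕ x) × nbrCount G σ′ v (outNeighbour y (toℕ x′)) ≤ β
            few y x′ cl = let x′<x , out≤ = few-out (inv v pend) y x′ (trans (sym (cong class eq)) cl)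
              in m≤n⇒m≤1+n x′<x , ≤-trans (nbrCount-mono σ′ σ (outNeighbour y (toℕ x′)) (outNeighbour y (toℕ x′)) v λ u _ → out-earlier y (toℕ x′) u x′<x) out≤
            grow : ∀ x′ → nbrCount G σ v (collides x′ (valueAt d q (σ v) x′)) ≤ nbrCount G σ′ v (collides x′ (valueAt d q (σ′ v) x′))
            grow x′ = subst (λ y → nbrCount G σ v (collides x′ (valueAt d q (σ v) x′)) ≤ nbrCount G σ′ v (collides x′ y))
              (sym (value-same v x′)) (nbrCount-mono σ σ′ P P v λ u _ → collides-persists x′ (valueAt d q (σ v) x′) u)
              where
              P : State → Bool
              P = collides x′ (valueAt d q (σ v) x′)
            crowd′ : class (σ′ v) ≡ nothing → ∀ x′ → toℕ x′ < suc (toℕ x) → β < nbrCount G σ′ v (collides x′ (valueAt d q (σ′ v) x′))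
            crowd′ none′ x′ x′≤x with trans (sym (cong class eq)) none′ | toℕ x′ ≟ toℕ x
            ... | none | no x′≢x = <-≤-trans (crowded (inv v pend) none x′ (≤∧≢⇒< (≤-pred x′≤x) x′≢x)) (grow x′)
            ... | none | yes x′≡x with Finₚ.toℕ-injective x′≡x
            ...   | refl = <-≤-trans (busy pend none) (grow x′)

      -- A vertex left over saw at least β + 1 collisions in each of the `q` rounds, all still
      -- visible in the final state. There each of its at most ⌊E/2⌋ pending neighbours accounts for
      -- at most 2S of them, which is too few.
      all-classified : ∀ {E} → ⌊ E /2⌋ * (2 * S) < q * suc β → ∀ {σ} → Invariant E q σ →
                       ∀ v → pending (σ v) ≡ true → class (σ v) ≢ nothing
      all-classified {E} enough {σ} (val , low , inv) v pend none = <⇒≱ enough (begin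
        q * suc β
          ≡⟨ sumFin-const q (suc β) ⟨
        sumFin {q} (λ _ → suc β)
          ≤⟨ sumFin-mono (λ x → crowded (inv v pend) none x (Finₚ.toℕ<n x)) ⟩
        sumFin (λ x → nbrCount G σ v (collides x (valueAt d q (σ v) x)))
          ≤⟨ sumFin-mono {q} {g = λ x → count (λ u → A u ∧ R u x)} (λ x → count-mono λ u → ∧-assocʳ {adj G v u} {pending (σ u)}) ⟩
        sumFin (λ x → count (λ u → A u ∧ R u x))
          ≤⟨ double-count A R (2 * S)
               (λ u h → count-collisions (σ v) (σ u) (base-small val v) (base-small val u) (base-proper val v u (proj₁ (∧-elim h)))) ⟩
        pendingDegree G σ v * (2 * S)
          ≤⟨ *-monoˡ-≤ (2 * S) (half (pendingDegree G σ v) (low v pend)) ⟩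
        ⌊ E /2⌋ * (2 * S) ∎)
        where
        open ≤-Reasoning
        A : Fin n → Bool
        A u = adj G v u ∧ pending (σ u)
        R : Fin n → Fin q → Bool
        R u x = ⌊ valueAt d q (σ u) x Fin.≟ valueAt d q (σ v) x ⌋ ∨ hasClass (valueAt d q (σ v) x) (σ u)
        half : ∀ m → 2 * m < E → m ≤ ⌊ E /2⌋
        half m 2m<E = subst (_≤ ⌊ E /2⌋) (trans (cong ⌊_/2⌋ (cong (m +_) (+-identityʳ m))) (sym (n≡⌊n+n/2⌋ m))) (⌊n/2⌋-mono (<⇒≤ 2m<E))

      declassify-correct : ∀ {E σ σ′} → Round G declassify σ σ′ → Valid σ → PendingDegree< E σ → Invariant E 0 σ′
      declassify-correct {σ = σ} {σ′} round val low =
        Valid-transfer (λ v → cong base (proj₂ (proj₂ (round v)))) (λ v → cong final (proj₂ (proj₂ (round v)))) val ,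
        PendingDegree<-transfer {σ = σ} {σ′} (λ v → cong final (proj₂ (proj₂ (round v)))) low ,
        λ v _ → record
          { few-out = λ y x eq → contradiction (trans (sym eq) (cong class (proj₂ (proj₂ (round v))))) λ ()
          ; crowded = λ _ x () }

    -- Counting free colours

    freeAt : (Fin n → State) → Fin n → Fin (suc Δ) → Bool
    freeAt σ v = free (nbrCount G σ v)

    Active : Fin q → ℕ → (Fin n → State) → Fin n → Set
    Active c D σ v = pending (σ v) ≡ true × hasClass c (σ v) ≡ true × D ≤ 2 * pendingDegree G σ v

    -- Of the Δ + 1 colours each coloured neighbour uses up at most one, and coloured and pending
    -- neighbours together number at most Δ.
    pendingDegree<free : ∀ σ v → pendingDegree G σ v < count (freeAt σ v)
    pendingDegree<free σ v = +-cancelʳ-< (count coloured) (pendingDegree G σ v) (count (freeAt σ v)) (begin-strict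
      pendingDegree G σ v + count coloured                    ≡⟨ sumFin-+ (λ u → ⟦ adj G v u ∧ pending (σ u) ⟧) (λ u → ⟦ coloured u ⟧) ⟨
      sumFin (λ u → ⟦ adj G v u ∧ pending (σ u) ⟧ + ⟦ coloured u ⟧)
                                                              ≡⟨ sumFin-cong (λ u → split (adj G v u) (pending (σ u))) ⟩
      degree G v                                              ≤⟨ deg≤Δ v ⟩
      Δ                                                       <⟨ ≤-refl ⟩
      suc Δ                                                   ≡⟨ count-not (freeAt σ v) ⟨
      count (freeAt σ v) + count (not ∘ freeAt σ v)           ≤⟨ +-monoʳ-≤ (count (freeAt σ v)) taken ⟩
      count (freeAt σ v) + count coloured                     ∎)
      where
      open ≤-Reasoning
      coloured : Fin n → Bool
      coloured u = adj G v u ∧ not (pending (σ u))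
      split : ∀ a b → ⟦ a ∧ b ⟧ + ⟦ a ∧ not b ⟧ ≡ ⟦ a ⟧
      split true  true  = refl
      split true  false = refl
      split false true  = refl
      split false false = refl
      used : ∀ f → ⟦ not (freeAt σ v f) ⟧ ≤ nbrCount G σ v (finalIs f)
      used f with nbrCount G σ v (finalIs f)
      ... | zero  = z≤n
      ... | suc _ = s≤s z≤n
      final⇒coloured : ∀ f u → adj G v u ∧ finalIs f (σ u) ≡ true → coloured u ∧ finalIs f (σ u) ≡ true
      final⇒coloured f u h with final (σ u) | ∧-elim {adj G v u} h
      ... | just _ | vu , is = ∧-intro (∧-intro vu refl) is
      taken : count (not ∘ freeAt σ v) ≤ count coloured
      taken = begin
        count (not ∘ freeAt σ v)                                          ≤⟨ sumFin-mono used ⟩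
        sumFin (λ f → nbrCount G σ v (finalIs f))
          ≤⟨ sumFin-mono {g = λ f → count (λ u → coloured u ∧ finalIs f (σ u))} (λ f → count-mono (final⇒coloured f)) ⟩
        sumFin (λ f → count (λ u → coloured u ∧ finalIs f (σ u)))
          ≤⟨ double-count coloured (λ u f → finalIs f (σ u)) 1 (λ u _ → one (final (σ u))) ⟩
        count coloured * 1                                                ≡⟨ *-identityʳ _ ⟩
        count coloured                                                    ∎
        where
        one : ∀ m → count (λ f → maybe′ (λ f′ → ⌊ f′ Fin.≟ f ⌋) false m) ≤ 1
        one m = count-at-most-one _ (same m)
          where
          same : ∀ m i j → maybe′ (λ f′ → ⌊ f′ Fin.≟ i ⌋) false m ≡ true → maybe′ (λ f′ → ⌊ f′ Fin.≟ j ⌋) false m ≡ true → i ≡ j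
          same (just f) i j hᵢ hⱼ = trans (sym (⌊⌋⇒ (f Fin.≟ i) hᵢ)) (⌊⌋⇒ (f Fin.≟ j) hⱼ)

    good-part-exists : ∀ {β D} → 2 * (p * (S * β)) ≤ D → ∀ σ v → D ≤ 2 * pendingDegree G σ v →
      ∃[ j ] S * β < count (λ f → freeAt σ v f ∧ onCurve (base (σ v)) j f)
    good-part-exists {β} {D} wide σ v D≤ = sumFin-pigeonhole (λ _ → S * β) _ (begin-strict
      sumFin {p} (λ _ → S * β)       ≡⟨ sumFin-const p (S * β) ⟩
      p * (S * β)                    <⟨ *-cancelˡ-< 2 (p * (S * β)) (count (freeAt σ v)) (begin-strict
            2 * (p * (S * β))          ≤⟨ wide ⟩
            D                          ≤⟨ D≤ ⟩
            2 * pendingDegree G σ v    <⟨ *-monoʳ-< 2 (pendingDegree<free σ v) ⟩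
            2 * count (freeAt σ v)     ∎) ⟩
      count (freeAt σ v)             ≤⟨ sumFin-mono (λ f → some-part f (freeAt σ v f)) ⟩
      sumFin (λ f → count (λ j → freeAt σ v f ∧ onCurve (base (σ v)) j f))
                                     ≡⟨ sumFin-swap (λ f j → ⟦ freeAt σ v f ∧ onCurve (base (σ v)) j f ⟧) ⟩
      sumFin (λ j → count (λ f → freeAt σ v f ∧ onCurve (base (σ v)) j f)) ∎)
      where
      open ≤-Reasoning
      some-part : ∀ f b → ⟦ b ⟧ ≤ count (λ j → b ∧ onCurve (base (σ v)) j f)
      some-part f false = z≤n
      some-part f true = let j , on = translate-exists (base (σ v)) f in
        subst (_≤ count (λ j → onCurve (base (σ v)) j f)) (cong ⟦_⟧ on) (≤-sumFin (λ j → ⟦ onCurve (base (σ v)) j f ⟧) j)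

    -- The chosen translate of each of the at most β out-neighbours meets that of v in at most `S`
    -- colours, so fewer free colours are blocked than the translate contains.
    good-final-exists : ∀ {β c} {σ} → Valid σ → ∀ v → nbrCount G σ v (outNeighbour c (stamp (σ v))) ≤ β →
      S * β < count (λ f → freeAt σ v f ∧ onCurve (base (σ v)) (part (σ v)) f) →
      ∃[ f ] (freeAt σ v f ∧ onCurve (base (σ v)) (part (σ v)) f ≡ true × nbrCount G σ v (blocks c (stamp (σ v)) f) ≡ 0)
    good-final-exists {β} {c} {σ} val v few many =
      let f , lt = sumFin-pigeonhole (λ f → count (λ u → A u ∧ R u f)) (λ f → ⟦ L f ⟧) (begin-strict
            sumFin (λ f → count (λ u → A u ∧ R u f))    ≤⟨ double-count A R S (λ u h → count-curves-intersect _ _ _ _ (base-small val v) (base-small val u) (base-proper val v u (proj₁ (∧-elim h)))) ⟩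
            count A * S                                 ≤⟨ *-monoˡ-≤ S few ⟩
            β * S                                       ≡⟨ *-comm β S ⟩
            S * β                                       <⟨ many ⟩
            count L                                     ∎)
      in f , good f (L f) refl lt
      where
      open ≤-Reasoning
      A : Fin n → Bool
      A u = adj G v u ∧ outNeighbour c (stamp (σ v)) (σ u)
      R : Fin n → Fin (suc Δ) → Bool
      R u f = onCurve (base (σ v)) (part (σ v)) f ∧ onCurve (base (σ u)) (part (σ u)) f
      L : Fin (suc Δ) → Bool
      L f = freeAt σ v f ∧ onCurve (base (σ v)) (part (σ v)) f
      blocker : ∀ f → onCurve (base (σ v)) (part (σ v)) f ≡ true → ∀ u →
                adj G v u ∧ blocks c (stamp (σ v)) f (σ u) ≡ true → A u ∧ R u f ≡ true
      blocker f on u h = let vu , h′ = ∧-elim {adj G v u} h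
                             out , onᵤ = ∧-elim {outNeighbour c (stamp (σ v)) (σ u)} h′
                         in ∧-intro (∧-intro vu out) (∧-intro on onᵤ)
      -- A count below `⟦ b ⟧` forces b to be true and the count to be 0.
      good : ∀ f b → L f ≡ b → count (λ u → A u ∧ R u f) < ⟦ b ⟧ → L f ≡ true × nbrCount G σ v (blocks c (stamp (σ v)) f) ≡ 0
      good f true Lf lt = Lf , n≤0⇒n≡0 (≤-trans (count-mono (blocker f (proj₂ (∧-elim Lf)))) (≤-pred lt))

    -- Serving the classes one after the other

    module ClassPhase (β D : ℕ) (wide : 2 * (p * (S * β)) ≤ D) where

      -- `dropped` holds because a vertex that stays pending when its class is served must have
      -- failed the degree test, and pending degrees only decrease afterwards.
      record Processed (k : ℕ) (σ : Fin n → State) (v : Fin n) : Set where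
        field
          cls      : Fin q
          time     : Fin q
          class≡   : class (σ v) ≡ just (cls , time)
          out≤β    : nbrCount G σ v (outNeighbour cls (toℕ time)) ≤ β
          dropped  : toℕ cls < k → 2 * pendingDegree G σ v < D

      open Processed

      ClassInvariant : ℕ → (Fin n → State) → Set
      ClassInvariant k σ = Valid σ × (∀ v → pending (σ v) ≡ true → Processed k σ v)

      module _ (c : Fin q) where

        active⇒Active : ∀ {σ v Q} → (∀ P → Q P ≡ nbrCount G σ v P) → active c D (σ v) Q ≡ true → Active c D σ v
        active⇒Active {σ} {v} {Q} Q≡ act =
          let pend , act′ = ∧-elim {pending (σ v)} act
              has , D≤ = ∧-elim {hasClass c (σ v)} act′
          in pend , has , subst (λ z → D ≤ 2 * z) (Q≡ pending) (⌊⌋⇒ (D ≤? 2 * Q pending) D≤)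

        Active⇒active : ∀ {σ v Q} → (∀ P → Q P ≡ nbrCount G σ v P) → Active c D σ v → active c D (σ v) Q ≡ true
        Active⇒active {Q = Q} Q≡ (pend , has , D≤) =
          ∧-intro pend (∧-intro has (⇒⌊⌋ (D ≤? 2 * Q pending) (subst (λ z → D ≤ 2 * z) (sym (Q≡ pending)) D≤)))

        free≡ : ∀ {σ v Q} → (∀ P → Q P ≡ nbrCount G σ v P) → ∀ f → free Q f ≡ freeAt σ v f
        free≡ Q≡ f = cong (λ z → ⌊ z ≟ 0 ⌋) (Q≡ (finalIs f))

        goodPart : (Fin n → State) → Fin n → Fin p → Set
        goodPart σ v j = S * β < count (λ f → freeAt σ v f ∧ onCurve (base (σ v)) j f)

        choosePart-cases : ∀ {σ σ′} → Round G (choosePart β D c) σ σ′ → ∀ v →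
          ∃[ j ] (σ′ v ≡ record (σ v) { part = j } × (Active c D σ v → goodPart σ v j))
        choosePart-cases {σ} {σ′} round v with round v
        ... | Q , Q≡ , eq with true-or-false (active c D (σ v) Q)
        ...   | inj₂ f rewrite f = part (σ v) , eq , λ act → ⊥-elim (true≢false (Active⇒active {σ} Q≡ act) f)
        ...   | inj₁ t rewrite t = pick (part (σ v)) P , eq , λ act →
          let _ , _ , D≤ = act
              j , many = good-part-exists wide σ v D≤
          in subst (S * β <_) (count≡ _) (⌊⌋⇒ (_ <? _) (pick-correct (part (σ v)) P j (⇒⌊⌋ (_ <? _) (subst (S * β <_) (sym (count≡ j)) many))))
          where
          P : Fin p → Bool
          P j = ⌊ S * β <? count (λ f → free Q f ∧ onCurve (base (σ v)) j f) ⌋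
          count≡ : ∀ j → count (λ f → free Q f ∧ onCurve (base (σ v)) j f) ≡ count (λ f → freeAt σ v f ∧ onCurve (base (σ v)) j f)
          count≡ j = count-cong λ f → cong (_∧ onCurve (base (σ v)) j f) (free≡ {σ} Q≡ f)

        GoodFinal : (Fin n → State) → Fin n → Fin (suc Δ) → Set
        GoodFinal σ v f = freeAt σ v f ≡ true × onCurve (base (σ v)) (part (σ v)) f ≡ true × nbrCount G σ v (blocks c (stamp (σ v)) f) ≡ 0

        chooseFinal-cases : ∀ {σ σ′} → Round G (chooseFinal D c) σ σ′ → Valid σ → ∀ v →
          (Active c D σ v → nbrCount G σ v (outNeighbour c (stamp (σ v))) ≤ β × goodPart σ v (part (σ v))) →
          (Active c D σ v × ∃[ f ] (σ′ v ≡ record (σ v) { final = just f } × GoodFinal σ v f))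
          ⊎ (¬ Active c D σ v × σ′ v ≡ σ v)
        chooseFinal-cases {σ} {σ′} round val v ready with round v
        ... | Q , Q≡ , eq with true-or-false (active c D (σ v) Q)
        ...   | inj₂ f rewrite f = inj₂ ((λ act → true≢false (Active⇒active {σ} Q≡ act) f) , eq)
        ...   | inj₁ t rewrite t = inj₁ (act , pick zero P , eq ,
                  trans (sym (free≡ {σ} Q≡ _)) (proj₁ fine) , proj₂ fine , trans (sym (Q≡ _)) (⌊⌋⇒ (_ ≟ 0) (proj₂ picked)))
          where
          act : Active c D σ v
          act = active⇒Active {σ} Q≡ t
          P : Fin (suc Δ) → Bool
          P f = (free Q f ∧ onCurve (base (σ v)) (part (σ v)) f) ∧ ⌊ Q (blocks c (stamp (σ v)) f) ≟ 0 ⌋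
          exists : ∃[ f ] P f ≡ true
          exists = let f , good , unblocked = good-final-exists val v (proj₁ (ready act)) (proj₂ (ready act))
                       fr , on = ∧-elim {freeAt σ v f} good
                   in f , ∧-intro (∧-intro (trans (free≡ {σ} Q≡ f) fr) on) (⇒⌊⌋ (_ ≟ 0) (trans (Q≡ _) unblocked))
          picked : (free Q (pick zero P) ∧ onCurve (base (σ v)) (part (σ v)) (pick zero P)) ≡ true × ⌊ Q (blocks c (stamp (σ v)) (pick zero P)) ≟ 0 ⌋ ≡ true
          picked = ∧-elim (pick-correct zero P (proj₁ exists) (proj₂ exists))
          fine : free Q (pick zero P) ≡ true × onCurve (base (σ v)) (part (σ v)) (pick zero P) ≡ true
          fine = ∧-elim (proj₁ picked)

        module _ {σ σ₁ σ₂} (r₁ : Round G (choosePart β D c) σ σ₁) (r₂ : Round G (chooseFinal D c) σ₁ σ₂)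
                 (inv : ClassInvariant (toℕ c) σ) where

          new-part : ∀ v → ∃[ j ] (σ₁ v ≡ record (σ v) { part = j } × (Active c D σ v → goodPart σ v j))
          new-part = choosePart-cases r₁

          base₁ : ∀ v → base (σ₁ v) ≡ base (σ v)
          base₁ v = cong base (proj₁ (proj₂ (new-part v)))

          final₁ : ∀ v → final (σ₁ v) ≡ final (σ v)
          final₁ v = cong final (proj₁ (proj₂ (new-part v)))

          class₁ : ∀ v → class (σ₁ v) ≡ class (σ v)
          class₁ v = cong class (proj₁ (proj₂ (new-part v)))

          valid₁ : Valid σ₁
          valid₁ = Valid-transfer base₁ final₁ (proj₁ inv)

          outNeighbour₁ : ∀ y t u → outNeighbour y t (σ₁ u) ≡ outNeighbour y t (σ u)
          outNeighbour₁ y t u = cong₂ (λ f k → unset f ∧ (maybe′ (λ (y′ , _) → ⌊ y′ Fin.≟ y ⌋) false k ∧ ⌊ maybe′ (λ (_ , x) → toℕ x) 0 k ≤? t ⌋)) (final₁ u) (class₁ u)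

          Active₁⇒Active : ∀ v → Active c D σ₁ v → Active c D σ v
          Active₁⇒Active v (pend , has , D≤) =
            trans (sym (cong unset (final₁ v))) pend ,
            trans (sym (cong (maybe′ (λ (y′ , _) → ⌊ y′ Fin.≟ c ⌋) false) (class₁ v))) has ,
            subst (λ z → D ≤ 2 * z) (pendingDegree-cong {σ} {σ₁} final₁ v) D≤

          ready : ∀ v → Active c D σ₁ v → nbrCount G σ₁ v (outNeighbour c (stamp (σ₁ v))) ≤ β × goodPart σ₁ v (part (σ₁ v))
          ready v act₁ = out≤ , part-good
            where
            act : Active c D σ v
            act = Active₁⇒Active v act₁
            pr : Processed (toℕ c) σ v
            pr = proj₂ inv v (proj₁ act)
            cls≡c : cls pr ≡ c
            cls≡c = hasClass⇒≡ {s = σ v} (class≡ pr) (proj₁ (proj₂ act))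
            out≤ : nbrCount G σ₁ v (outNeighbour c (stamp (σ₁ v))) ≤ β
            out≤ = subst₂ (λ y t → nbrCount G σ₁ v (outNeighbour y t) ≤ β) cls≡c
              (sym (stamp≡ {s = σ₁ v} (trans (class₁ v) (class≡ pr))))
              (≤-trans (nbrCount-mono σ₁ σ (outNeighbour _ _) (outNeighbour _ _) v
                         (λ u _ → trans (sym (outNeighbour₁ (cls pr) (toℕ (time pr)) u)))) (out≤β pr))
            part-good : goodPart σ₁ v (part (σ₁ v))
            part-good = subst (S * β <_) (count-cong λ f → cong₂ _∧_
                (cong (λ z → ⌊ z ≟ 0 ⌋) (count-cong λ u → cong (λ z → adj G v u ∧ maybe′ (λ f′ → ⌊ f′ Fin.≟ f ⌋) false z) (sym (final₁ u))))
                (cong₂ (λ b j → onCurve b j f) (sym (base₁ v)) (sym (cong part (proj₁ (proj₂ (new-part v)))))))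
              (proj₂ (proj₂ (new-part v)) act)

          cases : ∀ v → (Active c D σ₁ v × ∃[ f ] (σ₂ v ≡ record (σ₁ v) { final = just f } × GoodFinal σ₁ v f))
                        ⊎ (¬ Active c D σ₁ v × σ₂ v ≡ σ₁ v)
          cases v = chooseFinal-cases r₂ valid₁ v (ready v)

          base₂ : ∀ v → base (σ₂ v) ≡ base (σ₁ v)
          base₂ v with cases v
          ... | inj₁ (_ , _ , eq , _) = cong base eq
          ... | inj₂ (_ , eq)         = cong base eq

          class₂ : ∀ v → class (σ₂ v) ≡ class (σ₁ v)
          class₂ v with cases v
          ... | inj₁ (_ , _ , eq , _) = cong class eq
          ... | inj₂ (_ , eq)         = cong class eq

          still-pending : ∀ v → pending (σ₂ v) ≡ true → ¬ Active c D σ₁ v × pending (σ₁ v) ≡ true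
          still-pending v pend with cases v
          ... | inj₁ (_ , _ , eq , _) = ⊥-elim (true≢false pend (cong pending eq))
          ... | inj₂ (inactive , eq)  = inactive , trans (sym (cong pending eq)) pend

          taken⇒≢ : ∀ u v f g → adj G v u ≡ true → final (σ₁ u) ≡ just g → GoodFinal σ₁ v f → f ≢ g
          taken⇒≢ u v f g vu fin (fr , _) refl =
            true≢false (∧-intro vu (trans (cong (maybe′ (λ f′ → ⌊ f′ Fin.≟ f ⌋) false) fin) (⇒⌊⌋ (f Fin.≟ f) refl)))
                       (count≡0 _ (⌊⌋⇒ (_ ≟ 0) fr) u)

          -- The colour g of u lies on the translate of u, and v has avoided this translate as a
          -- whole. For equal stamps the two vertices avoid each other.
          later⇒≢ : ∀ u v f g → adj G v u ≡ true → stamp (σ₁ u) ≤ stamp (σ₁ v) → Active c D σ₁ u →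
                    GoodFinal σ₁ u g → GoodFinal σ₁ v f → f ≢ g
          later⇒≢ u v f g vu u≤v (pend , has , _) (_ , on , _) (_ , _ , unblocked) refl =
            true≢false (∧-intro vu (∧-intro (∧-intro pend (∧-intro has (⇒⌊⌋ (_ ≤? _) u≤v))) on)) (count≡0 _ unblocked u)

          final-proper₂ : ∀ u v f → adj G u v ≡ true → final (σ₂ u) ≡ just f → final (σ₂ v) ≡ just f → ⊥
          final-proper₂ u v f uv fu fv with cases u | cases v
          ... | inj₂ (_ , eu) | inj₂ (_ , ev) = final-proper valid₁ u v f uv (trans (sym (cong final eu)) fu) (trans (sym (cong final ev)) fv)
          ... | inj₁ (_ , g , eu , gf) | inj₂ (_ , ev) =
            taken⇒≢ v u g f uv (trans (sym (cong final ev)) fv) gf (just-injective (trans (sym (cong final eu)) fu))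
          ... | inj₂ (_ , eu) | inj₁ (_ , g , ev , gf) =
            taken⇒≢ u v g f (trans (adj-sym G v u) uv) (trans (sym (cong final eu)) fu) gf (just-injective (trans (sym (cong final ev)) fv))
          -- Both ends are coloured in this round. The one with the larger stamp has avoided the
          -- translate that the other fixed in the round before.
          ... | inj₁ (au , g , eu , gu) | inj₁ (av , h , ev , gv) with ≤-total (stamp (σ₁ u)) (stamp (σ₁ v))
          ...   | inj₁ u≤v = later⇒≢ u v h g (trans (adj-sym G v u) uv) u≤v au gu gv
                               (trans (just-injective (trans (sym (cong final ev)) fv)) (sym (just-injective (trans (sym (cong final eu)) fu))))
          ...   | inj₂ v≤u = later⇒≢ v u g h uv v≤u av gv gu
                               (trans (just-injective (trans (sym (cong final eu)) fu)) (sym (just-injective (trans (sym (cong final ev)) fv))))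

          pendingDegree-≤ : ∀ v → pendingDegree G σ₂ v ≤ pendingDegree G σ v
          pendingDegree-≤ v = nbrCount-mono σ₂ σ pending pending v
            (λ u _ pend → trans (sym (cong unset (final₁ u))) (proj₂ (still-pending u pend)))

          outNeighbour-≤ : ∀ y t u → outNeighbour y t (σ₂ u) ≡ true → outNeighbour y t (σ u) ≡ true
          outNeighbour-≤ y t u h =
            let pend , h′ = ∧-elim {pending (σ₂ u)} h
                has , le = ∧-elim {hasClass y (σ₂ u)} h′
            in trans (sym (outNeighbour₁ y t u)) (∧-intro (proj₂ (still-pending u pend)) (∧-intro
                 (trans (cong (maybe′ (λ (y′ , _) → ⌊ y′ Fin.≟ y ⌋) false) (sym (class₂ u))) has)
                 (trans (cong (λ k → ⌊ maybe′ (λ (_ , x) → toℕ x) 0 k ≤? t ⌋) (sym (class₂ u))) le)))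

          valid₂ : Valid σ₂
          valid₂ = record
            { base-proper  = λ u v uv eq → base-proper valid₁ u v uv (trans (sym (base₂ u)) (trans eq (base₂ v)))
            ; base-small   = λ v → subst (λ b → toℕ b < 2 ^ d) (sym (base₂ v)) (base-small valid₁ v)
            ; final-proper = final-proper₂ }

          processed₂ : ∀ v → Processed (toℕ c) σ v → ¬ Active c D σ₁ v → pending (σ₁ v) ≡ true → Processed (suc (toℕ c)) σ₂ v
          processed₂ v record { cls = y ; time = x ; class≡ = cl ; out≤β = out ; dropped = drp } inactive pend₁ = record
            { cls     = y
            ; time    = x
            ; class≡  = trans (class₂ v) (trans (class₁ v) cl)
            ; out≤β   = ≤-trans (nbrCount-mono σ₂ σ (outNeighbour y (toℕ x)) (outNeighbour y (toℕ x)) v (λ u _ → outNeighbour-≤ y (toℕ x) u)) out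
            ; dropped = drop (toℕ y ≟ toℕ c)
            }
            where
            unserved : y ≡ c → 2 * pendingDegree G σ₁ v < D
            unserved refl = ≰⇒> λ D≤ → inactive (pend₁ , ≡⇒hasClass {s = σ₁ v} (trans (class₁ v) cl) , D≤)
            drop : Dec (toℕ y ≡ toℕ c) → toℕ y < suc (toℕ c) → 2 * pendingDegree G σ₂ v < D
            drop (no y≢c) y≤c = ≤-<-trans (*-monoʳ-≤ 2 (pendingDegree-≤ v)) (drp (≤∧≢⇒< (≤-pred y≤c) y≢c))
            drop (yes y≡c) _ = ≤-<-trans (*-monoʳ-≤ 2 (≤-trans (pendingDegree-≤ v) (≤-reflexive (sym (pendingDegree-cong {σ} {σ₁} final₁ v)))))
              (unserved (Finₚ.toℕ-injective y≡c))

          block-invariant : ClassInvariant (suc (toℕ c)) σ₂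
          block-invariant = valid₂ , λ v pend₂ →
            let inactive , pend₁ = still-pending v pend₂
            in processed₂ v (proj₂ inv v (trans (sym (cong unset (final₁ v))) pend₁)) inactive pend₁

    -- Composition of the rounds

    stage-correct : 2 * (p * S) * (2 * S) ≤ q → ∀ E {σ σ′} → let D = ⌊ E /2⌋ in
      Runs G (stage (outBound D) D) σ σ′ → Valid σ → PendingDegree< E σ → Valid σ′ × PendingDegree< D σ′
    stage-correct q-big E {σ} {σ′} (step declassified r) val low =
      let σ₁ , classifying , choosing = Runs-++ (forEach q (λ x → classify β x ∷ [])) r
          classified = classify-all σ₁ (Classification.declassify-correct β declassified val low) classifying
          val′ , processed = choose-all (proj₁ classified , start-processing classified) choosing
      in val′ , λ v pend → let pr = processed v pend in ClassPhase.Processed.dropped pr (Finₚ.toℕ<n (ClassPhase.Processed.cls pr))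
      where
      D = ⌊ E /2⌋
      β = outBound D
      wide = outBound-wide D
      classify-all : ∀ σ₁ {σ₀} → Classification.Invariant β E 0 σ₀ →
        Runs G (forEach q (λ x → classify β x ∷ [])) σ₀ σ₁ → Classification.Invariant β E q σ₁
      classify-all σ₁ = forEach-invariant q (Classification.Invariant β E)
        (λ { x _ _ inv (step round done) → Classification.classify-invariant β x round inv })
      start-processing : ∀ {σ₁} → Classification.Invariant β E q σ₁ →
        ∀ v → pending (σ₁ v) ≡ true → ClassPhase.Processed β D wide 0 σ₁ v
      start-processing {σ₁} inv@(_ , _ , classified) v pend = go (class (σ₁ v)) refl
        where
        go : ∀ k → class (σ₁ v) ≡ k → ClassPhase.Processed β D wide 0 σ₁ v
        go nothing eq = contradiction eq (Classification.all-classified β (outBound-enough q-big D) inv v pend)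
        go (just (y , x)) eq = record
          { cls = y ; time = x ; class≡ = eq ; dropped = λ ()
          ; out≤β = proj₂ (Classification.Classified.few-out (classified v pend) y x eq) }
      choose-all : ∀ {σ₁ σ₂} → ClassPhase.ClassInvariant β D wide 0 σ₁ →
        Runs G (forEach q (λ c → choosePart β D c ∷ chooseFinal D c ∷ [])) σ₁ σ₂ → ClassPhase.ClassInvariant β D wide q σ₂
      choose-all = forEach-invariant q (ClassPhase.ClassInvariant β D wide)
        (λ { c _ _ inv (step r₁ (step r₂ done)) → ClassPhase.block-invariant β D wide c r₁ r₂ inv })

    stages-correct : 2 * (p * S) * (2 * S) ≤ q → ∀ k E {σ σ′} → Runs G (stages k E) σ σ′ →
      Valid σ → PendingDegree< E σ → Valid σ′ × PendingDegree< (halve k E) σ′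
    stages-correct q-big k E r val low = forEach-invariant k (λ i σ → Valid σ × PendingDegree< (halve i E) σ)
      (λ i _ _ (val , low) r → stage-correct q-big (halve (toℕ i) E) r val low) (val , low) r

    linialRounds-correct : ∀ (sch : LinialSchedule) k {σ σ′} → Runs G (linialRounds sch k) σ σ′ →
      ProperBase G σ → (∀ v → toℕ (base (σ v)) < 2 ^ bits sch 0) →
      ProperBase G σ′ × (∀ v → toℕ (base (σ′ v)) < 2 ^ bits sch k) × (∀ v → final (σ′ v) ≡ final (σ v))
    linialRounds-correct sch k {σ} r proper small = forEach-invariant k
      (λ i τ → ProperBase G τ × (∀ v → toℕ (base (τ v)) < 2 ^ bits sch i) × (∀ v → final (τ v) ≡ final (σ v)))
      (λ { i _ _ (proper , small , same) (step round done) →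
           let proper′ , small′ , same′ = linial-correct G deg≤Δ (bits sch (toℕ i)) {{prime⇒nonZero (prime-mod sch (toℕ i))}} (prime-mod sch (toℕ i)) (fits sch (toℕ i)) (large sch (toℕ i)) round proper small
           in proper′ , (λ v → <-≤-trans (small′ v) (next-bits sch (toℕ i))) , λ v → trans (same′ v) (same v) })
      (proper , small , λ _ → refl) r

    initially-valid : ∀ {σ} → ProperBase G σ → (∀ v → toℕ (base (σ v)) < 2 ^ d) → (∀ v → final (σ v) ≡ nothing) → Valid σ
    initially-valid proper small none = record
      { base-proper  = proper
      ; base-small   = small
      ; final-proper = λ u v c _ fu _ → contradiction (trans (sym fu) (none u)) λ () }

    pendingDegree≤Δ : ∀ σ v → pendingDegree G σ v ≤ Δ
    pendingDegree≤Δ σ v = ≤-trans (count-mono (λ u → proj₁ ∘ ∧-elim {adj G v u})) (deg≤Δ v)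

    none-pending : ∀ {σ} → PendingDegree< 0 σ → ∀ v → ∃[ c ] final (σ v) ≡ just c
    none-pending {σ} low v with final (σ v) in eq
    ... | just c  = c , refl
    ... | nothing = contradiction (low v (cong unset eq)) λ ()

    output-proper : ∀ {σ} → Valid σ → (∀ v → ∃[ c ] final (σ v) ≡ just c) → Proper G (fromMaybe zero ∘ final ∘ σ)
    output-proper {σ} val coloured u v uv eq with coloured u | coloured v
    ... | c , fu | c′ , fv = final-proper val u v c uv fu (trans fv (cong just (begin
      c′                              ≡⟨ cong (fromMaybe zero) fv ⟨
      fromMaybe zero (final (σ v))    ≡⟨ eq ⟨
      fromMaybe zero (final (σ u))    ≡⟨ cong (fromMaybe zero) fu ⟩
      c                               ∎)))
      where open ≡-Reasoning

    colouring-correct : 2 * (p * S) * (2 * S) ≤ q → ∀ (sch : LinialSchedule) l k {σ σ′} →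
      bits sch l ≡ d → halve k (suc (2 * Δ)) ≡ 0 → Runs G (linialRounds sch l ++ stages k (suc (2 * Δ))) σ σ′ →
      ProperBase G σ → (∀ v → toℕ (base (σ v)) < 2 ^ bits sch 0) → (∀ v → final (σ v) ≡ nothing) →
      Proper G (fromMaybe zero ∘ final ∘ σ′)
    colouring-correct q-big sch l k {σ} {σ′} bits≡d exhausted r proper small none =
      let σ₁ , r₁ , r₂ = Runs-++ (linialRounds sch l) r
          proper₁ , small₁ , same₁ = linialRounds-correct sch l r₁ proper small
          val′ , low′ = stages-correct q-big k (suc (2 * Δ)) r₂
            (initially-valid proper₁ (λ v → subst (λ e → toℕ (base (σ₁ v)) < 2 ^ e) bits≡d (small₁ v)) (λ v → trans (same₁ v) (none v)))
            (λ v _ → s≤s (*-monoʳ-≤ 2 (pendingDegree≤Δ σ₁ v)))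
      in output-proper val′ (none-pending {σ′} (subst (λ E → PendingDegree< E σ′) exhausted low′))

-- Parameters and bounds

^≤-intro : ∀ {m n} k l → m ≤ 2 ^ k → n ≤ 2 ^ l → m * n ≤ 2 ^ (k + l)
^≤-intro k l m≤ n≤ = ≤-trans (*-mono-≤ m≤ n≤) (≤-reflexive (sym (^-distribˡ-+-* 2 k l)))

^-2-mono : ∀ {m k l} → k ≤ l → m ≤ 2 ^ k → m ≤ 2 ^ l
^-2-mono k≤l m≤ = ≤-trans m≤ (^-monoʳ-≤ 2 k≤l)

1+n≤2^[1+k] : ∀ {n} k → n ≤ 2 ^ k → suc n ≤ 2 ^ suc k
1+n≤2^[1+k] k n≤ = ≤-trans (+-mono-≤ (m^n>0 2 k) n≤) (≤-reflexive (cong ((2 ^ k) +_) (sym (+-identityʳ (2 ^ k)))))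

⌈log₂⌉-near-prime : ∀ N {m} → m ≤ 4 * N * (2 + ⌈log₂ N ⌉) → ⌈log₂ m ⌉ ≤ 2 * ⌈log₂ N ⌉ + 3
⌈log₂⌉-near-prime N {m} m≤ = begin
  ⌈log₂ m ⌉                                      ≤⟨ ⌈log₂⌉-mono-≤ m≤ ⟩
  ⌈log₂ (4 * N * (2 + y)) ⌉                      ≤⟨ ⌈log₂m*n⌉≤ (4 * N) (2 + y) ⟩
  ⌈log₂ (4 * N) ⌉ + ⌈log₂ (2 + y) ⌉              ≤⟨ +-mono-≤ (⌈log₂m*n⌉≤ 4 N) (⌈log₂[1+n]⌉≤n (suc y)) ⟩
  (⌈log₂ 4 ⌉ + y) + suc y                        ≡⟨ cong (λ z → (z + y) + suc y) (⌈log₂2^n⌉≡n 2) ⟩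
  (2 + y) + suc y                                ≡⟨ lem y ⟩
  2 * y + 3                                      ∎
  where
  open ≤-Reasoning
  y = ⌈log₂ N ⌉
  lem : ∀ y → (2 + y) + suc y ≡ 2 * y + 3
  lem = solve-∀

8l+39≤2^[l+6] : ∀ l → 8 * l + 39 ≤ 2 ^ (l + 6)
8l+39≤2^[l+6] l = begin
  8 * l + 39                ≤⟨ +-mono-≤ (*-monoʳ-≤ 8 (<⇒≤ (n<2^n l))) (m≤m*n 39 (2 ^ l) {{m^n≢0 2 l}}) ⟩
  8 * 2 ^ l + 39 * 2 ^ l    ≡⟨ *-distribʳ-+ (2 ^ l) 8 39 ⟨
  47 * 2 ^ l                ≤⟨ *-monoˡ-≤ (2 ^ l) (m≤m+n 47 17) ⟩
  64 * 2 ^ l                ≡⟨ *-comm 64 (2 ^ l) ⟩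
  2 ^ l * 2 ^ 6             ≡⟨ ^-distribˡ-+-* 2 l 6 ⟨
  2 ^ (l + 6)               ∎
  where open ≤-Reasoning

-- For L ≥ 1 the sum is at most the product L(8l + 39), whose logarithm splits into ⌈log₂ L⌉ with
-- coefficient one and a term in `l` alone.
⌈log₂[4L+B+1]⌉≤ : ∀ L l → ⌈log₂ suc (4 * L + (8 * l + 34)) ⌉ ≤ ⌈log₂ L ⌉ + (l + 6)
⌈log₂[4L+B+1]⌉≤ zero l = n≤2^k⇒⌈log₂n⌉≤k (l + 6) (≤-trans (≤-trans (≤-reflexive (sym (+-suc (8 * l) 34))) (+-monoʳ-≤ (8 * l) (m≤m+n 35 4))) (8l+39≤2^[l+6] l))
⌈log₂[4L+B+1]⌉≤ L@(suc L-1) l = begin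
  ⌈log₂ suc (4 * L + (8 * l + 34)) ⌉        ≤⟨ ⌈log₂⌉-mono-≤ (begin
      suc (4 * L + (8 * l + 34))              ≡⟨ lem₁ L l ⟩
      4 * L + (8 * l + 35)                    ≤⟨ +-monoʳ-≤ (4 * L) (m≤n*m (8 * l + 35) L) ⟩
      4 * L + L * (8 * l + 35)                ≡⟨ lem₂ L l ⟩
      L * (8 * l + 39)                        ∎) ⟩
  ⌈log₂ (L * (8 * l + 39)) ⌉                ≤⟨ ⌈log₂m*n⌉≤ L (8 * l + 39) ⟩
  ⌈log₂ L ⌉ + ⌈log₂ (8 * l + 39) ⌉          ≤⟨ +-monoʳ-≤ ⌈log₂ L ⌉ (n≤2^k⇒⌈log₂n⌉≤k (l + 6) (8l+39≤2^[l+6] l)) ⟩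
  ⌈log₂ L ⌉ + (l + 6)                       ∎
  where
  open ≤-Reasoning
  lem₁ : ∀ L l → suc (4 * L + (8 * l + 34)) ≡ 4 * L + (8 * l + 35)
  lem₁ = solve-∀
  lem₂ : ∀ L l → 4 * L + L * (8 * l + 35) ≡ L * (8 * l + 39)
  lem₂ = solve-∀

-- The additive constant 8l + 34 reproduces itself, so that one round of Linial's algorithm costs exactly one logarithm.
next-bits-bound : ∀ Δ l L {m} → Δ ≤ 2 ^ l → let N = suc (Δ * suc (4 * L + (8 * l + 34))) in
  m ≤ 4 * N * (2 + ⌈log₂ N ⌉) → m * m ≤ 2 ^ (4 * ⌈log₂ L ⌉ + (8 * l + 34))
next-bits-bound Δ l L {m} Δ≤ m≤ = begin
  m * m                                     ≤⟨ ^≤-intro ⌈log₂ m ⌉ ⌈log₂ m ⌉ (n≤2^⌈log₂n⌉ m) (n≤2^⌈log₂n⌉ m) ⟩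
  2 ^ (⌈log₂ m ⌉ + ⌈log₂ m ⌉)               ≤⟨ ^-monoʳ-≤ 2 (+-mono-≤ log-m log-m) ⟩
  -- With X = ⌈log₂ L⌉ + 2l + 7 the exponent is 4X + 6; this is the origin of 8l + 34.
  2 ^ ((2 * X + 3) + (2 * X + 3))           ≡⟨ cong (2 ^_) (lem l ⌈log₂ L ⌉) ⟩
  2 ^ (4 * ⌈log₂ L ⌉ + (8 * l + 34))        ∎
  where
  open ≤-Reasoning
  e = 4 * L + (8 * l + 34)
  X = suc l + (⌈log₂ L ⌉ + (l + 6))
  log-N : ⌈log₂ suc (Δ * suc e) ⌉ ≤ X
  log-N = begin
    ⌈log₂ suc (Δ * suc e) ⌉           ≤⟨ ⌈log₂⌉-mono-≤ (+-monoˡ-≤ (Δ * suc e) (s≤s (z≤n {e}))) ⟩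
    ⌈log₂ (suc Δ * suc e) ⌉           ≤⟨ ⌈log₂m*n⌉≤ (suc Δ) (suc e) ⟩
    ⌈log₂ suc Δ ⌉ + ⌈log₂ suc e ⌉     ≤⟨ +-mono-≤ (n≤2^k⇒⌈log₂n⌉≤k (suc l) (1+n≤2^[1+k] l Δ≤)) (⌈log₂[4L+B+1]⌉≤ L l) ⟩
    X                                 ∎
  log-m : ⌈log₂ m ⌉ ≤ 2 * X + 3
  log-m = ≤-trans (⌈log₂⌉-near-prime (suc (Δ * suc e)) m≤) (+-monoˡ-≤ 3 (*-monoʳ-≤ 2 log-N))
  lem : ∀ l y → (2 * (suc l + (y + (l + 6))) + 3) + (2 * (suc l + (y + (l + 6))) + 3) ≡ 4 * y + (8 * l + 34)
  lem = solve-∀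

2^⌈log₂n⌉≤2n : ∀ n .{{_ : NonZero n}} → 2 ^ ⌈log₂ n ⌉ ≤ 2 * n
2^⌈log₂n⌉≤2n n with ⌈log₂ n ⌉ in eq
... | zero  = ≤-trans (>-nonZero⁻¹ n) (m≤n*m n 2)
... | suc k = *-monoʳ-≤ 2 (≮⇒≥ {n} {2 ^ k} λ n<2^k → 1+n≰n (subst (_≤ k) eq (n≤2^k⇒⌈log₂n⌉≤k {n} k (<⇒≤ n<2^k))))

-- For m = n / c one has n ≤ (m + 1)c ≤ 2^(m + 4), and the c-th power puts only mc ≤ n besides 4c
-- into the exponent. So a fixed power stays below an exponential of base 2 up to a constant.
n^c≤2^[4c+n] : ∀ c n .{{_ : NonZero c}} → c ≤ 2 ^ 4 → n ^ c ≤ 2 ^ (4 * c + n)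
n^c≤2^[4c+n] c n c≤16 = begin
  n ^ c                   ≤⟨ ^-monoˡ-≤ c n≤ ⟩
  (2 ^ (4 + m)) ^ c       ≡⟨ ^-*-assoc 2 (4 + m) c ⟩
  2 ^ ((4 + m) * c)       ≡⟨ cong (2 ^_) (*-distribʳ-+ c 4 m) ⟩
  2 ^ (4 * c + m * c)     ≤⟨ ^-monoʳ-≤ 2 (+-monoʳ-≤ (4 * c) (m/n*n≤m n c)) ⟩
  2 ^ (4 * c + n)         ∎
  where
  open ≤-Reasoning
  m = n / c
  n≤ : n ≤ 2 ^ (4 + m)
  n≤ = begin
    n                     ≡⟨ m≡m%n+[m/n]*n n c ⟩
    n % c + m * c         ≤⟨ +-monoˡ-≤ (m * c) (<⇒≤ (m%n<n n c)) ⟩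
    suc m * c             ≤⟨ *-mono-≤ (n<2^n m) c≤16 ⟩
    2 ^ m * 2 ^ 4         ≡⟨ *-comm (2 ^ m) (2 ^ 4) ⟩
    2 ^ 4 * 2 ^ m         ≡⟨ ^-distribˡ-+-* 2 4 m ⟨
    2 ^ (4 + m)           ∎

^-cancel-≤ : ∀ k {m n} .{{_ : NonZero k}} → m ^ k ≤ n ^ k → m ≤ n
^-cancel-≤ k mᵏ≤nᵏ = ≮⇒≥ λ n<m → <⇒≱ (^-monoˡ-< k n<m) mᵏ≤nᵏ

-- a⁴ ≤ 4 · 2^{2l} and L¹⁶ = O(2^l), while k⁴ ≥ Δ³ ≥ 2^{3l} / 8.
[aL⁴]⁴-bound : ∀ x a l {Δ k} → let L = suc l in
  a * a ≤ 2 ^ suc l → L ^ 16 ≤ 2 ^ (x + L) → 2 ^ l ≤ 2 * Δ → Δ ^ 3 ≤ k ^ 4 →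
  (a * (L * L * L * L)) ^ 4 ≤ 2 ^ ((x + 3) + 3) * k ^ 4
[aL⁴]⁴-bound x a l {Δ} {k} a²≤ L¹⁶≤ 2^l≤ Δ³≤ = begin
  (a * (L * L * L * L)) ^ 4
    ≡⟨ trans (lem₁ a (L * L * L * L)) (cong ((a * a) * (a * a) *_) (trans (cong (_^ 4) (lem₀ L)) (^-*-assoc L 4 4))) ⟩
  (a * a) * (a * a) * L ^ 16
    ≤⟨ ^≤-intro (suc l + suc l) (x + L) (^≤-intro (suc l) (suc l) a²≤ a²≤) L¹⁶≤ ⟩
  2 ^ (suc l + suc l + (x + L))
    ≡⟨ cong (2 ^_) (lem₂ x l) ⟩
  2 ^ ((x + 3) + (l + l + l))
    ≡⟨ trans (^-distribˡ-+-* 2 (x + 3) (l + l + l)) (cong (2 ^ (x + 3) *_) (trans (^-distribˡ-+-* 2 (l + l) l) (cong (_* 2 ^ l) (^-distribˡ-+-* 2 l l)))) ⟩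
  2 ^ (x + 3) * (2 ^ l * 2 ^ l * 2 ^ l)
    ≤⟨ *-monoʳ-≤ (2 ^ (x + 3)) (*-mono-≤ (*-mono-≤ 2^l≤ 2^l≤) 2^l≤) ⟩
  2 ^ (x + 3) * (2 * Δ * (2 * Δ) * (2 * Δ))
    ≡⟨ lem₃ (2 ^ (x + 3)) Δ ⟩
  2 ^ (x + 3) * 2 ^ 3 * Δ ^ 3
    ≤⟨ *-mono-≤ (≤-reflexive (sym (^-distribˡ-+-* 2 (x + 3) 3))) Δ³≤ ⟩
  2 ^ ((x + 3) + 3) * k ^ 4 ∎
  where
  open ≤-Reasoning
  L = suc l
  lem₀ : ∀ L → L * L * L * L ≡ L * (L * (L * (L * 1)))
  lem₀ = solve-∀
  lem₁ : ∀ a y → a * y * (a * y * (a * y * (a * y * 1))) ≡ (a * a) * (a * a) * (y * (y * (y * (y * 1))))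
  lem₁ = solve-∀
  lem₂ : ∀ x l → suc l + suc l + (x + suc l) ≡ (x + 3) + (l + l + l)
  lem₂ = solve-∀
  lem₃ : ∀ x Δ → x * (2 * Δ * (2 * Δ) * (2 * Δ)) ≡ x * 8 * (Δ * (Δ * (Δ * 1)))
  lem₃ = solve-∀

^-*-distrib : ∀ x y k → (x * y) ^ k ≡ x ^ k * y ^ k
^-*-distrib x y zero    = refl
^-*-distrib x y (suc k) = trans (cong (x * y *_) (^-*-distrib x y k)) (lem x y (x ^ k) (y ^ k))
  where
  lem : ∀ x y u v → x * y * (u * v) ≡ x * u * (y * v)
  lem = solve-∀

fourth-root : ∀ e {m c x} → x ≤ 2 ^ (e * 4) → m ^ 4 ≤ x * c ^ 4 → m ≤ 2 ^ e * c
fourth-root e {m} {c} {x} x≤ m⁴≤ = ^-cancel-≤ 4 {m} {2 ^ e * c} (begin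
  m ^ 4                      ≤⟨ m⁴≤ ⟩
  x * c ^ 4                  ≤⟨ *-monoˡ-≤ (c ^ 4) x≤ ⟩
  2 ^ (e * 4) * c ^ 4        ≡⟨ cong (_* c ^ 4) (^-*-assoc 2 e 4) ⟨
  (2 ^ e) ^ 4 * c ^ 4        ≡⟨ ^-*-distrib (2 ^ e) c 4 ⟨
  (2 ^ e * c) ^ 4            ∎)
  where open ≤-Reasoning

-- For l = 0, that is Δ ≤ 1, the product c · l vanishes and the `+ 1` of the round bound has to pay,
-- which suffices as w = 1. Otherwise l + 1 ≤ 2l.
round-arithmetic : ∀ u y c l w → 1 ≤ y → (l ≡ 0 → w ≡ 1) → (NonZero l → w ≤ y * c) → u * w * suc l ≤ 2 * (u * y) * (c * l + 1)
round-arithmetic u y c zero w 1≤y small _ = begin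
  u * w * 1                    ≡⟨ cong (λ z → u * z * 1) (small refl) ⟩
  u * 1 * 1                    ≡⟨ lem₁ u ⟩
  u * 1                        ≤⟨ *-monoʳ-≤ u 1≤y ⟩
  u * y                        ≤⟨ m≤n*m (u * y) 2 ⟩
  2 * (u * y)                  ≡⟨ lem₂ (2 * (u * y)) c ⟩
  2 * (u * y) * (c * 0 + 1)    ∎
  where
  open ≤-Reasoning
  lem₁ : ∀ u → u * 1 * 1 ≡ u * 1
  lem₁ = solve-∀
  lem₂ : ∀ v c → v ≡ v * (c * 0 + 1)
  lem₂ = solve-∀
round-arithmetic u y c l@(suc k) w 1≤y _ large = begin
  u * w * suc l                ≤⟨ *-mono-≤ (*-monoʳ-≤ u (large _)) (+-monoˡ-≤ l (s≤s (z≤n {k}))) ⟩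
  u * (y * c) * (l + l)        ≡⟨ lem u y c l ⟩
  2 * (u * y) * (c * l)        ≤⟨ *-monoʳ-≤ (2 * (u * y)) (m≤m+n (c * l) 1) ⟩
  2 * (u * y) * (c * l + 1)    ∎
  where
  open ≤-Reasoning
  lem : ∀ u y c l → u * (y * c) * (l + l) ≡ 2 * (u * y) * (c * l)
  lem = solve-∀

round-count : ∀ u y n Δ {l L w T stagesLength} → l ≡ ⌈log₂ Δ ⌉ → L ≡ suc l → 1 ≤ y →
  (l ≡ 0 → w ≡ 1) → (NonZero l → w ≤ y * ceil34 Δ) →
  T ≡ logStar n * 1 + stagesLength → stagesLength ≤ u * w * L → T ≤ roundBound (2 * (u * y)) n Δ
round-count u y n Δ {l} {w = w} {stagesLength = X} refl refl 1≤y small large refl X≤ = begin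
  logStar n * 1 + X                                    ≡⟨ cong (_+ X) (*-identityʳ (logStar n)) ⟩
  logStar n + X                                        ≤⟨ +-monoʳ-≤ (logStar n) (≤-trans X≤ (round-arithmetic u y (ceil34 Δ) l w 1≤y small large)) ⟩
  logStar n + 2 * (u * y) * (ceil34 Δ * l + 1)         ≡⟨ +-comm (logStar n) _ ⟩
  roundBound (2 * (u * y)) n Δ                         ∎
  where open ≤-Reasoning

+-≤-2^ : ∀ k {m n} → m ≤ 2 ^ k → n ≤ 2 ^ k → m + n ≤ 2 ^ suc k
+-≤-2^ k m≤ n≤ = ≤-trans (+-mono-≤ m≤ n≤) (≤-reflexive (cong ((2 ^ k) +_) (sym (+-identityʳ (2 ^ k)))))

product-bound : ∀ {A n T B c r p e₀ e₁ e₂ e₃ e₄ e₅ e} → A ≤ 2 ^ e → n ≤ 2 ^ e₀ → T ≤ 2 ^ e₁ → B ≤ 2 ^ e₂ → c ≤ 2 ^ e₃ → r ≤ 2 ^ e₄ →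
  p ≤ 2 ^ e₅ → e₀ + (e₁ + (e₂ + (e₃ + (e₄ + e₅)))) ≡ e → A + n * (T * (B * (c * (r * p)))) ≤ 2 ^ suc e
product-bound {e₀ = e₀} {e₁} {e₂} {e₃} {e₄} {e₅} {e} A≤ n≤ T≤ B≤ c≤ r≤ p≤ refl = ≤-trans
  (+-mono-≤ A≤ (^≤-intro e₀ _ n≤ (^≤-intro e₁ _ T≤ (^≤-intro e₂ _ B≤ (^≤-intro e₃ _ c≤ (^≤-intro e₄ e₅ r≤ p≤))))))
  (≤-reflexive (cong ((2 ^ e) +_) (sym (+-identityʳ (2 ^ e)))))

-- From 2 ≤ n + 1 and 2^ν ≤ 2n ≤ (n + 1)²; the square doubles the coefficient `y`.
2^⌈log₂⌉-polynomial : ∀ x y n .{{_ : NonZero n}} {ν} → ν ≡ ⌈log₂ n ⌉ → 2 ^ suc (x + y * ν) ≤ suc n ^ (suc x + 2 * y)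
2^⌈log₂⌉-polynomial x y n {ν} refl = begin
  2 ^ (suc x + y * ν)              ≡⟨ ^-distribˡ-+-* 2 (suc x) (y * ν) ⟩
  2 ^ suc x * 2 ^ (y * ν)          ≡⟨ cong (λ e → 2 ^ suc x * 2 ^ e) (*-comm y ν) ⟩
  2 ^ suc x * 2 ^ (ν * y)          ≡⟨ cong (2 ^ suc x *_) (^-*-assoc 2 ν y) ⟨
  2 ^ suc x * (2 ^ ν) ^ y          ≤⟨ *-mono-≤ (^-monoˡ-≤ (suc x) 2≤1+n) (^-monoˡ-≤ y 2^ν≤) ⟩
  suc n ^ suc x * (suc n ^ 2) ^ y  ≡⟨ cong (suc n ^ suc x *_) (^-*-assoc (suc n) 2 y) ⟩
  suc n ^ suc x * suc n ^ (2 * y)  ≡⟨ ^-distribˡ-+-* (suc n) (suc x) (2 * y) ⟨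
  suc n ^ (suc x + 2 * y)          ∎
  where
  open ≤-Reasoning
  2≤1+n : 2 ≤ suc n
  2≤1+n = s≤s (>-nonZero⁻¹ n)
  2^ν≤ : 2 ^ ν ≤ suc n ^ 2
  2^ν≤ = ≤-trans (2^⌈log₂n⌉≤2n n) (*-mono-≤ 2≤1+n (≤-trans (n≤1+n n) (≤-reflexive (sym (*-identityʳ (suc n))))))

module Parameters (n Δ : ℕ) where

  l ν d S a : ℕ
  l = ⌈log₂ Δ ⌉
  ν = ⌈log₂ n ⌉
  d = 8 * l + 34
  S = suc d
  a = 2 ^ ⌈ l /2⌉

  -- p is about √Δ log Δ, so that the palette fits into the p × p grid, and q about p (log Δ)²,
  -- large enough for every vertex to find a class in which it has few out-neighbours.
  p-exists : ∃[ p ] (Prime p × a < p × p ≤ 4 * a * (2 + ⌈log₂ a ⌉))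
  p-exists = primeAbove a {{m^n≢0 2 ⌈ l /2⌉}}

  p : ℕ
  p = proj₁ p-exists

  p-prime : Prime p
  p-prime = proj₁ (proj₂ p-exists)

  W : ℕ
  W = 2 * (p * S) * (2 * S)

  W≢0 : NonZero W
  W≢0 = m*n≢0 (2 * (p * S)) (2 * S) {{m*n≢0 2 (p * S) {{_}} {{m*n≢0 p S {{prime⇒nonZero p-prime}}}}}}

  q-exists : ∃[ q ] (Prime q × W < q × q ≤ 4 * W * (2 + ⌈log₂ W ⌉))
  q-exists = primeAbove W {{W≢0}}

  q : ℕ
  q = proj₁ q-exists

  q-prime : Prime q
  q-prime = proj₁ (proj₂ q-exists)

  W≤q : W ≤ q
  W≤q = <⇒≤ (proj₁ (proj₂ (proj₂ q-exists)))

  -- The index is one ahead: the identifiers already have only ⌈log₂ n⌉ bits, and after log* n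
  -- rounds the iterated logarithm is at most 1, so the next one is 0 and exactly `d` bits remain.
  bits : ℕ → ℕ
  bits i = 4 * iterLog n (suc i) + d

  modulus-exists : ∀ i → let N = suc (Δ * suc (bits i)) in ∃[ m ] (Prime m × N < m × m ≤ 4 * N * (2 + ⌈log₂ N ⌉))
  modulus-exists i = primeAbove (suc (Δ * suc (bits i)))

  Ψ : ℕ
  Ψ = 2 ^ bits 0

  Δ≤2^l : Δ ≤ 2 ^ l
  Δ≤2^l = n≤2^⌈log₂n⌉ Δ

  h+h≤1+l : ⌈ l /2⌉ + ⌈ l /2⌉ ≤ suc l
  h+h≤1+l = ≤-trans (+-monoˡ-≤ ⌈ l /2⌉ (≤-trans (⌈n/2⌉≤1+⌊n/2⌋ l) ≤-refl)) (≤-reflexive (cong suc (⌊n/2⌋+⌈n/2⌉≡n l)))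
    where
    ⌈n/2⌉≤1+⌊n/2⌋ : ∀ n → ⌈ n /2⌉ ≤ suc ⌊ n /2⌋
    ⌈n/2⌉≤1+⌊n/2⌋ zero = z≤n
    ⌈n/2⌉≤1+⌊n/2⌋ (suc zero) = ≤-refl
    ⌈n/2⌉≤1+⌊n/2⌋ (suc (suc n)) = s≤s (⌈n/2⌉≤1+⌊n/2⌋ n)

  Δ<p² : Δ < p * p
  Δ<p² = begin-strict
    Δ                              ≤⟨ Δ≤2^l ⟩
    2 ^ l                          ≤⟨ ^-monoʳ-≤ 2 (≤-trans (≤-reflexive (sym (⌊n/2⌋+⌈n/2⌉≡n l))) (+-monoˡ-≤ ⌈ l /2⌉ (⌊n/2⌋≤⌈n/2⌉ l))) ⟩
    2 ^ (⌈ l /2⌉ + ⌈ l /2⌉)        ≡⟨ ^-distribˡ-+-* 2 ⌈ l /2⌉ ⌈ l /2⌉ ⟩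
    a * a                          <⟨ *-mono-< a<p a<p ⟩
    p * p                          ∎
    where
    open ≤-Reasoning
    a<p : a < p
    a<p = proj₁ (proj₂ (proj₂ p-exists))

  State : Set
  State = Rounds.State Δ Ψ p q d p-prime q-prime Δ<p²

  halve : ℕ → ℕ → ℕ
  halve = Rounds.halve Δ Ψ p q d p-prime q-prime Δ<p²

  schedule : Rounds.LinialSchedule Δ Ψ p q d p-prime q-prime Δ<p²
  schedule = record
    { bits      = bits
    ; modulus   = λ i → proj₁ (modulus-exists i)
    ; prime-mod = λ i → proj₁ (proj₂ (modulus-exists i))
    ; fits      = λ i → ≤-trans (next i) (^-monoʳ-≤ 2 (+-monoˡ-≤ d (*-monoʳ-≤ 4 (iterLog-≤ n (suc i)))))
    ; large     = λ i → <-trans (n<1+n _) (proj₁ (proj₂ (proj₂ (modulus-exists i))))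
    ; next-bits = next
    }
    where
    next : ∀ i → proj₁ (modulus-exists i) * proj₁ (modulus-exists i) ≤ 2 ^ bits (suc i)
    next i = next-bits-bound Δ l (iterLog n (suc i)) Δ≤2^l (proj₂ (proj₂ (proj₂ (modulus-exists i))))

  bits-logStar : bits (logStar n) ≡ d
  bits-logStar = cong (λ z → 4 * z + d) (⌈log₂≤1⌉ (iterLog n (logStar n)) (iterLog-logStar n))
    where
    ⌈log₂≤1⌉ : ∀ m → m ≤ 1 → ⌈log₂ m ⌉ ≡ 0
    ⌈log₂≤1⌉ zero _ = refl
    ⌈log₂≤1⌉ (suc zero) _ = refl
    ⌈log₂≤1⌉ (suc (suc m)) (s≤s ())

  n≤2^bits0 : n ≤ 2 ^ bits 0
  n≤2^bits0 = ^-2-mono (≤-trans (m≤n*m ν 4) (m≤m+n (4 * ν) d)) (n≤2^⌈log₂n⌉ n)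

  halve-< : ∀ i j E → E < 2 ^ (i + j) → halve i E < 2 ^ j
  halve-< zero    j E E< = E<
  halve-< (suc i) j E E< = half (halve-< i (suc j) E (subst (λ z → E < 2 ^ z) (sym (+-suc i j)) E<))
    where
    half : ∀ {m k} → m < 2 * k → ⌊ m /2⌋ < k
    half {m} {k} m<2k = *-cancelˡ-< 2 _ _ (≤-<-trans (≤-trans (≤-reflexive (cong (⌊ m /2⌋ +_) (+-identityʳ _)))
      (≤-trans (+-monoʳ-≤ ⌊ m /2⌋ (⌊n/2⌋≤⌈n/2⌉ m)) (≤-reflexive (⌊n/2⌋+⌈n/2⌉≡n m)))) m<2k)

  halve-exhausts : halve (2 + l) (suc (2 * Δ)) ≡ 0
  halve-exhausts = n<1⇒n≡0 (halve-< (2 + l) 0 (suc (2 * Δ)) (begin-strict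
    suc (2 * Δ)              <⟨ n<1+n _ ⟩
    2 + 2 * Δ                ≤⟨ +-mono-≤ (*-monoʳ-≤ 2 (m^n>0 2 l)) (*-monoʳ-≤ 2 Δ≤2^l) ⟩
    2 * 2 ^ l + 2 * 2 ^ l    ≡⟨ cong ((2 * 2 ^ l) +_) (+-identityʳ _) ⟨
    2 ^ (2 + l)              ≡⟨ cong (2 ^_) (+-identityʳ (2 + l)) ⟨
    2 ^ (2 + l + 0)          ∎))
    where open ≤-Reasoning

  program : List (Step State)
  program = Rounds.linialRounds Δ Ψ p q d p-prime q-prime Δ<p² schedule (logStar n) ++ Rounds.stages Δ Ψ p q d p-prime q-prime Δ<p² (2 + l) (suc (2 * Δ))

  length-program : length program ≡ logStar n * 1 + (2 + l) * suc (q * 1 + q * 2)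
  length-program = trans (Listₚ.length-++ (Rounds.linialRounds Δ Ψ p q d p-prime q-prime Δ<p² schedule (logStar n)))
    (cong₂ _+_ (length-forEach (logStar n) _ 1 (λ _ → refl)) (Rounds.length-stages Δ Ψ p q d p-prime q-prime Δ<p² (2 + l) (suc (2 * Δ))))

  start : Fin n → State
  start v = Rounds.state (Fin.inject≤ v n≤2^bits0) nothing nothing (0 mod p)
    where instance _ = prime⇒nonZero p-prime

  output : State → Fin (suc Δ)
  output = fromMaybe zero ∘ Rounds.State.final

  program-correct : (G : Graph n) → (∀ v → degree G v ≤ Δ) → ∀ σ → Runs G program start σ → Proper G (output ∘ σ)
  program-correct G deg≤Δ σ r = Rounds.colouring-correct Δ Ψ p q d p-prime q-prime Δ<p² G deg≤Δ W≤q schedule (logStar n) (2 + l) bits-logStar halve-exhausts r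
    (λ u v uv eq → true≢false uv (subst (λ w → adj G u w ≡ false) (Finₚ.inject≤-injective n≤2^bits0 n≤2^bits0 u v eq) (irrefl G u)))
    (λ v → subst (_< 2 ^ bits 0) (sym (Finₚ.toℕ-inject≤ v n≤2^bits0)) (<-≤-trans (Finₚ.toℕ<n v) n≤2^bits0))
    (λ _ → refl)

  0<length : 0 < length program
  0<length = subst (0 <_) (sym length-program) (≤-trans (s≤s z≤n) (m≤n+m _ (logStar n * 1)))

  state-finite : Finite State
  state-finite = Rounds.state-finite Δ Ψ p q d p-prime q-prime Δ<p²

  -- The type index `Δ₀` is kept apart from `Δ`, for which a capped degree will be substituted.
  algorithm : (Δ₀ : ℕ) → LocIter n Δ₀
  algorithm Δ₀ = Simulation.algorithm state-finite n Δ₀ (suc Δ) program start output 0<length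

  algorithm-correct : (G : Graph n) → (∀ v → degree G v ≤ Δ) → ∀ Δ₀ →
    (∀ t → Proper G (run (algorithm Δ₀) G t)) × (∀ v → toℕ (run (algorithm Δ₀) G (length program) v) < suc Δ)
  algorithm-correct G deg≤Δ Δ₀ =
    Simulation.correct state-finite n Δ₀ (suc Δ) program start output 0<length G (program-correct G deg≤Δ)

  -- The number of rounds

  L : ℕ
  L = suc l

  h≤l : ⌈ l /2⌉ ≤ l
  h≤l = ⌈n/2⌉≤n l

  ⌈log₂a⌉ : ⌈log₂ a ⌉ ≡ ⌈ l /2⌉
  ⌈log₂a⌉ = ⌈log₂2^n⌉≡n ⌈ l /2⌉

  p-bound : p ≤ 2 ^ 3 * (a * L)
  p-bound = begin
    p                              ≤⟨ proj₂ (proj₂ (proj₂ p-exists)) ⟩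
    4 * a * (2 + ⌈log₂ a ⌉)        ≡⟨ cong (λ z → 4 * a * (2 + z)) ⌈log₂a⌉ ⟩
    4 * a * (2 + ⌈ l /2⌉)          ≤⟨ *-monoʳ-≤ (4 * a) (≤-trans (+-monoʳ-≤ 2 h≤l) (s≤s (s≤s (m≤n+m l l)))) ⟩
    4 * a * (2 + (l + l))          ≡⟨ lem a l ⟩
    2 ^ 3 * (a * L)                ∎
    where
    open ≤-Reasoning
    lem : ∀ a l → 4 * a * (2 + (l + l)) ≡ 8 * (a * suc l)
    lem = solve-∀

  S-bound : S ≤ 2 ^ 6 * L
  S-bound = begin
    suc (8 * l + 34)      ≡⟨ +-suc (8 * l) 34 ⟨
    8 * l + 35            ≤⟨ +-mono-≤ (*-monoˡ-≤ l (m≤m+n 8 56)) (m≤m+n 35 29) ⟩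
    64 * l + 64           ≡⟨ +-comm (64 * l) 64 ⟩
    64 + 64 * l           ≡⟨ *-suc 64 l ⟨
    2 ^ 6 * L             ∎
    where open ≤-Reasoning

  W-bound : W ≤ 2 ^ 17 * (a * (L * L * L))
  W-bound = begin
    2 * (p * S) * (2 * S)
      ≤⟨ *-mono-≤ (*-monoʳ-≤ 2 (*-mono-≤ p-bound S-bound)) (*-monoʳ-≤ 2 S-bound) ⟩
    2 * (2 ^ 3 * (a * L) * (2 ^ 6 * L)) * (2 * (2 ^ 6 * L))
      ≡⟨ lem (2 ^ 3) (2 ^ 6) a L ⟩
    4 * (2 ^ 3 * (2 ^ 6 * 2 ^ 6)) * (a * (L * L * L))
      ≡⟨ cong (_* (a * (L * L * L))) 2^17≡ ⟩
    2 ^ 17 * (a * (L * L * L)) ∎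
    where
    open ≤-Reasoning
    2^17≡ : 4 * (2 ^ 3 * (2 ^ 6 * 2 ^ 6)) ≡ 2 ^ 17
    2^17≡ = refl
    lem : ∀ x y a L → 2 * (x * (a * L) * (y * L)) * (2 * (y * L)) ≡ 4 * (x * (y * y)) * (a * (L * L * L))
    lem = solve-∀

  L≤2^l : L ≤ 2 ^ l
  L≤2^l = n<2^n l

  ⌈log₂W⌉-bound : 2 + ⌈log₂ W ⌉ ≤ 2 ^ 5 * L
  ⌈log₂W⌉-bound = begin
    2 + ⌈log₂ W ⌉                            ≤⟨ +-monoʳ-≤ 2 (n≤2^k⇒⌈log₂n⌉≤k (17 + (⌈ l /2⌉ + (l + l + l))) W≤) ⟩
    2 + (17 + (⌈ l /2⌉ + (l + l + l)))       ≤⟨ +-monoʳ-≤ 19 (+-monoˡ-≤ (l + l + l) h≤l) ⟩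
    19 + (l + (l + l + l))                   ≤⟨ +-mono-≤ (m≤m+n 19 13) (m≤m+n (l + (l + l + l)) (28 * l)) ⟩
    32 + ((l + (l + l + l)) + 28 * l)        ≡⟨ lem l ⟩
    2 ^ 5 * L                                ∎
    where
    open ≤-Reasoning
    lem : ∀ l → 32 + ((l + (l + l + l)) + 28 * l) ≡ 32 * suc l
    lem = solve-∀
    W≤ : W ≤ 2 ^ (17 + (⌈ l /2⌉ + (l + l + l)))
    W≤ = ≤-trans W-bound (^≤-intro 17 (⌈ l /2⌉ + (l + l + l)) ≤-refl (^≤-intro ⌈ l /2⌉ (l + l + l) ≤-refl
           (^≤-intro (l + l) l (^≤-intro l l L≤2^l L≤2^l) L≤2^l)))

  q-bound : q ≤ 2 ^ 24 * (a * (L * L * L * L))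
  q-bound = begin
    q                                                       ≤⟨ proj₂ (proj₂ (proj₂ q-exists)) ⟩
    4 * W * (2 + ⌈log₂ W ⌉)                                 ≤⟨ *-mono-≤ (*-monoʳ-≤ 4 W-bound) ⌈log₂W⌉-bound ⟩
    4 * (2 ^ 17 * (a * (L * L * L))) * (2 ^ 5 * L)          ≡⟨ lem (2 ^ 17) (2 ^ 5) a L ⟩
    (4 * (2 ^ 17 * 2 ^ 5)) * (a * (L * L * L * L))          ≡⟨ cong (_* (a * (L * L * L * L))) 2^24≡ ⟩
    2 ^ 24 * (a * (L * L * L * L))                          ∎
    where
    open ≤-Reasoning
    2^24≡ : 4 * (2 ^ 17 * 2 ^ 5) ≡ 2 ^ 24
    2^24≡ = refl
    lem : ∀ x y a L → 4 * (x * (a * (L * L * L))) * (y * L) ≡ (4 * (x * y)) * (a * (L * L * L * L))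
    lem = solve-∀

  stages-length-bound : (2 + l) * suc (q * 1 + q * 2) ≤ 2 ^ 27 * (a * (L * L * L * L)) * L
  stages-length-bound = begin
    (2 + l) * suc (q * 1 + q * 2)                        ≤⟨ *-mono-≤ (s≤s (s≤s (m≤n+m l l))) (+-monoˡ-≤ (q * 1 + q * 2) (>-nonZero⁻¹ q {{prime⇒nonZero q-prime}})) ⟩
    (2 + (l + l)) * (q + (q * 1 + q * 2))                ≡⟨ lem l q ⟩
    8 * q * L                                            ≤⟨ *-monoˡ-≤ L (*-monoʳ-≤ 8 q-bound) ⟩
    8 * (2 ^ 24 * (a * (L * L * L * L))) * L             ≡⟨ cong (_* L) (*-assoc 8 (2 ^ 24) (a * (L * L * L * L))) ⟨
    8 * 2 ^ 24 * (a * (L * L * L * L)) * L               ≡⟨ cong (λ z → z * (a * (L * L * L * L)) * L) 2^27≡ ⟩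
    2 ^ 27 * (a * (L * L * L * L)) * L                   ∎
    where
    open ≤-Reasoning
    2^27≡ : 8 * 2 ^ 24 ≡ 2 ^ 27
    2^27≡ = refl
    lem : ∀ l q → (2 + (l + l)) * (q + (q * 1 + q * 2)) ≡ 8 * q * suc l
    lem = solve-∀

  aL⁴≤ceil34 : .{{_ : NonZero Δ}} → a * (L * L * L * L) ≤ 2 ^ 18 * ceil34 Δ
  -- L¹⁶ ≤ 2^(64 + L) leads to the constant 2^70 in the inequality of fourth powers; rounding 70 up
  -- to 72 = 18 · 4 gives the factor 2^18 after taking the root.
  aL⁴≤ceil34 = fourth-root 18 {a * (L * L * L * L)} {ceil34 Δ} {2 ^ (4 * 16 + 3 + 3)} (^-monoʳ-≤ 2 {4 * 16 + 3 + 3} {18 * 4} (m≤m+n 70 2))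
    ([aL⁴]⁴-bound (4 * 16) a l {Δ} {ceil34 Δ} a²≤ (n^c≤2^[4c+n] 16 (suc l) ≤-refl) (2^⌈log₂n⌉≤2n Δ) (Δ³≤ceil34⁴ Δ))
    where
    a²≤ : a * a ≤ 2 ^ suc l
    a²≤ = ≤-trans (≤-reflexive (sym (^-distribˡ-+-* 2 ⌈ l /2⌉ ⌈ l /2⌉))) (^-monoʳ-≤ 2 h+h≤1+l)

  rounds-bound : length program ≤ roundBound (2 * (2 ^ 27 * 2 ^ 18)) n Δ
  rounds-bound = round-count (2 ^ 27) (2 ^ 18) n Δ {l} {L} {a * (L * L * L * L)} refl refl (m^n>0 2 18)
    (cong (λ z → 2 ^ ⌈ z /2⌉ * (suc z * suc z * suc z * suc z)))
    (λ l≢0 → aL⁴≤ceil34 {{≢-nonZero λ Δ≡0 → ≢-nonZero⁻¹ l {{l≢0}} (cong ⌈log₂_⌉ Δ≡0)}})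
    length-program stages-length-bound

  -- The size of the colour space

  module _ .{{_ : NonZero n}} (Δ≤n : Δ ≤ n) where

    l≤ν : l ≤ ν
    l≤ν = ⌈log₂⌉-mono-≤ Δ≤n

    Δ≤2^ν : Δ ≤ 2 ^ ν
    Δ≤2^ν = ^-2-mono l≤ν Δ≤2^l

    a≤2^ν : a ≤ 2 ^ ν
    a≤2^ν = ^-monoʳ-≤ 2 (≤-trans h≤l l≤ν)

    L≤2^ν : L ≤ 2 ^ ν
    L≤2^ν = ^-2-mono l≤ν L≤2^l

    L⁴≤2^ : L * L * L * L ≤ 2 ^ (ν + ν + ν + ν)
    L⁴≤2^ = ^≤-intro (ν + ν + ν) ν (^≤-intro (ν + ν) ν (^≤-intro ν ν L≤2^ν L≤2^ν) L≤2^ν) L≤2^ν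

    p≤2^ : p ≤ 2 ^ (3 + (ν + ν))
    p≤2^ = ≤-trans p-bound (^≤-intro 3 (ν + ν) ≤-refl (^≤-intro ν ν a≤2^ν L≤2^ν))

    q≤2^ : q ≤ 2 ^ (24 + (ν + (ν + ν + ν + ν)))
    q≤2^ = ≤-trans q-bound (^≤-intro 24 (ν + (ν + ν + ν + ν)) ≤-refl (^≤-intro ν (ν + ν + ν + ν) a≤2^ν L⁴≤2^))

    length≤2^ : length program ≤ 2 ^ suc (27 + (ν + (ν + ν + ν + ν)) + ν)
    length≤2^ = subst (_≤ 2 ^ suc (27 + (ν + (ν + ν + ν + ν)) + ν)) (sym length-program)
      (+-≤-2^ (27 + (ν + (ν + ν + ν + ν)) + ν)
        (≤-trans (≤-reflexive (*-identityʳ (logStar n))) (≤-trans (logStar≤n n)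
          (^-2-mono {k = ν} {27 + (ν + (ν + ν + ν + ν)) + ν} (m≤n+m ν (27 + (ν + (ν + ν + ν + ν)))) (n≤2^⌈log₂n⌉ n))))
        (≤-trans stages-length-bound (^≤-intro (27 + (ν + (ν + ν + ν + ν))) ν
          (^≤-intro 27 (ν + (ν + ν + ν + ν)) ≤-refl (^≤-intro ν (ν + ν + ν + ν) a≤2^ν L⁴≤2^)) L≤2^ν)))

    Ψ≤2^ : Ψ ≤ 2 ^ (4 * ν + (8 * ν + 34))
    Ψ≤2^ = ^-monoʳ-≤ 2 (+-monoʳ-≤ (4 * ν) (+-monoˡ-≤ 34 (*-monoʳ-≤ 8 l≤ν)))

    -- The summands bound, in this order, the bit lengths of the identifier, the clock, `base`,
    -- `final`, `class` and `part`.
    exponents : ∀ ν → let w = 24 + (ν + (ν + ν + ν + ν)) in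
      ν + (suc (27 + (ν + (ν + ν + ν + ν)) + ν) + ((4 * ν + (8 * ν + 34)) + ((2 + ν) + (suc (w + w) + (3 + (ν + ν)))))) ≡ 116 + 32 * ν
    exponents = solve-∀

    size-bound : ∀ Δ₀ → M (algorithm Δ₀) ≤ suc n ^ (suc 116 + 2 * 32)
    size-bound Δ₀ = ≤-trans (≤-reflexive M≡) (≤-trans
      (product-bound {suc Δ} {n} {length program} {Ψ} {suc (suc Δ)} {suc (q * q)} {p}
        {ν} {suc (27 + (ν + (ν + ν + ν + ν)) + ν)} {4 * ν + (8 * ν + 34)} {2 + ν} {suc ((24 + (ν + (ν + ν + ν + ν))) + (24 + (ν + (ν + ν + ν + ν))))} {3 + (ν + ν)} {116 + 32 * ν}
        (^-2-mono {k = suc ν} {116 + 32 * ν} (+-mono-≤ (m≤m+n 1 115) (m≤n*m ν 32)) (1+n≤2^[1+k] ν Δ≤2^ν))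
        (n≤2^⌈log₂n⌉ n) length≤2^ Ψ≤2^
        (1+n≤2^[1+k] (suc ν) (1+n≤2^[1+k] ν Δ≤2^ν))
        (1+n≤2^[1+k] ((24 + (ν + (ν + ν + ν + ν))) + (24 + (ν + (ν + ν + ν + ν)))) (^≤-intro (24 + (ν + (ν + ν + ν + ν))) (24 + (ν + (ν + ν + ν + ν))) q≤2^ q≤2^))
        p≤2^ (exponents ν))
      (2^⌈log₂⌉-polynomial 116 32 n {ν} refl))
      where
      M≡ : M (algorithm Δ₀) ≡ suc Δ + n * (length program * (Ψ * (suc (suc Δ) * (suc (q * q) * p))))
      M≡ = refl

-- A graph on n vertices has maximum degree at most n; capping Δ keeps the colour space polynomial in n.
algorithmFor : (n Δ : ℕ) → LocIter n Δ
algorithmFor n Δ = Parameters.algorithm n (Δ ⊓ n) Δ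

colours-bound : ∀ n Δ → M (algorithmFor n Δ) ≤ suc n ^ (suc 116 + 2 * 32)
-- Without vertices only the block of outputs remains; it has one colour, as the capped degree is 0.
colours-bound zero Δ = ≤-trans (≤-reflexive (trans (+-identityʳ _) (cong suc (⊓-zeroʳ Δ)))) (≤-reflexive (sym (^-zeroˡ (suc 116 + 2 * 32))))
colours-bound n@(suc _) Δ = Parameters.size-bound n (Δ ⊓ n) (m⊓n≤n Δ n) Δ

degree≤n : ∀ {n} (G : Graph n) v → degree G v ≤ n
degree≤n {n} G v = ≤-trans (m≤m+n _ _) (≤-reflexive (count-not (adj G v)))

algorithmFor-correct : ∀ n Δ (G : Graph n) → maxDegree G ≡ Δ →
  (∀ t → Proper G (run (algorithmFor n Δ) G t)) ×
  (∃[ t ] (t ≤ roundBound (2 * (2 ^ 27 * 2 ^ 18)) n Δ × (∀ v → toℕ (run (algorithmFor n Δ) G t v) ≤ Δ)))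
algorithmFor-correct n Δ G max≡Δ =
  let proper , final = Parameters.algorithm-correct n (Δ ⊓ n) G (λ v → ⊓-glb (deg≤Δ v) (degree≤n G v)) Δ
  in proper , length (Parameters.program n (Δ ⊓ n)) ,
     subst (λ z → length (Parameters.program n (Δ ⊓ n)) ≤ roundBound (2 * (2 ^ 27 * 2 ^ 18)) n z) Δ⊓n≡Δ (Parameters.rounds-bound n (Δ ⊓ n)) ,
     λ v → ≤-trans (≤-pred (final v)) (m⊓n≤m Δ n)
  where
  deg≤Δ : ∀ v → degree G v ≤ Δ
  deg≤Δ v = subst (degree G v ≤_) max≡Δ (≤-maxFin (degree G) v)
  Δ⊓n≡Δ : Δ ⊓ n ≡ Δ
  Δ⊓n≡Δ = m≤n⇒m⊓n≡m (subst (_≤ n) max≡Δ (maxFin≤ (degree≤n G)))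

theorem1p3 : Σ[ A ∈ ((n Δ : ℕ) → LocIter n Δ) ] Σ[ c ∈ ℕ ] Σ[ C ∈ ℕ ]
    ( (∀ n Δ → M (A n Δ) ≤ suc n ^ c)
    × (∀ n Δ (G : Graph n) → maxDegree G ≡ Δ →
    (∀ t → Proper G (run (A n Δ) G t))
    × (∃[ t ] (t ≤ roundBound C n Δ × (∀ v → toℕ (run (A n Δ) G t v) ≤ Δ)))) )
theorem1p3 = algorithmFor , suc 116 + 2 * 32 , 2 * (2 ^ 27 * 2 ^ 18) , colours-bound , algorithmFor-correct
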